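{- Let $q>1$ be a prime power, let $V$ be a vector space of dimension $7$ over $\mathbb{F}_q$, and let $D$ be a $q$-analog of the Fano plane in $V$. Assume that there exists a hyperplane $H$ of $V$ such that all points of $H$ are $\alpha$-points of $D$. Then the following two statements, which are equivalent to each other, hold: (a) The line set of the symplectic generalized quadrangle $W(q)$ is partitionable into spreads of $W(q)$. (b) The point set of the parabolic quadric $Q(4,q)$ is partitionable into ovoids of $Q(4,q)$.
   Context: A $k$-subspace is a subspace of dimension $k$ over $\mathbb{F}_q$. The $1$-subspaces are called points, the $2$-subspaces lines, the $3$-subspaces planes, the $4$-subspaces solids, and the $6$-subspaces of the $7$-dimensional space $V$ hyperplanes. A $q$-analog of the Fano plane in $V$ (a $2$-$(7,3,1)_q$ subspace design) is a set $D$ of $3$-subspaces of $V$ (called blocks) such that each $2$-subspace of $V$ is contained in exactly one block. A line spread of a vector space $W$ over $\mathbb{F}_q$ is a set $\mathcal{S}$ of $2$-subspaces of $W$ such that each point of $W$ is contained in exactly one element of $\mathcal{S}$. It is called geometric if for any two distinct $B,B'\in\mathcal{S}$, the set $\{L\in\mathcal{S}\mid L\leq B+B'\}$ is a line spread of $B+B'$. For a point $P$ of $V$, the derived design of $D$ in $P$ is $\{B/P\mid B\in D,\ P\leq B\}$; it is a line spread of the $6$-dimensional space $V/P$. The point $P$ is called an $\alpha$-point of $D$ if the derived design of $D$ in $P$ is a geometric line spread. $W(q)$ is the incidence structure whose points are all points of $\mathrm{PG}(3,q)=\mathrm{PG}(\mathbb{F}_q^4)$ and whose lines are the $2$-subspaces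 of $\mathbb{F}_q^4$ that are totally isotropic with respect to the alternating bilinear form $(\mathbf{x},\mathbf{y})\mapsto x_1y_2-x_2y_1+x_3y_4-x_4y_3$; incidence is inclusion. $Q(4,q)$ is the incidence structure whose points are the points of $\mathrm{PG}(4,q)=\mathrm{PG}(\mathbb{F}_q^5)$ on which the quadratic form $x_1x_2+x_3x_4+x_5^2$ vanishes, and whose lines are the lines of $\mathrm{PG}(4,q)$ all of whose points are of this kind; incidence is inclusion. A spread of such an incidence structure is a set of its lines such that each of its points is incident with exactly one line of the set. An ovoid is a set of its points such that each of its lines is incident with exactly one point of the set. -}

module Defs where

open import Algebra.Apartness.Bundles using (HeytingField; HeytingCommutativeRing)
open import Algebra.Bundles using (CommutativeRing; AbelianGroup)
open import Algebra.Module.Bundles using (LeftModule)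
import Algebra.Construct.Pointwise as Pointwise
import Algebra.Properties.AbelianGroup as AbelianGroupProperties
import Algebra.Properties.CommutativeSemigroup as CommutativeSemigroupProperties
open import Algebra.Properties.Monoid.Sum using (sum)
open import Data.Fin.Base using (Fin)
open import Data.Fin.Patterns using (0F; 1F; 2F; 3F; 4F)
open import Data.Nat.Base using (ℕ; _^_)
open import Data.Nat.Primality using (Prime)
open import Data.Product using (Σ-syntax; ∃₂; ∃-syntax; ∃!; _×_; _,_)
open import Data.Unit.Base using (tt)
open import Data.Vec.Functional using (Vector)
open import Function.Base using (id; _∘_)
open import Function.Bundles using (Bijection)
open import Level using (0ℓ) renaming (suc to lsuc)
open import Relation.Binary.Bundles using (Setoid)
open import Relation.Binary.Core using (Rel)
open import Relation.Binary.Definitions using (_Respects_)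
open import Relation.Binary.PropositionalEquality using (_≡_; setoid)
open import Relation.Nullary.Negation using (¬_)
open import Relation.Unary as Unary using (Pred; U)
import Relation.Binary.Reasoning.Setoid as ≈-Reasoning

IsPrimePower : ℕ → Set
IsPrimePower q = ∃₂ λ p e → Prime p × q ≡ p ^ e

-- On a finite carrier _≈_ and invertibility are decidable, so a Heyting field
-- is the same as a classical field.
Field : Set₁
Field = HeytingField 0ℓ 0ℓ 0ℓ

commutativeRingOf : Field → CommutativeRing 0ℓ 0ℓ
commutativeRingOf F = HeytingCommutativeRing.commutativeRing (HeytingField.heytingCommutativeRing F)

HasOrder : Field → ℕ → Set
HasOrder F q = Bijection (setoid (Fin q)) (CommutativeRing.setoid (commutativeRingOf F))

record IncidenceStructure : Set₂ where
  field
    points : Setoid (lsuc 0ℓ) 0ℓ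
    lines  : Setoid (lsuc 0ℓ) 0ℓ

  open Setoid points public using () renaming (Carrier to Point; _≈_ to _≈ₚ_)
  open Setoid lines  public using () renaming (Carrier to Line; _≈_ to _≈ₗ_)

  field
    _I_ : Point → Line → Set

  IsSpread : Pred Line 0ℓ → Set₁
  IsSpread S = S Respects _≈ₗ_ × (∀ p → ∃! _≈ₗ_ λ l → S l × p I l)

  IsOvoid : Pred Point 0ℓ → Set₁
  IsOvoid O = O Respects _≈ₚ_ × (∀ l → ∃! _≈ₚ_ λ p → O p × p I l)

  -- The parts of a partition are distinct and nonempty: each element lies in
  -- exactly one part, and a spread or an ovoid of a structure that has points and
  -- lines is nonempty.
  LinesPartitionableIntoSpreads : Set₁
  LinesPartitionableIntoSpreads =
    ∃[ n ] Σ[ S ∈ (Fin n → Pred Line 0ℓ) ]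
      (∀ i → IsSpread (S i)) × (∀ l → ∃! _≡_ λ i → S i l)

  PointsPartitionableIntoOvoids : Set₁
  PointsPartitionableIntoOvoids =
    ∃[ n ] Σ[ O ∈ (Fin n → Pred Point 0ℓ) ]
      (∀ i → IsOvoid (O i)) × (∀ p → ∃! _≡_ λ i → O i p)

module Geometry (F : Field) where

  open CommutativeRing (commutativeRingOf F)

  VectorSpace : Set₁
  VectorSpace = LeftModule ring 0ℓ 0ℓ

  coordinateSpace : ℕ → VectorSpace
  coordinateSpace n = record
    { Carrierᴹ     = Vector Carrier n
    ; _≈ᴹ_         = G._≈_
    ; _+ᴹ_         = G._∙_
    ; _*ₗ_         = λ a x i → a * x i
    ; 0ᴹ           = G.ε
    ; -ᴹ_          = G._⁻¹
    ; isLeftModule = record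
      { isLeftSemimodule = record
        { +ᴹ-isCommutativeMonoid = G.isCommutativeMonoid
        ; isPreleftSemimodule    = record
          { *ₗ-cong      = λ a≈b x≈y i → *-cong a≈b (x≈y i)
          ; *ₗ-zeroˡ     = λ x i → zeroˡ (x i)
          ; *ₗ-distribʳ  = λ x a b i → distribʳ (x i) a b
          ; *ₗ-identityˡ = λ x i → *-identityˡ (x i)
          ; *ₗ-assoc     = λ a b x i → *-assoc a b (x i)
          ; *ₗ-zeroʳ     = λ a i → zeroʳ a
          ; *ₗ-distribˡ  = λ a x y i → distribˡ a (x i) (y i)
          }
        }
      ; -ᴹ‿cong    = G.⁻¹-cong
      ; -ᴹ‿inverse = G.inverse
      }
    }
    where module G = AbelianGroup (Pointwise.abelianGroup (Fin n) +-abelianGroup)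

  module _ (V : VectorSpace) where

    open LeftModule V

    linearCombination : ∀ {n} → Vector Carrier n → Vector Carrierᴹ n → Carrierᴹ
    linearCombination a v = sum +ᴹ-monoid λ i → a i *ₗ v i

    record Subspace : Set₁ where
      field
        Member    : Pred Carrierᴹ 0ℓ
        respects  : Member Respects _≈ᴹ_
        0-closed  : Member 0ᴹ
        +-closed  : ∀ {x y} → Member x → Member y → Member (x +ᴹ y)
        *ₗ-closed : ∀ a {x} → Member x → Member (a *ₗ x)

    record Basis (W : Subspace) (k : ℕ) : Set where
      open Subspace W
      field
        vectors     : Vector Carrierᴹ k
        members     : ∀ i → Member (vectors i)
        independent : ∀ a → linearCombination a vectors ≈ᴹ 0ᴹ → ∀ i → a i ≈ 0#
        spanning    : ∀ {x} → Member x → ∃[ a ] x ≈ᴹ linearCombination a vectors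

    wholeSpace : Subspace
    wholeSpace = record
      { Member    = U
      ; respects  = λ _ → id
      ; 0-closed  = tt
      ; +-closed  = λ _ _ → tt
      ; *ₗ-closed = λ _ _ → tt
      }

    HasDimension : ℕ → Set
    HasDimension = Basis wholeSpace

    -- Equality of k-subspaces (_≐_ below) ignores the basis.
    record KSubspace (k : ℕ) : Set₁ where
      field
        subspace : Subspace
        basis    : Basis subspace k

      open Subspace subspace public

    ProjectivePoint : Set₁
    ProjectivePoint = KSubspace 1

    ProjectiveLine : Set₁
    ProjectiveLine = KSubspace 2

  open Subspace using (Member)
  open KSubspace using (subspace)

  module _ {V : VectorSpace} where

    open LeftModule V

    infix 4 _≤ₛ_ _≤_ _≐_

    _≤ₛ_ : Rel (Subspace V) 0ℓ
    X ≤ₛ Y = Member X Unary.⊆ Member Y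

    _≤_ : ∀ {j k} → KSubspace V j → KSubspace V k → Set
    X ≤ Y = subspace X ≤ₛ subspace Y

    _≐_ : ∀ {j k} → KSubspace V j → KSubspace V k → Set
    X ≐ Y = Member (subspace X) Unary.≐ Member (subspace Y)

    private
      open CommutativeSemigroupProperties
             (AbelianGroup.commutativeSemigroup +ᴹ-abelianGroup) using (interchange)
      open AbelianGroupProperties +ᴹ-abelianGroup
             using (⁻¹-∙-comm; inverseˡ-unique; ⁻¹-involutive)
      open ≈-Reasoning ≈ᴹ-setoid

      -1*x≈-x : ∀ x → (- 1#) *ₗ x ≈ᴹ -ᴹ x
      -1*x≈-x x = inverseˡ-unique _ x (begin
        (- 1#) *ₗ x +ᴹ x          ≈⟨ +ᴹ-congˡ (*ₗ-identityˡ x) ⟨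
        (- 1#) *ₗ x +ᴹ 1# *ₗ x    ≈⟨ *ₗ-distribʳ x (- 1#) 1# ⟨
        (- 1# + 1#) *ₗ x          ≈⟨ *ₗ-cong (-‿inverseˡ 1#) ≈ᴹ-refl ⟩
        0# *ₗ x                   ≈⟨ *ₗ-zeroˡ x ⟩
        0ᴹ                        ∎)

      a*-x≈-a*x : ∀ a x → a *ₗ (-ᴹ x) ≈ᴹ -ᴹ (a *ₗ x)
      a*-x≈-a*x a x = inverseˡ-unique _ _ (begin
        a *ₗ (-ᴹ x) +ᴹ a *ₗ x     ≈⟨ *ₗ-distribˡ a (-ᴹ x) x ⟨
        a *ₗ (-ᴹ x +ᴹ x)          ≈⟨ *ₗ-cong refl (-ᴹ‿inverseˡ x) ⟩
        a *ₗ 0ᴹ                   ≈⟨ *ₗ-zeroʳ a ⟩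
        0ᴹ                        ∎)

    -ᴹ-closed : ∀ (X : Subspace V) {x} → Member X x → Member X (-ᴹ x)
    -ᴹ-closed X x∈X = Subspace.respects X (-1*x≈-x _) (Subspace.*ₗ-closed X (- 1#) x∈X)

    infixl 6 _+ₛ_

    _+ₛ_ : Subspace V → Subspace V → Subspace V
    X +ₛ Y = record
      { Member    = λ z → ∃₂ λ x y → Member X x × Member Y y × z ≈ᴹ x +ᴹ y
      ; respects  = λ z≈z′ (x , y , x∈X , y∈Y , z≈x+y) →
                      x , y , x∈X , y∈Y , ≈ᴹ-trans (≈ᴹ-sym z≈z′) z≈x+y
      ; 0-closed  = 0ᴹ , 0ᴹ , X.0-closed , Y.0-closed , ≈ᴹ-sym (+ᴹ-identityˡ 0ᴹ)
      ; +-closed  = λ (x , y , x∈X , y∈Y , z≈) (x′ , y′ , x′∈X , y′∈Y , z′≈) →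
                      x +ᴹ x′ , y +ᴹ y′ , X.+-closed x∈X x′∈X , Y.+-closed y∈Y y′∈Y ,
                      ≈ᴹ-trans (+ᴹ-cong z≈ z′≈) (interchange x y x′ y′)
      ; *ₗ-closed = λ a (x , y , x∈X , y∈Y , z≈) →
                      a *ₗ x , a *ₗ y , X.*ₗ-closed a x∈X , Y.*ₗ-closed a y∈Y ,
                      ≈ᴹ-trans (*ₗ-cong refl z≈) (*ₗ-distribˡ a x y)
      }
      where
      module X = Subspace X
      module Y = Subspace Y

    -- The quotient space keeps the carrier of V and coarsens its equality.
    congruentModulo : Subspace V → Rel Carrierᴹ 0ℓ
    congruentModulo X x y = Member X (x +ᴹ -ᴹ y)

    private
      module Modulo (X : Subspace V) where
        open Subspace X using (respects; 0-closed; +-closed; *ₗ-closed)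

        infix 4 _~_
        _~_ : Rel Carrierᴹ 0ℓ
        _~_ = congruentModulo X

        reflexive~ : ∀ {x y} → x ≈ᴹ y → x ~ y
        reflexive~ {x} {y} x≈y = respects (begin
          0ᴹ           ≈⟨ -ᴹ‿inverseʳ y ⟨
          y +ᴹ -ᴹ y    ≈⟨ +ᴹ-congʳ x≈y ⟨
          x +ᴹ -ᴹ y    ∎) 0-closed

        -‿cong~ : ∀ {x y} → x ~ y → (-ᴹ x) ~ (-ᴹ y)
        -‿cong~ x~y = respects (≈ᴹ-sym (⁻¹-∙-comm _ _)) (-ᴹ-closed X x~y)

        sym~ : ∀ {x y} → x ~ y → y ~ x
        sym~ {x} {y} x~y = respects (begin
          -ᴹ (x +ᴹ -ᴹ y)       ≈⟨ ⁻¹-∙-comm x (-ᴹ y) ⟨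
          -ᴹ x +ᴹ -ᴹ (-ᴹ y)    ≈⟨ +ᴹ-congˡ (⁻¹-involutive y) ⟩
          -ᴹ x +ᴹ y            ≈⟨ +ᴹ-comm (-ᴹ x) y ⟩
          y +ᴹ -ᴹ x            ∎) (-ᴹ-closed X x~y)

        trans~ : ∀ {x y z} → x ~ y → y ~ z → x ~ z
        trans~ {x} {y} {z} x~y y~z = respects (begin
          (x +ᴹ -ᴹ y) +ᴹ (y +ᴹ -ᴹ z)    ≈⟨ +ᴹ-assoc x (-ᴹ y) (y +ᴹ -ᴹ z) ⟩
          x +ᴹ (-ᴹ y +ᴹ (y +ᴹ -ᴹ z))    ≈⟨ +ᴹ-congˡ (+ᴹ-assoc (-ᴹ y) y (-ᴹ z)) ⟨
          x +ᴹ ((-ᴹ y +ᴹ y) +ᴹ -ᴹ z)    ≈⟨ +ᴹ-congˡ (+ᴹ-congʳ (-ᴹ‿inverseˡ y)) ⟩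
          x +ᴹ (0ᴹ +ᴹ -ᴹ z)             ≈⟨ +ᴹ-congˡ (+ᴹ-identityˡ (-ᴹ z)) ⟩
          x +ᴹ -ᴹ z                     ∎) (+-closed x~y y~z)

        +-cong~ : ∀ {x y u v} → x ~ y → u ~ v → (x +ᴹ u) ~ (y +ᴹ v)
        +-cong~ {x} {y} {u} {v} x~y u~v = respects (begin
          (x +ᴹ -ᴹ y) +ᴹ (u +ᴹ -ᴹ v)    ≈⟨ interchange x (-ᴹ y) u (-ᴹ v) ⟩
          (x +ᴹ u) +ᴹ (-ᴹ y +ᴹ -ᴹ v)    ≈⟨ +ᴹ-congˡ (⁻¹-∙-comm y v) ⟩
          (x +ᴹ u) +ᴹ -ᴹ (y +ᴹ v)       ∎) (+-closed x~y u~v)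

        *-cong~ : ∀ {a b x y} → a ≈ b → x ~ y → (a *ₗ x) ~ (b *ₗ y)
        *-cong~ {a} {b} {x} {y} a≈b x~y = respects (begin
          a *ₗ (x +ᴹ -ᴹ y)          ≈⟨ *ₗ-distribˡ a x (-ᴹ y) ⟩
          a *ₗ x +ᴹ a *ₗ (-ᴹ y)     ≈⟨ +ᴹ-congˡ (a*-x≈-a*x a y) ⟩
          a *ₗ x +ᴹ -ᴹ (a *ₗ y)     ≈⟨ +ᴹ-congˡ (-ᴹ‿cong (*ₗ-cong a≈b ≈ᴹ-refl)) ⟩
          a *ₗ x +ᴹ -ᴹ (b *ₗ y)     ∎) (*ₗ-closed a x~y)

    quotient : Subspace V → VectorSpace
    quotient X = record
      { Carrierᴹ     = Carrierᴹ
      ; _≈ᴹ_         = congruentModulo X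
      ; _+ᴹ_         = _+ᴹ_
      ; _*ₗ_         = _*ₗ_
      ; 0ᴹ           = 0ᴹ
      ; -ᴹ_          = -ᴹ_
      ; isLeftModule = record
        { isLeftSemimodule = record
          { +ᴹ-isCommutativeMonoid = record
            { isMonoid = record
              { isSemigroup = record
                { isMagma = record
                  { isEquivalence = record
                    { refl  = reflexive~ ≈ᴹ-refl
                    ; sym   = sym~
                    ; trans = trans~
                    }
                  ; ∙-cong = +-cong~
                  }
                ; assoc = λ x y z → reflexive~ (+ᴹ-assoc x y z)
                }
              ; identity = reflexive~ ∘ +ᴹ-identityˡ , reflexive~ ∘ +ᴹ-identityʳ
              }
            ; comm = λ x y → reflexive~ (+ᴹ-comm x y)
            }
          ; isPreleftSemimodule = record
            { *ₗ-cong      = *-cong~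
            ; *ₗ-zeroˡ     = reflexive~ ∘ *ₗ-zeroˡ
            ; *ₗ-distribʳ  = λ x a b → reflexive~ (*ₗ-distribʳ x a b)
            ; *ₗ-identityˡ = reflexive~ ∘ *ₗ-identityˡ
            ; *ₗ-assoc     = λ a b x → reflexive~ (*ₗ-assoc a b x)
            ; *ₗ-zeroʳ     = reflexive~ ∘ *ₗ-zeroʳ
            ; *ₗ-distribˡ  = λ a x y → reflexive~ (*ₗ-distribˡ a x y)
            }
          }
        ; -ᴹ‿cong    = -‿cong~
        ; -ᴹ‿inverse = reflexive~ ∘ -ᴹ‿inverseˡ , reflexive~ ∘ -ᴹ‿inverseʳ
        }
      }
      where open Modulo X

    -- The image of Y under the projection V → V/X; it is Y/X when X ≤ Y.
    quotientSubspace : (X : Subspace V) → Subspace V → Subspace (quotient X)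
    quotientSubspace X Y = record
      { Member    = λ z → ∃[ y ] Member Y y × z ~ y
      ; respects  = λ z~z′ (y , y∈Y , z~y) → y , y∈Y , trans~ (sym~ z~z′) z~y
      ; 0-closed  = 0ᴹ , Y.0-closed , reflexive~ ≈ᴹ-refl
      ; +-closed  = λ (x , x∈Y , z~x) (y , y∈Y , w~y) →
                      x +ᴹ y , Y.+-closed x∈Y y∈Y , +-cong~ z~x w~y
      ; *ₗ-closed = λ a (y , y∈Y , z~y) →
                      a *ₗ y , Y.*ₗ-closed a y∈Y , *-cong~ refl z~y
      }
      where
      open Modulo X
      module Y = Subspace Y

  module _ {V : VectorSpace} where

    -- S is a line spread of the subspace X, whose points and lines are those of V
    -- contained in X.
    IsLineSpread : ∀ {s} → Subspace V → Pred (ProjectiveLine V) s → Set _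
    IsLineSpread X S =
        S Respects _≐_
      × (∀ L → S L → subspace L ≤ₛ X)
      × (∀ (P : ProjectivePoint V) → subspace P ≤ₛ X → ∃! _≐_ λ L → S L × P ≤ L)

    IsGeometricLineSpread : ∀ {s} → Subspace V → Pred (ProjectiveLine V) s → Set _
    IsGeometricLineSpread X S =
        IsLineSpread X S
      × (∀ B B′ → S B → S B′ → ¬ (B ≐ B′) →
           let B+B′ = subspace B +ₛ subspace B′ in
           IsLineSpread B+B′ λ L → S L × subspace L ≤ₛ B+B′)

    IsFanoAnalog : ∀ {d} → Pred (KSubspace V 3) d → Set _
    IsFanoAnalog D =
      D Respects _≐_ × (∀ (L : ProjectiveLine V) → ∃! _≐_ λ B → D B × L ≤ B)

  module _ {V : VectorSpace} where

    -- Ranges over 2-subspaces of V/P: B/P is always one, as B is a 3-subspace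
    -- containing the point P.
    derivedDesign : ∀ {d} → Pred (KSubspace V 3) d → (P : ProjectivePoint V) →
                    Pred (ProjectiveLine (quotient (subspace P))) _
    derivedDesign D P L =
      ∃[ B ] D B × P ≤ B ×
        Member (subspace L) Unary.≐ Member (quotientSubspace (subspace P) (subspace B))

    IsαPoint : ∀ {d} → Pred (KSubspace V 3) d → ProjectivePoint V → Set _
    IsαPoint D P =
      IsGeometricLineSpread (wholeSpace (quotient (subspace P))) (derivedDesign D P)

  subspaceSetoid : ∀ {V k p} → Pred (KSubspace V k) p → Setoid _ 0ℓ
  subspaceSetoid C = record
    { Carrier       = Σ[ X ∈ _ ] C X
    ; _≈_           = λ (X , _) (Y , _) → X ≐ Y
    ; isEquivalence = record
      { refl  = id , id
      ; sym   = λ (X⊆Y , Y⊆X) → Y⊆X , X⊆Y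
      ; trans = λ (X⊆Y , Y⊆X) (Y⊆Z , Z⊆Y) → (λ x → Y⊆Z (X⊆Y x)) , (λ z → Y⊆X (Z⊆Y z))
      }
    }

  symplecticForm : Vector Carrier 4 → Vector Carrier 4 → Carrier
  symplecticForm x y = x 0F * y 1F - x 1F * y 0F + x 2F * y 3F - x 3F * y 2F

  TotallyIsotropic : Pred (ProjectiveLine (coordinateSpace 4)) 0ℓ
  TotallyIsotropic L =
    ∀ {x y} → Member (subspace L) x → Member (subspace L) y → symplecticForm x y ≈ 0#

  symplecticQuadrangle : IncidenceStructure
  symplecticQuadrangle = record
    { points = subspaceSetoid {coordinateSpace 4} {1} U
    ; lines  = subspaceSetoid TotallyIsotropic
    ; _I_    = λ (P , _) (L , _) → P ≤ L
    }

  parabolicForm : Vector Carrier 5 → Carrier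
  parabolicForm x = x 0F * x 1F + x 2F * x 3F + x 4F * x 4F

  Singular : Pred (ProjectivePoint (coordinateSpace 5)) 0ℓ
  Singular P = ∀ {x} → Member (subspace P) x → parabolicForm x ≈ 0#

  TotallySingular : Pred (ProjectiveLine (coordinateSpace 5)) (lsuc 0ℓ)
  TotallySingular L = ∀ (P : ProjectivePoint (coordinateSpace 5)) → P ≤ L → Singular P

  parabolicQuadric : IncidenceStructure
  parabolicQuadric = record
    { points = subspaceSetoid Singular
    ; lines  = subspaceSetoid TotallySingular
    ; _I_    = λ (P , _) (L , _) → P ≤ L
    }

{-# OPTIONS --safe #-}

-- Call vectors x, y of H perpendicular if the block through them lies in H.  Because the
-- derived design in x is geometric, the vectors perpendicular to x form a hyperplane of H,
-- so ⟂ is a null polarity of H, and as such it is the perpendicularity of a nondegenerate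
-- alternating form.  Fix a hyperbolic line ⟨e,f⟩ of H and identify its 4-dimensional
-- perpendicular space with the ambient space of W(q).  The block through a line M of W(q)
-- lies in H and in the perpendicular space M ⊕ ⟨e,f⟩ of M, hence meets ⟨e,f⟩ in a single
-- point r.  For a fixed r the lines M with this point form a spread: the one through v is
-- the projection from r of the block through r and v.  So the q + 1 points of ⟨e,f⟩ give a
-- partition of the lines of W(q) into spreads.  The equivalence of (a) and (b) is the Klein
-- correspondence, under which Q(4,q) is the dual of W(q).

module Submission where

open import Defs
open import Algebra.Apartness.Bundles using (HeytingField)
open import Algebra.Bundles using (AbelianGroup; CommutativeRing)
open import Algebra.Module.Bundles using (LeftModule)
import Algebra.Properties.AbelianGroup as AbelianGroupProperties
import Algebra.Properties.CommutativeSemigroup as CommutativeSemigroupProperties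
open import Algebra.Properties.Monoid.Sum using (sum-cong-≋)
import Algebra.Properties.Ring as RingProperties
import Algebra.Properties.Semiring.Mult.TCOptimised as Mult
import Algebra.Solver.Ring as RingSolver
open import Algebra.Solver.Ring.AlmostCommutativeRing
  using (fromCommutativeRing; _-Raw-AlmostCommutative⟶_)
open import Data.Fin.Base using (Fin; zero; suc; _↑ˡ_; _↑ʳ_; combine; finToFun; funToFin)
open import Data.Fin.Patterns using (0F; 1F; 2F; 3F; 4F; 5F)
import Data.Fin.Properties as Fin
open import Data.Integer.Base as ℤ using (ℤ; +_; -[1+_])
import Data.Integer.Properties as ℤ
open import Data.Maybe.Base using (Maybe; just; nothing)
open import Data.Nat.Base as ℕ using (ℕ; zero; suc; _<_; _^_; s≤s; s<s; z<s)
import Data.Nat.Properties as ℕ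
open import Data.Product using (Σ-syntax; ∃; ∃₂; ∃-syntax; ∃!; _×_; _,_; proj₁; proj₂)
import Data.Vec.Base as Vec
open import Data.Vec.Functional using (Vector; []; _∷_; head; tail)
open import Data.Vec.N-ary using (N-ary; _$ⁿ_)
import Data.Vec.Properties as Vec
open import Function.Base using (_∘_; id)
open import Function.Bundles using (Bijection; Equivalence; _⇔_; mk⇔)
open import Level using (Level; 0ℓ)
open import Relation.Binary.Bundles using (Setoid)
open import Relation.Binary.Definitions using (Decidable; _Respects_)
open import Relation.Binary.PropositionalEquality as ≡ using (_≡_)
import Relation.Binary.Reasoning.Setoid as ≈-Reasoning
open import Relation.Nullary using (¬_; Dec; yes; no; contradiction; map′)
open import Relation.Nullary.Decidable using (decidable-stable)
open import Relation.Unary as Unary using (Pred)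

-- The blocks yield perpendicularity only as a relation, so no scalar comes attached to a pair of
-- vectors. A form is recovered by rescaling one vector of a symplectic basis, and agreement with it
-- is then carried from a few vectors to all others by sums of nonperpendicular vectors. That the
-- vectors perpendicular to x have codimension at most one rests on the solid of V/x spanned by two
-- blocks through x: a line spread of a solid has a line in every plane, in particular in the plane
-- that H cuts out. This is proved by matching q^2 points of that plane against q^2 points off it.
-- Codimension zero is excluded because the blocks through x would otherwise span too much inside H.
-- Finiteness of F does the work of classical reasoning: membership, independence and existence are
-- decided by search, and dimension arguments are pigeonhole arguments on the q^n coefficient
-- vectors. In the Klein correspondence, the matrix attached to a point of PG(4,q) produces both the
-- line of W(q) belonging to a singular point and the common point of two such lines, in place of
-- case distinctions on Plücker coordinates.

-- Polynomial identities with integer coefficients.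

module IntegerCoefficientSolver {c ℓ} (R : CommutativeRing c ℓ) where

  open CommutativeRing R
  open Mult semiring using (×-homo-+; ×1-homo-*; 1+×) renaming (_×_ to _·_)
  open RingProperties ring
    using (-‿distribˡ-*; -‿distribʳ-*; -0#≈0#; -‿involutive; -‿+-comm)
  open ≈-Reasoning setoid

  -- The normaliser must recognise equal and vanishing coefficients. Integers make this decidable
  -- over every commutative ring.
  ⟦_⟧ℤ : ℤ → Carrier
  ⟦ + n ⟧ℤ      = n · 1#
  ⟦ -[1+ n ] ⟧ℤ = - (suc n · 1#)

  cancel-1 : ∀ a b → a - b ≈ (1# + a) - (1# + b)
  cancel-1 a b = sym (begin
    (1# + a) + - (1# + b)        ≈⟨ +-congˡ (-‿+-comm 1# b) ⟨
    (1# + a) + (- 1# + - b)      ≈⟨ +-congʳ (+-comm 1# a) ⟩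
    (a + 1#) + (- 1# + - b)      ≈⟨ +-assoc a 1# _ ⟩
    a + (1# + (- 1# + - b))      ≈⟨ +-congˡ (+-assoc 1# (- 1#) (- b)) ⟨
    a + ((1# + - 1#) + - b)      ≈⟨ +-congˡ (+-congʳ (-‿inverseʳ 1#)) ⟩
    a + (0# + - b)               ≈⟨ +-congˡ (+-identityˡ (- b)) ⟩
    a + - b                      ∎)

  ⊖-homo : ∀ m n → ⟦ m ℤ.⊖ n ⟧ℤ ≈ m · 1# - n · 1#
  ⊖-homo zero    zero    = sym (-‿inverseʳ 0#)
  ⊖-homo zero    (suc n) = sym (+-identityˡ _)
  ⊖-homo (suc m) zero    = sym (trans (+-congˡ -0#≈0#) (+-identityʳ _))
  ⊖-homo (suc m) (suc n) = begin
    ⟦ suc m ℤ.⊖ suc n ⟧ℤ            ≡⟨ ≡.cong ⟦_⟧ℤ (ℤ.[1+m]⊖[1+n]≡m⊖n m n) ⟩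
    ⟦ m ℤ.⊖ n ⟧ℤ                    ≈⟨ ⊖-homo m n ⟩
    m · 1# - n · 1#                 ≈⟨ cancel-1 _ _ ⟩
    (1# + m · 1#) - (1# + n · 1#)   ≈⟨ +-cong (1+× m 1#) (-‿cong (1+× n 1#)) ⟨
    suc m · 1# - suc n · 1#         ∎

  +-homoℤ : ∀ i j → ⟦ i ℤ.+ j ⟧ℤ ≈ ⟦ i ⟧ℤ + ⟦ j ⟧ℤ
  +-homoℤ (+ m)      (+ n)      = ×-homo-+ 1# m n
  +-homoℤ (+ m)      -[1+ n ]   = ⊖-homo m (suc n)
  +-homoℤ -[1+ m ]   (+ n)      = trans (⊖-homo n (suc m)) (+-comm _ _)
  +-homoℤ -[1+ m ]   -[1+ n ]   = begin
    - (suc (suc (m ℕ.+ n)) · 1#)        ≡⟨ ≡.cong (λ k → - (suc k · 1#)) (ℕ.+-suc m n) ⟨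
    - ((suc m ℕ.+ suc n) · 1#)          ≈⟨ -‿cong (×-homo-+ 1# (suc m) (suc n)) ⟩
    - (suc m · 1# + suc n · 1#)         ≈⟨ -‿+-comm _ _ ⟨
    - (suc m · 1#) + - (suc n · 1#)     ∎

  -‿homoℤ : ∀ i → ⟦ ℤ.- i ⟧ℤ ≈ - ⟦ i ⟧ℤ
  -‿homoℤ (+ zero)   = sym -0#≈0#
  -‿homoℤ (+ suc n)  = refl
  -‿homoℤ -[1+ n ]   = sym (-‿involutive _)

  *-homoℕ : ∀ m n → ⟦ + m ℤ.* + n ⟧ℤ ≈ ⟦ + m ⟧ℤ * ⟦ + n ⟧ℤ
  *-homoℕ m n = begin
    ⟦ + m ℤ.* + n ⟧ℤ      ≡⟨ ≡.cong ⟦_⟧ℤ (ℤ.pos-* m n) ⟨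
    (m ℕ.* n) · 1#        ≈⟨ ×1-homo-* m n ⟩
    m · 1# * n · 1#       ∎

  *-homoℤ : ∀ i j → ⟦ i ℤ.* j ⟧ℤ ≈ ⟦ i ⟧ℤ * ⟦ j ⟧ℤ
  *-homoℤ (+ m) (+ n) = *-homoℕ m n
  *-homoℤ (+ m) -[1+ n ] = begin
    ⟦ + m ℤ.* -[1+ n ] ⟧ℤ            ≡⟨ ≡.cong ⟦_⟧ℤ (ℤ.neg-distribʳ-* (+ m) (+ suc n)) ⟨
    ⟦ ℤ.- (+ m ℤ.* + suc n) ⟧ℤ       ≈⟨ -‿homoℤ (+ m ℤ.* + suc n) ⟩
    - ⟦ + m ℤ.* + suc n ⟧ℤ           ≈⟨ -‿cong (*-homoℕ m (suc n)) ⟩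
    - (m · 1# * suc n · 1#)          ≈⟨ -‿distribʳ-* _ _ ⟩
    m · 1# * - (suc n · 1#)          ∎
  *-homoℤ -[1+ m ] (+ n) = begin
    ⟦ -[1+ m ] ℤ.* + n ⟧ℤ            ≡⟨ ≡.cong ⟦_⟧ℤ (ℤ.neg-distribˡ-* (+ suc m) (+ n)) ⟨
    ⟦ ℤ.- (+ suc m ℤ.* + n) ⟧ℤ       ≈⟨ -‿homoℤ (+ suc m ℤ.* + n) ⟩
    - ⟦ + suc m ℤ.* + n ⟧ℤ           ≈⟨ -‿cong (*-homoℕ (suc m) n) ⟩
    - (suc m · 1# * n · 1#)          ≈⟨ -‿distribˡ-* _ _ ⟩
    - (suc m · 1#) * n · 1#          ∎
  *-homoℤ -[1+ m ] -[1+ n ] = begin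
    (suc m ℕ.* suc n) · 1#             ≈⟨ ×1-homo-* (suc m) (suc n) ⟩
    suc m · 1# * suc n · 1#            ≈⟨ -‿involutive _ ⟨
    - - (suc m · 1# * suc n · 1#)      ≈⟨ -‿cong (-‿distribʳ-* _ _) ⟩
    - (suc m · 1# * - (suc n · 1#))    ≈⟨ -‿distribˡ-* _ _ ⟩
    - (suc m · 1#) * - (suc n · 1#)    ∎

  ℤ-homomorphism : ℤ.+-*-rawRing -Raw-AlmostCommutative⟶ fromCommutativeRing R
  ℤ-homomorphism = record
    { ⟦_⟧    = ⟦_⟧ℤ
    ; +-homo = +-homoℤ
    ; *-homo = *-homoℤ
    ; -‿homo = -‿homoℤ
    ; 0-homo = refl
    ; 1-homo = refl
    }

  _≟ℤ_ : ∀ i j → Maybe (⟦ i ⟧ℤ ≈ ⟦ j ⟧ℤ)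
  i ≟ℤ j with i ℤ.≟ j
  ... | yes i≡j = just (reflexive (≡.cong ⟦_⟧ℤ i≡j))
  ... | no  _   = nothing

  open RingSolver ℤ.+-*-rawRing (fromCommutativeRing R) ℤ-homomorphism _≟ℤ_ public
    using (Polynomial; con; var; _:+_; _:*_; _:-_; :-_; _:=_; solve; normalise; ⟦_⟧; correct)
    renaming (⟦_⟧N to ⟦_⟧ₙ)

  -- Tabulating the normal forms lets a single `≡.refl` check a whole family of identities; for a
  -- variable index i the normal forms would not compute.
  components : ∀ {n m} (ρ : Vec.Vec Carrier n) (equations : Vector (Polynomial n × Polynomial n) m) →
               let l = proj₁ ∘ equations ; r = proj₂ ∘ equations in
               Vec.tabulate (normalise ∘ l) ≡ Vec.tabulate (normalise ∘ r) → ∀ i → ⟦ l i ⟧ ρ ≈ ⟦ r i ⟧ ρ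
  components ρ equations eq i = begin
    ⟦ l i ⟧ ρ              ≈⟨ correct (l i) ρ ⟨
    ⟦ normalise (l i) ⟧ₙ ρ ≡⟨ ≡.cong (λ p → ⟦ p ⟧ₙ ρ) (Vec.lookup∘tabulate (normalise ∘ l) i) ⟨
    ⟦ entry l ⟧ₙ ρ         ≡⟨ ≡.cong (λ ps → ⟦ Vec.lookup ps i ⟧ₙ ρ) eq ⟩
    ⟦ entry r ⟧ₙ ρ         ≡⟨ ≡.cong (λ p → ⟦ p ⟧ₙ ρ) (Vec.lookup∘tabulate (normalise ∘ r) i) ⟩
    ⟦ normalise (r i) ⟧ₙ ρ ≈⟨ correct (r i) ρ ⟩
    ⟦ r i ⟧ ρ              ∎
    where
    l = proj₁ ∘ equations
    r = proj₂ ∘ equations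
    entry : Vector (Polynomial _) _ → _
    entry f = Vec.lookup (Vec.tabulate (normalise ∘ f)) i

  variables : ∀ l m n → Vector (Polynomial (l ℕ.+ (m ℕ.+ n))) m
  variables l m n i = var (l ↑ʳ (i ↑ˡ n))

-- Finite fields: decidability and counting.

module FiniteField {q : ℕ} (F : Field) (order : HasOrder F q) where

  open CommutativeRing (commutativeRingOf F) hiding (zero)
  open HeytingField F using (tight; #⇒invertible)
  open IntegerCoefficientSolver (commutativeRingOf F)
    using (solve; con; _:+_; _:*_; _:-_; :-_; _:=_)
  open ≈-Reasoning setoid

  element : Fin q → Carrier
  element = Bijection.to order

  index : Carrier → Fin q
  index x = proj₁ (Bijection.surjective order x)

  element-index : ∀ x → element (index x) ≈ x
  element-index x = proj₂ (Bijection.surjective order x) ≡.refl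

  index-cong : ∀ {x y} → x ≈ y → index x ≡ index y
  index-cong {x} {y} x≈y = Bijection.injective order
    (trans (element-index x) (trans x≈y (sym (element-index y))))

  index-injective : ∀ {x y} → index x ≡ index y → x ≈ y
  index-injective {x} {y} eq = trans (sym (element-index x))
    (trans (reflexive (≡.cong element eq)) (element-index y))

  infix 4 _≟_
  _≟_ : ∀ x y → Dec (x ≈ y)
  x ≟ y = map′ index-injective index-cong (index x Fin.≟ index y)

  ∃? : {P : Pred Carrier 0ℓ} → P Respects _≈_ → Unary.Decidable P → Dec (∃ P)
  ∃? resp P? = map′ (λ (i , p) → element i , p)
                    (λ (x , p) → index x , resp (sym (element-index x)) p)
                    (Fin.any? (P? ∘ element))

  _⁻¹⟨_⟩ : ∀ x → ¬ (x ≈ 0#) → Carrier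
  inverseʳ⟨_⟩ : ∀ {x} (x≉0 : ¬ (x ≈ 0#)) → x * (x ⁻¹⟨ x≉0 ⟩) ≈ 1#

  private
    -- A Heyting field inverts only elements apart from 0, which x ≉ 0 does not directly provide. An
    -- exhaustive search decides whether an inverse exists; if none does, x is not apart from 0, and
    -- tightness gives x ≈ 0.
    reciprocal : ∀ x → ¬ (x ≈ 0#) → ∃[ y ] x * y ≈ 1#
    reciprocal x x≉0 with ∃? (λ y≈z xy≈1 → trans (*-congˡ (sym y≈z)) xy≈1) (λ y → x * y ≟ 1#)
    ... | yes p = p
    ... | no ¬p = contradiction (proj₁ (tight x 0#) λ x#0 →
                    let (y , _ , xy≈1) = #⇒invertible x#0 in
                    ¬p (y , trans (*-congʳ x≈x-0) xy≈1)) x≉0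
      where
      x≈x-0 : x ≈ x - 0#
      x≈x-0 = solve 1 (λ x → x := x :- con (+ 0)) refl x

  x ⁻¹⟨ x≉0 ⟩ = proj₁ (reciprocal x x≉0)
  inverseʳ⟨ x≉0 ⟩ = proj₂ (reciprocal _ x≉0)

  *-cancel : ∀ {a b} → ¬ (a ≈ 0#) → a * b ≈ 0# → b ≈ 0#
  *-cancel {a} {b} a≉0 ab≈0 = begin
    b              ≈⟨ *-identityˡ b ⟨
    1# * b         ≈⟨ *-congʳ (inverseʳ⟨ a≉0 ⟩) ⟨
    a * c * b      ≈⟨ solve 3 (λ a b c → a :* c :* b := c :* (a :* b)) refl a b c ⟩
    c * (a * b)    ≈⟨ *-congˡ ab≈0 ⟩
    c * 0#         ≈⟨ zeroʳ c ⟩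
    0#             ∎
    where c = a ⁻¹⟨ a≉0 ⟩

  -- If 1 were 0, all elements would coincide, whereas 1 < q supplies two distinct indices.
  1≉0 : 1 < q → ¬ (1# ≈ 0#)
  1≉0 (s≤s (s≤s _)) 1≈0 = Fin.0≢1+n {i = zero} (Bijection.injective order (trans (≈0 _) (sym (≈0 _))))
    where
    ≈0 : ∀ x → x ≈ 0#
    ≈0 x = trans (sym (*-identityʳ x)) (trans (*-congˡ 1≈0) (zeroʳ x))

  _≋_ : ∀ {n} → Vector Carrier n → Vector Carrier n → Set
  a ≋ b = ∀ i → a i ≈ b i

  tuple : ∀ {n} → Fin (q ^ n) → Vector Carrier n
  tuple k = element ∘ finToFun k

  tuple-index : ∀ {n} → Vector Carrier n → Fin (q ^ n)
  tuple-index a = funToFin (index ∘ a)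

  tuple-tuple-index : ∀ {n} (a : Vector Carrier n) → tuple (tuple-index a) ≋ a
  tuple-tuple-index a i = trans
    (reflexive (≡.cong element (Fin.finToFun-funToFin (index ∘ a) i))) (element-index (a i))

  private
    funToFin-cong : ∀ {m n} {f g : Fin m → Fin n} → (∀ i → f i ≡ g i) → funToFin f ≡ funToFin g
    funToFin-cong {zero}  f≗g = ≡.refl
    funToFin-cong {suc m} f≗g = ≡.cong₂ combine (f≗g zero) (funToFin-cong (f≗g ∘ suc))

  tuple-injective : ∀ {n} {k l : Fin (q ^ n)} → tuple {n} k ≋ tuple l → k ≡ l
  tuple-injective {n} {k} {l} eq = ≡.trans (≡.sym (Fin.funToFin-finToFin {n} {q} k))
    (≡.trans (funToFin-cong {n} (λ i → Bijection.injective order (eq i))) (Fin.funToFin-finToFin {n} {q} l))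

  tuple-index-injective : ∀ {n} {a b : Vector Carrier n} → tuple-index a ≡ tuple-index b → a ≋ b
  tuple-index-injective {n} {a} {b} eq i = trans (sym (tuple-tuple-index a i))
    (trans (reflexive (≡.cong (λ k → tuple {n} k i) eq)) (tuple-tuple-index b i))

  ∃-tuple? : ∀ {n} {P : Pred (Vector Carrier n) 0ℓ} → P Respects _≋_ → Unary.Decidable P → Dec (∃ P)
  ∃-tuple? {n} resp P? = map′ (λ (k , p) → tuple k , p)
    (λ (a , p) → tuple-index a , resp (λ i → sym (tuple-tuple-index a i)) p)
    (Fin.any? (P? ∘ tuple {n}))

  -- The pigeonhole principle for q^n < q^m. It takes the place of Gaussian elimination as the
  -- source of linear dependence.
  collision : ∀ {m n} → 1 < q → n < m → (f : Vector Carrier m → Vector Carrier n) →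
              ∃₂ λ a b → ¬ (a ≋ b) × f a ≋ f b
  collision {m} {n} 1<q n<m f =
    let i , j , i<j , eq = Fin.pigeonhole (ℕ.^-monoʳ-< q 1<q n<m) (tuple-index ∘ f ∘ tuple {m}) in
    tuple i , tuple j , (λ a≋b → Fin.<⇒≢ i<j (tuple-injective {m} a≋b)) ,
    tuple-index-injective eq

  -- Pigeonhole on the q^n + 1 vectors consisting of b and the values of f: since f is injective,
  -- the coincidence must involve b.
  injective⇒surjective : ∀ {n} (f : Fin (q ^ n) → Vector Carrier n) →
             (∀ {k l} → f k ≋ f l → k ≡ l) → ∀ b → ∃[ k ] f k ≋ b
  injective⇒surjective {n} f f-injective b with Fin.pigeonhole (ℕ.n<1+n (q ^ n)) b∷f
    where
    b∷f : Fin (suc (q ^ n)) → Fin (q ^ n)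
    b∷f zero    = tuple-index b
    b∷f (suc k) = tuple-index (f k)
  ... | zero  , suc k , _ , eq = k , λ i → sym (tuple-index-injective eq i)
  ... | suc k , suc l , k<l , eq =
    contradiction (≡.cong suc (f-injective (tuple-index-injective eq))) (Fin.<⇒≢ k<l)

-- Linear combinations and vector identities.

module _ (F : Field) where

  open CommutativeRing (commutativeRingOf F) hiding (zero)
  open Geometry F
  open IntegerCoefficientSolver (commutativeRingOf F)

  module LinearCombinations (V : VectorSpace) where

    open LeftModule V
    open AbelianGroupProperties +ᴹ-abelianGroup using (inverseˡ-unique)
    open CommutativeSemigroupProperties
           (AbelianGroup.commutativeSemigroup +ᴹ-abelianGroup) using (interchange)
    open ≈-Reasoning ≈ᴹ-setoid

    -1*x≈-x : ∀ x → (- 1#) *ₗ x ≈ᴹ -ᴹ x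
    -1*x≈-x x = inverseˡ-unique _ x (begin
      (- 1#) *ₗ x +ᴹ x          ≈⟨ +ᴹ-congˡ (*ₗ-identityˡ x) ⟨
      (- 1#) *ₗ x +ᴹ 1# *ₗ x    ≈⟨ *ₗ-distribʳ x (- 1#) 1# ⟨
      (- 1# + 1#) *ₗ x          ≈⟨ *ₗ-cong (-‿inverseˡ 1#) ≈ᴹ-refl ⟩
      0# *ₗ x                   ≈⟨ *ₗ-zeroˡ x ⟩
      0ᴹ                        ∎)

    lc : ∀ {n} → Vector Carrier n → Vector Carrierᴹ n → Carrierᴹ
    lc = linearCombination V

    lc-cong : ∀ {n} {a b : Vector Carrier n} {u v : Vector Carrierᴹ n} →
              (∀ i → a i ≈ b i) → (∀ i → u i ≈ᴹ v i) → lc a u ≈ᴹ lc b v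
    lc-cong a≈b u≈v = sum-cong-≋ +ᴹ-monoid (λ i → *ₗ-cong (a≈b i) (u≈v i))

    lc-congˡ : ∀ {n} {a b : Vector Carrier n} {v : Vector Carrierᴹ n} →
               (∀ i → a i ≈ b i) → lc a v ≈ᴹ lc b v
    lc-congˡ a≈b = lc-cong a≈b (λ _ → ≈ᴹ-refl)

    lc-+ : ∀ {n} (a b : Vector Carrier n) (v : Vector Carrierᴹ n) →
           lc (λ i → a i + b i) v ≈ᴹ lc a v +ᴹ lc b v
    lc-+ {zero}  a b v = ≈ᴹ-sym (+ᴹ-identityˡ 0ᴹ)
    lc-+ {suc n} a b v = begin
      (a zero + b zero) *ₗ v zero +ᴹ lc (λ i → a (suc i) + b (suc i)) (v ∘ suc)
        ≈⟨ +ᴹ-cong (*ₗ-distribʳ (v zero) (a zero) (b zero)) (lc-+ (a ∘ suc) (b ∘ suc) (v ∘ suc)) ⟩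
      (a zero *ₗ v zero +ᴹ b zero *ₗ v zero) +ᴹ (lc (a ∘ suc) (v ∘ suc) +ᴹ lc (b ∘ suc) (v ∘ suc))
        ≈⟨ interchange _ _ _ _ ⟩
      lc a v +ᴹ lc b v ∎

    lc-* : ∀ {n} c (a : Vector Carrier n) (v : Vector Carrierᴹ n) →
           lc (λ i → c * a i) v ≈ᴹ c *ₗ lc a v
    lc-* {zero}  c a v = ≈ᴹ-sym (*ₗ-zeroʳ c)
    lc-* {suc n} c a v = begin
      (c * a zero) *ₗ v zero +ᴹ lc (λ i → c * a (suc i)) (v ∘ suc)
        ≈⟨ +ᴹ-cong (*ₗ-assoc c (a zero) (v zero)) (lc-* c (a ∘ suc) (v ∘ suc)) ⟩
      c *ₗ (a zero *ₗ v zero) +ᴹ c *ₗ lc (a ∘ suc) (v ∘ suc)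
        ≈⟨ *ₗ-distribˡ c _ _ ⟨
      c *ₗ lc a v ∎

    lc-0 : ∀ {n} (v : Vector Carrierᴹ n) → lc (λ _ → 0#) v ≈ᴹ 0ᴹ
    lc-0 {zero}  v = ≈ᴹ-refl
    lc-0 {suc n} v = ≈ᴹ-trans (+ᴹ-cong (*ₗ-zeroˡ (v zero)) (lc-0 (v ∘ suc))) (+ᴹ-identityˡ 0ᴹ)

    δ : ∀ {n} → Fin n → Vector Carrier n
    δ zero    zero    = 1#
    δ zero    (suc j) = 0#
    δ (suc i) zero    = 0#
    δ (suc i) (suc j) = δ i j

    lc-δ : ∀ {n} (i : Fin n) (v : Vector Carrierᴹ n) → lc (δ i) v ≈ᴹ v i
    lc-δ zero    v = ≈ᴹ-trans (+ᴹ-cong (*ₗ-identityˡ (v zero)) (lc-0 (v ∘ suc))) (+ᴹ-identityʳ _)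
    lc-δ (suc i) v = ≈ᴹ-trans (+ᴹ-cong (*ₗ-zeroˡ (v zero)) (lc-δ i (v ∘ suc))) (+ᴹ-identityˡ _)

    -- An equation between linear combinations with polynomial coefficients is
    -- decided by normalising the coefficient of each vector variable.
    data Expr (n m : ℕ) : Set where
      ⟨_⟩ : Fin m → Expr n m
      _⊕_ : Expr n m → Expr n m → Expr n m
      _⊙_ : Polynomial n → Expr n m → Expr n m
      ⊝_  : Expr n m → Expr n m
      𝟎   : Expr n m

    infixl 6 _⊕_
    infixr 7 _⊙_
    infix  8 ⊝_
    infix  4 _⊜_

    ⟦_⟧ᶠ : ∀ {n} → Polynomial n → Vector Carrier n → Carrier
    ⟦ p ⟧ᶠ ρ = ⟦ p ⟧ (Vec.tabulate ρ)

    ⟦_⟧ᴱ : ∀ {n m} → Expr n m → Vector Carrier n → Vector Carrierᴹ m → Carrierᴹ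
    ⟦ ⟨ i ⟩   ⟧ᴱ ρ v = v i
    ⟦ e ⊕ e′  ⟧ᴱ ρ v = ⟦ e ⟧ᴱ ρ v +ᴹ ⟦ e′ ⟧ᴱ ρ v
    ⟦ p ⊙ e   ⟧ᴱ ρ v = ⟦ p ⟧ᶠ ρ *ₗ ⟦ e ⟧ᴱ ρ v
    ⟦ ⊝ e     ⟧ᴱ ρ v = -ᴹ ⟦ e ⟧ᴱ ρ v
    ⟦ 𝟎       ⟧ᴱ ρ v = 0ᴹ

    private
      δᴾ : ∀ {n m} → Fin m → Fin m → Polynomial n
      δᴾ zero    zero    = con (+ 1)
      δᴾ zero    (suc j) = con (+ 0)
      δᴾ (suc i) zero    = con (+ 0)
      δᴾ (suc i) (suc j) = δᴾ i j

      δᴾ-correct : ∀ {n m} (ρ : Vector Carrier n) (i j : Fin m) → ⟦ δᴾ i j ⟧ᶠ ρ ≈ δ i j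
      δᴾ-correct ρ zero    zero    = refl
      δᴾ-correct ρ zero    (suc j) = refl
      δᴾ-correct ρ (suc i) zero    = refl
      δᴾ-correct ρ (suc i) (suc j) = δᴾ-correct ρ i j

    coefficients : ∀ {n m} → Expr n m → Fin m → Polynomial n
    coefficients ⟨ j ⟩    i = δᴾ j i
    coefficients (e ⊕ e′) i = coefficients e i :+ coefficients e′ i
    coefficients (p ⊙ e)  i = p :* coefficients e i
    coefficients (⊝ e)    i = con -[1+ 0 ] :* coefficients e i
    coefficients 𝟎        i = con (+ 0)

    private
      expand : ∀ {n m} → Expr n m → Vector Carrier n → Vector Carrierᴹ m → Carrierᴹ
      expand e ρ v = lc (λ i → ⟦ coefficients e i ⟧ᶠ ρ) v

      expand-correct : ∀ {n m} (e : Expr n m) ρ v → ⟦ e ⟧ᴱ ρ v ≈ᴹ expand e ρ v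
      expand-correct ⟨ j ⟩ ρ v = ≈ᴹ-sym (≈ᴹ-trans (lc-congˡ (δᴾ-correct ρ j)) (lc-δ j v))
      expand-correct (e ⊕ e′) ρ v = ≈ᴹ-trans
        (+ᴹ-cong (expand-correct e ρ v) (expand-correct e′ ρ v))
        (≈ᴹ-sym (lc-+ (λ i → ⟦ coefficients e i ⟧ᶠ ρ) (λ i → ⟦ coefficients e′ i ⟧ᶠ ρ) v))
      expand-correct (p ⊙ e) ρ v = ≈ᴹ-trans
        (*ₗ-cong refl (expand-correct e ρ v))
        (≈ᴹ-sym (lc-* (⟦ p ⟧ᶠ ρ) (λ i → ⟦ coefficients e i ⟧ᶠ ρ) v))
      expand-correct (⊝ e) ρ v = begin
        -ᴹ ⟦ e ⟧ᴱ ρ v              ≈⟨ -ᴹ‿cong (expand-correct e ρ v) ⟩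
        -ᴹ expand e ρ v            ≈⟨ -1*x≈-x _ ⟨
        (- 1#) *ₗ expand e ρ v     ≈⟨ lc-* (- 1#) (λ i → ⟦ coefficients e i ⟧ᶠ ρ) v ⟨
        expand (⊝ e) ρ v           ∎
      expand-correct 𝟎 ρ v = ≈ᴹ-sym (lc-0 v)

    _⊜_ : ∀ {n m} → Expr n m → Expr n m → Expr n m × Expr n m
    _⊜_ = _,_

    -- The first n arguments of f name the scalars, which may enter polynomially; the last m name
    -- the vectors.
    linear : ∀ {n m} (ρ : Vector Carrier n) (v : Vector Carrierᴹ m)
             (f : N-ary n (Polynomial n) (N-ary m (Expr n m) (Expr n m × Expr n m))) →
             let l , r = (f $ⁿ Vec.map var (Vec.allFin n)) $ⁿ Vec.map ⟨_⟩ (Vec.allFin m) in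
             Vec.tabulate (normalise ∘ coefficients l) ≡ Vec.tabulate (normalise ∘ coefficients r) →
             ⟦ l ⟧ᴱ ρ v ≈ᴹ ⟦ r ⟧ᴱ ρ v
    linear {n} {m} ρ v f eq = begin
      ⟦ l ⟧ᴱ ρ v      ≈⟨ expand-correct l ρ v ⟩
      expand l ρ v    ≈⟨ lc-congˡ agree ⟩
      expand r ρ v    ≈⟨ expand-correct r ρ v ⟨
      ⟦ r ⟧ᴱ ρ v      ∎
      where
      l,r = (f $ⁿ Vec.map var (Vec.allFin n)) $ⁿ Vec.map ⟨_⟩ (Vec.allFin m)
      l = proj₁ l,r
      r = proj₂ l,r
      agree : ∀ i → ⟦ coefficients l i ⟧ᶠ ρ ≈ ⟦ coefficients r i ⟧ᶠ ρ
      agree = components (Vec.tabulate ρ) (λ i → coefficients l i := coefficients r i) eq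

-- Spans and linear independence.

module Spans (F : Field) (V : Geometry.VectorSpace F) where

  open CommutativeRing (commutativeRingOf F) hiding (zero)
  open Geometry F
  open IntegerCoefficientSolver (commutativeRingOf F)
  open LeftModule V
  open LinearCombinations F V public

  infix 4 _∈_ _∉_
  _∈_ : Carrierᴹ → Subspace V → Set
  x ∈ X = Subspace.Member X x

  _∉_ : Carrierᴹ → Subspace V → Set
  x ∉ X = ¬ (x ∈ X)

  span : ∀ {n} → Vector Carrierᴹ n → Subspace V
  span v = record
    { Member    = λ x → ∃[ a ] x ≈ᴹ lc a v
    ; respects  = λ x≈y (a , x≈) → a , ≈ᴹ-trans (≈ᴹ-sym x≈y) x≈
    ; 0-closed  = (λ _ → 0#) , ≈ᴹ-sym (lc-0 v)
    ; +-closed  = λ (a , x≈) (b , y≈) →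
                    (λ i → a i + b i) , ≈ᴹ-trans (+ᴹ-cong x≈ y≈) (≈ᴹ-sym (lc-+ a b v))
    ; *ₗ-closed = λ c (a , x≈) →
                    (λ i → c * a i) , ≈ᴹ-trans (*ₗ-cong refl x≈) (≈ᴹ-sym (lc-* c a v))
    }

  -- A record, so that the type of a proof determines `v`; the bare function type would unfold `lc`
  -- and lose it.
  record Independent {n} (v : Vector Carrierᴹ n) : Set where
    constructor independent
    field only-trivially : ∀ a → lc a v ≈ᴹ 0ᴹ → ∀ i → a i ≈ 0#

  open Independent public

  spanned : ∀ {n} (v : Vector Carrierᴹ n) → Independent v → KSubspace V n
  spanned v v-ind = record
    { subspace = span v
    ; basis    = record
      { vectors     = v
      ; members     = λ i → δ i , ≈ᴹ-sym (lc-δ i v)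
      ; independent = only-trivially v-ind
      ; spanning    = id
      }
    }

  zeroSubspace : Subspace V
  zeroSubspace = record
    { Member    = _≈ᴹ 0ᴹ
    ; respects  = λ x≈y x≈0 → ≈ᴹ-trans (≈ᴹ-sym x≈y) x≈0
    ; 0-closed  = ≈ᴹ-refl
    ; +-closed  = λ x≈0 y≈0 → ≈ᴹ-trans (+ᴹ-cong x≈0 y≈0) (+ᴹ-identityˡ 0ᴹ)
    ; *ₗ-closed = λ k x≈0 → ≈ᴹ-trans (*ₗ-cong refl x≈0) (*ₗ-zeroʳ k)
    }

  ∈span : ∀ {n} (v : Vector Carrierᴹ n) i → v i ∈ span v
  ∈span v i = δ i , ≈ᴹ-sym (lc-δ i v)

  lc-closed : ∀ (X : Subspace V) {n} (v : Vector Carrierᴹ n) → (∀ i → v i ∈ X) → ∀ a → lc a v ∈ X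
  lc-closed X {zero}  v v⊆X a = Subspace.0-closed X
  lc-closed X {suc n} v v⊆X a = Subspace.+-closed X
    (Subspace.*ₗ-closed X (a zero) (v⊆X zero)) (lc-closed X (v ∘ suc) (v⊆X ∘ suc) (a ∘ suc))

  span-least : ∀ (X : Subspace V) {n} (v : Vector Carrierᴹ n) → (∀ i → v i ∈ X) → span v ≤ₛ X
  span-least X v v⊆X (a , x≈) = Subspace.respects X (≈ᴹ-sym x≈) (lc-closed X v v⊆X a)

  -‿closed : ∀ (X : Subspace V) {x} → x ∈ X → -ᴹ x ∈ X
  -‿closed X x∈X = Subspace.respects X (-1*x≈-x _) (Subspace.*ₗ-closed X (- 1#) x∈X)

  ∈-+ₛˡ : ∀ (X Y : Subspace V) {x} → x ∈ X → x ∈ X +ₛ Y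
  ∈-+ₛˡ X Y x∈X = _ , 0ᴹ , x∈X , Subspace.0-closed Y , ≈ᴹ-sym (+ᴹ-identityʳ _)

  ∈-+ₛʳ : ∀ (X Y : Subspace V) {y} → y ∈ Y → y ∈ X +ₛ Y
  ∈-+ₛʳ X Y y∈Y = 0ᴹ , _ , Subspace.0-closed X , y∈Y , ≈ᴹ-sym (+ᴹ-identityˡ _)

  scale-zero : ∀ {k} x → k ≈ 0# → k *ₗ x ≈ᴹ 0ᴹ
  scale-zero x k≈0 = ≈ᴹ-trans (*ₗ-cong k≈0 ≈ᴹ-refl) (*ₗ-zeroˡ x)

  scale-one : ∀ {k} x → k ≈ 1# → k *ₗ x ≈ᴹ x
  scale-one x k≈1 = ≈ᴹ-trans (*ₗ-cong k≈1 ≈ᴹ-refl) (*ₗ-identityˡ x)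

  drop-zeroˡ : ∀ {k} x y → k ≈ 0# → k *ₗ x +ᴹ y ≈ᴹ y
  drop-zeroˡ x y k≈0 = ≈ᴹ-trans (+ᴹ-congʳ (scale-zero x k≈0)) (+ᴹ-identityˡ y)

  drop-zeroʳ : ∀ {k} x y → k ≈ 0# → x +ᴹ k *ₗ y ≈ᴹ x
  drop-zeroʳ x y k≈0 = ≈ᴹ-trans (+ᴹ-congˡ (scale-zero y k≈0)) (+ᴹ-identityʳ x)

  vectors : ∀ {k} → KSubspace V k → Vector Carrierᴹ k
  vectors = Basis.vectors ∘ KSubspace.basis

  vectors∈ : ∀ {k} (B : KSubspace V k) i → vectors B i ∈ KSubspace.subspace B
  vectors∈ B = Basis.members (KSubspace.basis B)

  lc-difference : ∀ {n} a b (v : Vector Carrierᴹ n) → lc a v ≈ᴹ lc b v → lc (λ i → a i + - 1# * b i) v ≈ᴹ 0ᴹ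
  lc-difference a b v eq = begin
    lc (λ i → a i + - 1# * b i) v          ≈⟨ lc-+ a (λ i → - 1# * b i) v ⟩
    lc a v +ᴹ lc (λ i → - 1# * b i) v      ≈⟨ +ᴹ-cong eq (lc-* (- 1#) b v) ⟩
    lc b v +ᴹ (- 1#) *ₗ lc b v             ≈⟨ +ᴹ-congˡ (-1*x≈-x (lc b v)) ⟩
    lc b v +ᴹ -ᴹ lc b v                    ≈⟨ -ᴹ‿inverseʳ (lc b v) ⟩
    0ᴹ                                     ∎
    where open ≈-Reasoning ≈ᴹ-setoid

  a-b≈0⇒a≈b : ∀ {a b} → a + - 1# * b ≈ 0# → a ≈ b
  a-b≈0⇒a≈b {a} {b} eq = begin
    a                   ≈⟨ solve 2 (λ a b → a := a :+ con -[1+ 0 ] :* b :+ b) refl a b ⟩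
    a + - 1# * b + b    ≈⟨ +-congʳ eq ⟩
    0# + b              ≈⟨ +-identityˡ b ⟩
    b                   ∎
    where open ≈-Reasoning setoid

  lc-injective : ∀ {n} {v : Vector Carrierᴹ n} → Independent v → ∀ {a b} → lc a v ≈ᴹ lc b v → ∀ i →
      a i ≈ b i
  lc-injective {v = v} v-ind {a} {b} eq i = a-b≈0⇒a≈b (only-trivially v-ind _ (lc-difference a b v eq) i)

  independent-tail : ∀ {n} {v : Vector Carrierᴹ (suc n)} → Independent v → Independent (tail v)
  independent-tail {v = v} v-ind = independent λ a eq → only-trivially v-ind (0# ∷ a)
    (≈ᴹ-trans (+ᴹ-cong (*ₗ-zeroˡ (v zero)) eq) (+ᴹ-identityˡ 0ᴹ)) ∘ suc

-- Linear maps and preimages of subspaces.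

module _ (F : Field) where

  open CommutativeRing (commutativeRingOf F) hiding (zero)
  open Geometry F

  module _ {M N : VectorSpace} where

    private
      module M = LeftModule M
      module N = LeftModule N

    record IsLinear (φ : M.Carrierᴹ → N.Carrierᴹ) : Set where
      field
        cong    : ∀ {x y} → x M.≈ᴹ y → φ x N.≈ᴹ φ y
        linearity : ∀ a b x y → φ (a M.*ₗ x M.+ᴹ b M.*ₗ y) N.≈ᴹ a N.*ₗ φ x N.+ᴹ b N.*ₗ φ y

      additive : ∀ x y → φ (x M.+ᴹ y) N.≈ᴹ φ x N.+ᴹ φ y
      additive x y = N.≈ᴹ-trans
          (cong (M.+ᴹ-cong (M.≈ᴹ-sym (M.*ₗ-identityˡ x)) (M.≈ᴹ-sym (M.*ₗ-identityˡ y))))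
        (N.≈ᴹ-trans (linearity 1# 1# x y) (N.+ᴹ-cong (N.*ₗ-identityˡ (φ x)) (N.*ₗ-identityˡ (φ y))))

      homogeneous : ∀ k x → φ (k M.*ₗ x) N.≈ᴹ k N.*ₗ φ x
      homogeneous k x = N.≈ᴹ-trans
        (cong (M.≈ᴹ-sym (M.≈ᴹ-trans (M.+ᴹ-congˡ (M.*ₗ-zeroˡ x)) (M.+ᴹ-identityʳ (k M.*ₗ x)))))
        (N.≈ᴹ-trans (linearity k 0# x x) (N.≈ᴹ-trans (N.+ᴹ-congˡ (N.*ₗ-zeroˡ (φ x)))
            (N.+ᴹ-identityʳ (k N.*ₗ φ x))))

      preserves-0 : φ M.0ᴹ N.≈ᴹ N.0ᴹ
      preserves-0 = N.≈ᴹ-trans (cong (M.≈ᴹ-sym (M.*ₗ-zeroˡ M.0ᴹ)))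
        (N.≈ᴹ-trans (homogeneous 0# M.0ᴹ) (N.*ₗ-zeroˡ (φ M.0ᴹ)))

      preimage : Subspace N → Subspace M
      preimage X = record
        { Member    = λ x → Subspace.Member X (φ x)
        ; respects  = λ x≈y → Subspace.respects X (cong x≈y)
        ; 0-closed  = Subspace.respects X (N.≈ᴹ-sym preserves-0) (Subspace.0-closed X)
        ; +-closed  = λ {x} {y} φx∈X φy∈X → Subspace.respects X (N.≈ᴹ-sym (additive x y))
            (Subspace.+-closed X φx∈X φy∈X)
        ; *ₗ-closed = λ k {x} φx∈X → Subspace.respects X (N.≈ᴹ-sym (homogeneous k x))
            (Subspace.*ₗ-closed X k φx∈X)
        }

-- Dimension theory over a finite field.

module LinearAlgebra {q : ℕ} (F : Field) (order : HasOrder F q) (1<q : 1 < q)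
  (V : Geometry.VectorSpace F) (_≟ᴹ_ : Decidable (LeftModule._≈ᴹ_ V)) where

  open CommutativeRing (commutativeRingOf F) hiding (zero)
  open Geometry F
  open LeftModule V
  open FiniteField F order
  open Spans F V public
  open IntegerCoefficientSolver (commutativeRingOf F) using (_:*_; _:+_; con; :-_)
  open ≈-Reasoning ≈ᴹ-setoid

  abstract

    _∈span?_ : ∀ x {n} (v : Vector Carrierᴹ n) → Dec (x ∈ span v)
    x ∈span? v = ∃-tuple? (λ a≋b x≈ → ≈ᴹ-trans x≈ (lc-congˡ a≋b)) (λ a → x ≟ᴹ lc a v)

    -- Counting instead of exchange: expressing the combinations of v through u maps F^m to F^n, so
    -- two different coefficient vectors give the same combination of v.
    steinitz : ∀ {m n} → n < m → (v : Vector Carrierᴹ m) (u : Vector Carrierᴹ n) →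
               (∀ i → v i ∈ span u) → ¬ Independent v
    steinitz {m} n<m v u v⊆u v-ind =
      let f = λ a → lc-closed (span u) v v⊆u a
          a , b , a≉b , fa≋fb = collision 1<q n<m (proj₁ ∘ f)
      in a≉b (lc-injective v-ind (begin
        lc a v              ≈⟨ proj₂ (f a) ⟩
        lc (proj₁ (f a)) u  ≈⟨ lc-congˡ fa≋fb ⟩
        lc (proj₁ (f b)) u  ≈⟨ proj₂ (f b) ⟨
        lc b v              ∎))

    solve-head : ∀ {n} {v : Vector Carrierᴹ (suc n)} a → ¬ (a zero ≈ 0#) → lc a v ≈ᴹ 0ᴹ →
                 head v ∈ span (tail v)
    solve-head {v = v} a a₀≉0 eq = Subspace.respects (span (tail v)) (≈ᴹ-sym head≈)
      (Subspace.*ₗ-closed (span (tail v)) (- a₀⁻¹) (a ∘ suc , ≈ᴹ-refl))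
      where
      a₀⁻¹ : Carrier
      a₀⁻¹ = a zero ⁻¹⟨ a₀≉0 ⟩
      rest : Carrierᴹ
      rest = lc (a ∘ suc) (tail v)
      head≈ : head v ≈ᴹ (- a₀⁻¹) *ₗ rest
      head≈ = begin
        head v
          ≈⟨ *ₗ-identityˡ (head v) ⟨
        1# *ₗ head v
          ≈⟨ *ₗ-cong (inverseʳ⟨ a₀≉0 ⟩) ≈ᴹ-refl ⟨
        (a zero * a₀⁻¹) *ₗ head v
          ≈⟨ linear (a zero ∷ a₀⁻¹ ∷ []) (head v ∷ rest ∷ [])
               (λ a b x y → (a :* b) ⊙ x ⊜ b ⊙ (a ⊙ x ⊕ y) ⊕ (:- b) ⊙ y) ≡.refl ⟩
        a₀⁻¹ *ₗ (a zero *ₗ head v +ᴹ rest) +ᴹ (- a₀⁻¹) *ₗ rest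
          ≈⟨ +ᴹ-congʳ (≈ᴹ-trans (*ₗ-cong refl eq) (*ₗ-zeroʳ a₀⁻¹)) ⟩
        0ᴹ +ᴹ (- a₀⁻¹) *ₗ rest
          ≈⟨ +ᴹ-identityˡ _ ⟩
        (- a₀⁻¹) *ₗ rest ∎

    extend : ∀ {n} {v : Vector Carrierᴹ (suc n)} → Independent (tail v) → head v ∉ span (tail v) →
             Independent v
    extend {v = v} tail-ind head∉ = independent λ a eq →
      let a₀≈0 = decidable-stable (a zero ≟ 0#) (λ a₀≉0 → head∉ (solve-head {v = v} a a₀≉0 eq))
          tail≈0 = begin
            lc (a ∘ suc) (tail v)                       ≈⟨ +ᴹ-identityˡ _ ⟨
            0ᴹ +ᴹ lc (a ∘ suc) (tail v)                 ≈⟨ +ᴹ-congʳ (scale-zero (head v) a₀≈0) ⟨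
            a zero *ₗ head v +ᴹ lc (a ∘ suc) (tail v)   ≈⟨ eq ⟩
            0ᴹ                                          ∎
      in λ where
        zero    → a₀≈0
        (suc i) → only-trivially tail-ind (a ∘ suc) tail≈0 i

    head∉tail : ∀ {n} {v : Vector Carrierᴹ (suc n)} → Independent v → head v ∉ span (tail v)
    head∉tail {v = v} v-ind (a , head≈) = 1≉0 1<q
      (only-trivially v-ind (1# ∷ λ i → - 1# * a i) (begin
        1# *ₗ head v +ᴹ lc (λ i → - 1# * a i) (tail v)
          ≈⟨ +ᴹ-cong (≈ᴹ-trans (*ₗ-identityˡ _) head≈) (lc-* (- 1#) a (tail v)) ⟩
        lc a (tail v) +ᴹ (- 1#) *ₗ lc a (tail v)
          ≈⟨ linear [] (lc a (tail v) ∷ []) (λ x → x ⊕ con -[1+ 0 ] ⊙ x ⊜ 𝟎) ≡.refl ⟩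
        0ᴹ ∎) zero)

    independent? : ∀ {n} (v : Vector Carrierᴹ n) → Dec (Independent v)
    independent? {zero}  v = yes (independent λ _ _ ())
    independent? {suc n} v with independent? (tail v) | head v ∈span? tail v
    ... | yes tail-ind | no  head∉ = yes (extend tail-ind head∉)
    ... | yes _        | yes head∈ = no (λ v-ind → head∉tail v-ind head∈)
    ... | no  ¬tail    | _         = no (¬tail ∘ independent-tail)

    shrink : ∀ {n} (v : Vector Carrierᴹ (suc n)) → ¬ Independent v →
             Σ[ u ∈ Vector Carrierᴹ n ] (∀ i → v i ∈ span u)
    shrink {n} v v-dep with head v ∈span? tail v
    ... | yes head∈ = tail v , λ where
            zero    → head∈
            (suc i) → ∈span (tail v) i
    ... | no head∉ with n
    ...   | zero  = contradiction (extend (independent λ _ _ ()) head∉) v-dep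
    ...   | suc _ =
            let u , tail⊆u = shrink (tail v) (λ tail-ind → v-dep (extend tail-ind head∉))
                hu = head v ∷ u
                u⊆hu = span-least (span hu) u (∈span hu ∘ suc)
            in hu , λ where
              zero    → ∈span hu zero
              (suc i) → u⊆hu (tail⊆u i)

    -- If w were dependent, `shrink` would put w, and hence v, into the span of one vector fewer,
    -- against `steinitz`. This permits changes of basis without computing coefficients.
    independent-by : ∀ {n} {v w : Vector Carrierᴹ n} → Independent v → (∀ i → v i ∈ span w) → Independent w
    independent-by {zero}  _ _ = independent λ _ _ ()
    independent-by {suc n} {v} {w} v-ind v⊆w = decidable-stable (independent? w) λ w-dep →
      let u , w⊆u = shrink w w-dep in
      steinitz (ℕ.n<1+n n) v u (λ i → span-least (span u) w w⊆u (v⊆w i)) v-ind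

    outside : ∀ {m n} → n < m → {v : Vector Carrierᴹ m} → Independent v → (u : Vector Carrierᴹ n) →
              ∃[ i ] v i ∉ span u
    outside n<m {v} v-ind u = Fin.¬∀⟶∃¬ _ (λ i → v i ∈ span u) (λ i → v i ∈span? u)
      (λ v⊆u → steinitz n<m v u v⊆u v-ind)

    spans : ∀ {n} {v u : Vector Carrierᴹ n} → Independent v → (∀ i → v i ∈ span u) → span u ≤ₛ span v
    spans {n} {v} {u} v-ind v⊆u {x} x∈u = decidable-stable (x ∈span? v) λ x∉v →
      steinitz (ℕ.n<1+n n) (x ∷ v) u (λ { zero → x∈u ; (suc i) → v⊆u i }) (extend v-ind x∉v)

  module _ {k} (B : KSubspace V k) where

    private
      module B = KSubspace B
      b = vectors B
      b-ind = independent (Basis.independent B.basis)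
      B⊆b = Basis.spanning B.basis

    abstract

      member-outside : ∀ {n} → n < k → (u : Vector Carrierᴹ n) → ∃[ t ] B.Member t × t ∉ span u
      member-outside n<k u = let i , bᵢ∉u = outside n<k b-ind u in b i , vectors∈ B i , bᵢ∉u

      independent-spans : {v : Vector Carrierᴹ k} → Independent v → (∀ i → B.Member (v i)) →
                          B.subspace ≤ₛ span v
      independent-spans v-ind v⊆B x∈B = spans v-ind (λ i → B⊆b (v⊆B i)) (B⊆b x∈B)

      dimension-bound : ∀ {n} → k < n → {v : Vector Carrierᴹ n} → (∀ i → B.Member (v i)) → ¬ Independent v
      dimension-bound k<n {v} v⊆B = steinitz k<n v b (λ i → B⊆b (v⊆B i))

      infix 4 _∈?_
      _∈?_ : ∀ x → Dec (B.Member x)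
      _∈?_ x = map′ (span-least B.subspace b (vectors∈ B)) B⊆b (x ∈span? b)

      ≤-from-basis : (X : Subspace V) → (∀ i → b i ∈ X) → B.subspace ≤ₛ X
      ≤-from-basis X b⊆X x∈B = span-least X b b⊆X (B⊆b x∈B)

  abstract

    independent-nonzero : ∀ {n} {v : Vector Carrierᴹ n} → Independent v → ∀ i → ¬ (v i ≈ᴹ 0ᴹ)
    independent-nonzero {v = v} v-ind i vᵢ≈0 = 1≉0 1<q (trans (sym (δ-diagonal i))
      (only-trivially v-ind (δ i) (≈ᴹ-trans (lc-δ i v) vᵢ≈0) i))
      where
      δ-diagonal : ∀ {n} (i : Fin n) → δ i i ≈ 1#
      δ-diagonal zero    = refl
      δ-diagonal (suc i) = δ-diagonal i

    unscale : ∀ (X : Subspace V) {k x} → ¬ (k ≈ 0#) → k *ₗ x ∈ X → x ∈ X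
    unscale X {k} {x} k≉0 kx∈X = Subspace.respects X (begin
      k ⁻¹⟨ k≉0 ⟩ *ₗ (k *ₗ x)   ≈⟨ linear (k ∷ k ⁻¹⟨ k≉0 ⟩ ∷ []) (x ∷ [])
          (λ k l x → l ⊙ (k ⊙ x) ⊜ (k :* l) ⊙ x) ≡.refl ⟩
      (k * k ⁻¹⟨ k≉0 ⟩) *ₗ x    ≈⟨ *ₗ-cong (inverseʳ⟨ k≉0 ⟩) ≈ᴹ-refl ⟩
      1# *ₗ x                   ≈⟨ *ₗ-identityˡ x ⟩
      x                         ∎) (Subspace.*ₗ-closed X (k ⁻¹⟨ k≉0 ⟩) kx∈X)

    nonzero-independent : ∀ {x} → ¬ (x ≈ᴹ 0ᴹ) → Independent (x ∷ [])
    nonzero-independent x≉0 = extend (independent λ _ _ ()) (x≉0 ∘ proj₂)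

    independent-swap : ∀ {x y} → Independent (x ∷ y ∷ []) → Independent (y ∷ x ∷ [])
    independent-swap {x} {y} xy-ind = independent-by xy-ind λ where
      0F → ∈span (y ∷ x ∷ []) 1F
      1F → ∈span (y ∷ x ∷ []) 0F

decidable-equality : ∀ {q} (F : Field) (order : HasOrder F q) (V : Geometry.VectorSpace F) {n : ℕ} →
                     Geometry.HasDimension F V n → Decidable (LeftModule._≈ᴹ_ V)
decidable-equality F order V {n} dim x y = map′
  (λ eq → ≈ᴹ-trans (proj₂ (coordinates x)) (≈ᴹ-trans (lc-congˡ eq) (≈ᴹ-sym (proj₂ (coordinates y)))))
  (λ x≈y → lc-injective (independent (Basis.independent dim))
    (≈ᴹ-trans (≈ᴹ-sym (proj₂ (coordinates x))) (≈ᴹ-trans x≈y (proj₂ (coordinates y)))))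
  (Fin.all? (λ i → proj₁ (coordinates x) i ≟ proj₁ (coordinates y) i))
  where
  open Geometry F
  open LeftModule V
  open FiniteField F order
  open Spans F V
  coordinates : ∀ x → ∃[ a ] x ≈ᴹ lc a (Basis.vectors dim)
  coordinates x = Basis.spanning dim {x} _

-- Perpendicularity relations and hyperbolic pairs.

record Orthogonality (F : Field) (M : Geometry.VectorSpace F) : Set₁ where
  open LeftModule M
  infix 4 _⟂_
  field
    _⟂_       : Carrierᴹ → Carrierᴹ → Set
    ⟂-resp    : ∀ {x y z} → y ≈ᴹ z → x ⟂ y → x ⟂ z
    ⟂-refl    : ∀ {x} → x ⟂ x
    ⟂-sym     : ∀ {x y} → x ⟂ y → y ⟂ x
    ⟂-+       : ∀ {x y z} → x ⟂ y → x ⟂ z → x ⟂ (y +ᴹ z)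
    ⟂-*       : ∀ k {x y} → x ⟂ y → x ⟂ (k *ₗ y)
    -- Says that the vectors perpendicular to x have codimension at most one. This is the relational
    -- trace of x ⟂ y being the vanishing of a linear functional at y.
    ⟂-project : ∀ {x z} → ¬ (x ⟂ z) → ∀ y → ∃[ k ] x ⟂ (y +ᴹ k *ₗ z)

module HyperbolicPairs {q : ℕ} (F : Field) (order : HasOrder F q) (1<q : 1 < q)
  (M : Geometry.VectorSpace F) (_≟ᴹ_ : Decidable (LeftModule._≈ᴹ_ M))
  (orthogonality : Orthogonality F M) where

  open CommutativeRing (commutativeRingOf F) hiding (zero)
  open Geometry F
  open LeftModule M
  open FiniteField F order
  open LinearAlgebra F order 1<q M _≟ᴹ_
  open Orthogonality orthogonality

  orthogonal : Carrierᴹ → Subspace M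
  orthogonal x = record
    { Member    = x ⟂_
    ; respects  = ⟂-resp
    ; 0-closed  = ⟂-resp (*ₗ-zeroˡ x) (⟂-* 0# ⟂-refl)
    ; +-closed  = ⟂-+
    ; *ₗ-closed = λ k → ⟂-* k
    }

  ⟂-respˡ : ∀ {x y z} → x ≈ᴹ y → x ⟂ z → y ⟂ z
  ⟂-respˡ x≈y = ⟂-sym ∘ ⟂-resp x≈y ∘ ⟂-sym

  ⟂-cancel : ∀ {x y z} → x ⟂ (y +ᴹ z) → x ⟂ y → x ⟂ z
  ⟂-cancel {x} {y} {z} x⟂y+z x⟂y = ⟂-resp
    (linear [] (y ∷ z ∷ []) (λ y z → (y ⊕ z) ⊕ ⊝ y ⊜ z) ≡.refl)
    (⟂-+ x⟂y+z (-‿closed (orthogonal x) x⟂y))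

  ⟂-coefficient : ∀ {x y k} → ¬ (x ⟂ y) → x ⟂ (k *ₗ y) → k ≈ 0#
  ⟂-coefficient {x} ¬x⟂y x⟂ky = decidable-stable (_ ≟ 0#) λ k≉0 → ¬x⟂y (unscale (orthogonal x) k≉0 x⟂ky)

  ⟂-zeroʳ : ∀ {x y k} → k ≈ 0# → x ⟂ (k *ₗ y)
  ⟂-zeroʳ {x} {y} k≈0 = ⟂-resp (≈ᴹ-sym (scale-zero y k≈0))
    (Subspace.0-closed (orthogonal x))

  NonDegenerate : Subspace M → Set
  NonDegenerate Z = ∀ {x} → x ∈ Z → ¬ (x ≈ᴹ 0ᴹ) → ∃[ y ] y ∈ Z × ¬ (x ⟂ y)

  complement : Carrierᴹ → Carrierᴹ → Subspace M → Subspace M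
  complement e f Z = record
    { Member    = λ w → w ∈ Z × e ⟂ w × f ⟂ w
    ; respects  = λ v≈w (v∈Z , e⟂v , f⟂v) → Subspace.respects Z v≈w v∈Z , ⟂-resp v≈w e⟂v , ⟂-resp v≈w f⟂v
    ; 0-closed  = Subspace.0-closed Z , Subspace.0-closed (orthogonal e) , Subspace.0-closed (orthogonal f)
    ; +-closed  = λ (v∈Z , e⟂v , f⟂v) (w∈Z , e⟂w , f⟂w) → Subspace.+-closed Z v∈Z w∈Z , ⟂-+ e⟂v e⟂w ,
        ⟂-+ f⟂v f⟂w
    ; *ₗ-closed = λ k (w∈Z , e⟂w , f⟂w) → Subspace.*ₗ-closed Z k w∈Z , ⟂-* k e⟂w , ⟂-* k f⟂w
    }

  -- The two corrections do not disturb each other: since e ⟂ e and f ⟂ f, the multiple of f can be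
  -- chosen for e alone and the multiple of e for f alone.
  project : ∀ {e f Z h} → ¬ (e ⟂ f) → e ∈ Z → f ∈ Z → h ∈ Z →
            ∃₂ λ a b → h +ᴹ (a *ₗ e +ᴹ b *ₗ f) ∈ complement e f Z
  project {e} {f} {Z} {h} ¬e⟂f e∈Z f∈Z h∈Z =
    let b , e⟂ = ⟂-project ¬e⟂f h
        a , f⟂ = ⟂-project (¬e⟂f ∘ ⟂-sym) h
    in a , b ,
       Subspace.+-closed Z h∈Z (Subspace.+-closed Z (Subspace.*ₗ-closed Z a e∈Z)
           (Subspace.*ₗ-closed Z b f∈Z)) ,
       ⟂-resp (linear (a ∷ b ∷ []) (h ∷ e ∷ f ∷ []) (λ a b h e f → (h ⊕ b ⊙ f) ⊕ a ⊙ e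
           ⊜ h ⊕ (a ⊙ e ⊕ b ⊙ f)) ≡.refl)
         (⟂-+ e⟂ (⟂-* a ⟂-refl)) ,
       ⟂-resp (linear (a ∷ b ∷ []) (h ∷ e ∷ f ∷ []) (λ a b h e f → (h ⊕ a ⊙ e) ⊕ b ⊙ f
           ⊜ h ⊕ (a ⊙ e ⊕ b ⊙ f)) ≡.refl)
         (⟂-+ f⟂ (⟂-* b ⟂-refl))

  -- A partner y of x in Z may be replaced by its projection, because x is perpendicular to the
  -- multiples of e and f that are added.
  complement-nondegenerate : ∀ {e f Z} → ¬ (e ⟂ f) → e ∈ Z → f ∈ Z →
                             NonDegenerate Z → NonDegenerate (complement e f Z)
  complement-nondegenerate {e} {f} {Z} ¬e⟂f e∈Z f∈Z Z-nd {x} (x∈Z , e⟂x , f⟂x) x≉0 =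
    let y , y∈Z , ¬x⟂y = Z-nd x∈Z x≉0
        a , b , y′∈ = project {Z = Z} ¬e⟂f e∈Z f∈Z y∈Z
    in _ , y′∈ , λ x⟂y′ → ¬x⟂y (⟂-cancel
         (⟂-resp (+ᴹ-comm y (a *ₗ e +ᴹ b *ₗ f)) x⟂y′)
         (⟂-+ (⟂-* a (⟂-sym e⟂x)) (⟂-* b (⟂-sym f⟂x))))

  -- The invariant of the construction of a symplectic basis: u lists the hyperbolic pairs collected
  -- so far, and Z is the complementary summand still to be split.
  record Frame {n} (u : Vector Carrierᴹ n) (Z : Subspace M) : Set where
    field
      frame-independent : Independent u
      nondegenerate     : NonDegenerate Z
      decompose         : ∀ h → ∃[ s ] s ∈ span u × h +ᴹ s ∈ Z
      disjoint          : ∀ {h} → h ∈ Z → h ∈ span u → h ≈ᴹ 0ᴹ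

  open Frame

  trivial-frame : NonDegenerate (wholeSpace M) → Frame [] (wholeSpace M)
  trivial-frame nd = record
    { frame-independent = independent λ _ _ ()
    ; nondegenerate     = nd
    ; decompose         = λ h → 0ᴹ , ([] , ≈ᴹ-refl) , _
    ; disjoint          = λ _ (_ , h≈0) → h≈0
    }

  extend-frame : ∀ {n} {u : Vector Carrierᴹ n} {Z e f} → Frame u Z → e ∈ Z → f ∈ Z → ¬ (e ⟂ f) →
                 Frame (e ∷ f ∷ u) (complement e f Z)
  extend-frame {u = u} {Z} {e} {f} frame e∈Z f∈Z ¬e⟂f = record
    { frame-independent = extend (extend (frame-independent frame) f∉) e∉
    ; nondegenerate     = complement-nondegenerate {Z = Z} ¬e⟂f e∈Z f∈Z (nondegenerate frame)
    ; decompose         = λ h →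
        let s , s∈ , h+s∈Z = decompose frame h
            a , b , h′∈ = project {Z = Z} ¬e⟂f e∈Z f∈Z h+s∈Z
        in s +ᴹ (a *ₗ e +ᴹ b *ₗ f) ,
           Subspace.+-closed (span (e ∷ f ∷ u)) (u⊆ s∈)
             (Subspace.+-closed (span (e ∷ f ∷ u)) (Subspace.*ₗ-closed (span (e ∷ f ∷ u)) a
                 (∈span (e ∷ f ∷ u) 0F))
               (Subspace.*ₗ-closed (span (e ∷ f ∷ u)) b (∈span (e ∷ f ∷ u) 1F))) ,
           Subspace.respects (complement e f Z) (+ᴹ-assoc h s _) h′∈
    ; disjoint          = λ {h} (h∈Z , e⟂h , f⟂h) (c , h≈) →
        let s    = lc (tail (tail c)) u
            r    = c 0F *ₗ e +ᴹ c 1F *ₗ f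
            r∈Z  = Subspace.+-closed Z (Subspace.*ₗ-closed Z (c 0F) e∈Z) (Subspace.*ₗ-closed Z (c 1F) f∈Z)
            -- Both h and r lie in Z, hence so does s, which also lies in the span of u.
            s≈0  = disjoint frame (Subspace.respects Z
                     (≈ᴹ-trans (+ᴹ-congʳ h≈) (linear (c 0F ∷ c 1F ∷ []) (e ∷ f ∷ s ∷ [])
                       (λ a b e f s → (a ⊙ e ⊕ (b ⊙ f ⊕ s)) ⊕ ⊝ (a ⊙ e ⊕ b ⊙ f) ⊜ s) ≡.refl))
                     (Subspace.+-closed Z h∈Z (-‿closed Z r∈Z))) (tail (tail c) , ≈ᴹ-refl)
            h≈r  = ≈ᴹ-trans h≈ (≈ᴹ-trans (+ᴹ-congˡ (+ᴹ-congˡ s≈0)) (+ᴹ-congˡ (+ᴹ-identityʳ _)))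
            -- Testing h against e removes the e-component, as e ⟂ e, and isolates the coefficient
            -- of f; testing against f isolates that of e.
            c₁≈0 = ⟂-coefficient ¬e⟂f (⟂-cancel (⟂-resp h≈r e⟂h) (⟂-* (c 0F) ⟂-refl))
            c₀≈0 = ⟂-coefficient (¬e⟂f ∘ ⟂-sym)
                     (⟂-cancel (⟂-resp (≈ᴹ-trans h≈r (+ᴹ-comm _ _)) f⟂h) (⟂-* (c 1F) ⟂-refl))
        in ≈ᴹ-trans h≈r (≈ᴹ-trans (+ᴹ-cong
             (scale-zero e c₀≈0)
             (scale-zero f c₁≈0)) (+ᴹ-identityˡ 0ᴹ))
    }
    where
    u⊆ : span u ≤ₛ span (e ∷ f ∷ u)
    u⊆ = span-least (span (e ∷ f ∷ u)) u (λ i → ∈span (e ∷ f ∷ u) (suc (suc i)))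
    f∉ : f ∉ span u
    f∉ f∈ = ¬e⟂f (⟂-resp (≈ᴹ-sym (disjoint frame f∈Z f∈)) (Subspace.0-closed (orthogonal e)))
    e∉ : e ∉ span (f ∷ u)
    e∉ (c , e≈) = ¬e⟂f (⟂-respˡ (≈ᴹ-sym e≈cf) (⟂-sym (⟂-* (c 0F) ⟂-refl)))
      where
      s≈0 : lc (c ∘ suc) u ≈ᴹ 0ᴹ
      s≈0 = disjoint frame (Subspace.respects Z
        (≈ᴹ-trans (+ᴹ-congʳ e≈) (linear (c 0F ∷ []) (f ∷ lc (c ∘ suc) u ∷ []) (λ c f s →
            (c ⊙ f ⊕ s) ⊕ ⊝ (c ⊙ f) ⊜ s) ≡.refl))
        (Subspace.+-closed Z e∈Z (-‿closed Z (Subspace.*ₗ-closed Z (c 0F) f∈Z)))) (c ∘ suc , ≈ᴹ-refl)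
      e≈cf : e ≈ᴹ c 0F *ₗ f
      e≈cf = ≈ᴹ-trans e≈ (≈ᴹ-trans (+ᴹ-congˡ s≈0) (+ᴹ-identityʳ _))

  -- A vector outside the span of u has a nonzero component in Z, and nondegeneracy of Z gives that
  -- component a partner.
  new-pair : ∀ {n m} {u : Vector Carrierᴹ n} {Z} → Frame u Z → HasDimension M m → n < m →
             ∃₂ λ e f → e ∈ Z × f ∈ Z × ¬ (e ⟂ f)
  new-pair {u = u} {Z} frame dim n<m =
    let i , h∉ = outside n<m (independent (Basis.independent dim)) u
        h = Basis.vectors dim i
        s , s∈ , e∈Z = decompose frame h
        e≉0 = λ e≈0 → h∉ (Subspace.respects (span u) (≈ᴹ-trans (≈ᴹ-sym (+ᴹ-identityˡ _))
            (≈ᴹ-trans (+ᴹ-congʳ (≈ᴹ-sym e≈0))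
                (linear [] (h ∷ s ∷ []) (λ h s → (h ⊕ s) ⊕ ⊝ s ⊜ h) ≡.refl))) (-‿closed (span u) s∈))
        f , f∈Z , ¬e⟂f = nondegenerate frame e∈Z e≉0
    in h +ᴹ s , f , e∈Z , f∈Z , ¬e⟂f

  ambient : ∀ {m} → HasDimension M m → KSubspace M m
  ambient dim = record { subspace = wholeSpace M ; basis = dim }

  full-frame-spans : ∀ {m} {u : Vector Carrierᴹ m} {Z} → Frame u Z → HasDimension M m → ∀ h → h ∈ span u
  full-frame-spans {u = u} frame dim h = independent-spans (ambient dim) {v = u} (frame-independent frame)
      (λ _ → _) {h} _

-- Coordinate spaces.

module CoordinateSpaces (F : Field) where

  open CommutativeRing (commutativeRingOf F) hiding (zero)
  open Geometry F

  -- `δ` is the same for every space over F; `coordinateSpace 0` is an arbitrary choice of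
  -- parameter.
  unit : ∀ {n} → Fin n → Vector Carrier n
  unit = LinearCombinations.δ F (coordinateSpace 0)

  module _ {n : ℕ} where
    open LinearCombinations F (coordinateSpace n) public using () renaming (lc to lcⁿ)

  private
    lc-zero : ∀ {m n} a (v : Vector (Vector Carrier n) m) j → (∀ i → v i j ≈ 0#) → lcⁿ a v j ≈ 0#
    lc-zero {zero}  a v j v≈0 = refl
    lc-zero {suc m} a v j v≈0 = trans
      (+-cong (trans (*-congˡ (v≈0 zero)) (zeroʳ _)) (lc-zero (tail a) (tail v) j (λ i → v≈0 (suc i))))
          (+-identityˡ 0#)

    lc-suc : ∀ {m n} a (v : Vector (Vector Carrier n) m) (v′ : Vector (Vector Carrier (suc n)) m) j →
             (∀ i → v′ i (suc j) ≈ v i j) → lcⁿ a v′ (suc j) ≈ lcⁿ a v j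
    lc-suc {zero}  a v v′ j eq = refl
    lc-suc {suc m} a v v′ j eq =
      +-cong (*-congˡ (eq zero)) (lc-suc (tail a) (tail v) (tail v′) j (λ i → eq (suc i)))

  lc-unit : ∀ {n} (a : Vector Carrier n) j → lcⁿ a (unit {n}) j ≈ a j
  lc-unit {suc n} a zero = trans (+-cong (*-identityʳ _) (lc-zero (tail a) (tail unit) zero (λ _ → refl)))
      (+-identityʳ _)
  lc-unit {suc n} a (suc j) = trans
    (+-cong (zeroʳ _) (trans (lc-suc (tail a) (unit {n}) (tail (unit {suc n})) j (λ _ → refl))
        (lc-unit (tail a) j)))
    (+-identityˡ _)

  standard-basis : ∀ n → HasDimension (coordinateSpace n) n
  standard-basis n = record
    { vectors     = unit
    ; members     = _
    ; independent = λ a eq i → trans (sym (lc-unit a i)) (eq i)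
    ; spanning    = λ {x} _ → x , λ i → sym (lc-unit x i)
    }

  pointwise-≟ : ∀ {q n} → HasOrder F q → Decidable (LeftModule._≈ᴹ_ (coordinateSpace n))
  pointwise-≟ order x y = Fin.all? (λ i → x i ≟ y i)
    where open FiniteField F order

-- The symplectic form on F⁴ and its totally isotropic lines.

module SymplecticSpace {q : ℕ} (F : Field) (order : HasOrder F q) (1<q : 1 < q) where

  open CommutativeRing (commutativeRingOf F) hiding (zero)
  open Geometry F
  open FiniteField F order
  open CoordinateSpaces F
  open IntegerCoefficientSolver (commutativeRingOf F)
    using (_:*_; _:+_; con; :-_; _:-_; solve; _:=_)

  F⁴ : VectorSpace
  F⁴ = coordinateSpace 4

  open LeftModule F⁴
  open LinearAlgebra F order 1<q F⁴ (pointwise-≟ order)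

  β : Carrierᴹ → Carrierᴹ → Carrier
  β = symplecticForm

  β-cong : ∀ {x y x′ y′} → x ≋ x′ → y ≋ y′ → β x y ≈ β x′ y′
  β-cong x≋x′ y≋y′ = +-cong (+-cong (+-cong
    (*-cong (x≋x′ 0F) (y≋y′ 1F)) (-‿cong (*-cong (x≋x′ 1F) (y≋y′ 0F))))
    (*-cong (x≋x′ 2F) (y≋y′ 3F))) (-‿cong (*-cong (x≋x′ 3F) (y≋y′ 2F)))

  β-+ʳ : ∀ x y z → β x (y +ᴹ z) ≈ β x y + β x z
  β-+ʳ x y z = solve 12 (λ x₀ x₁ x₂ x₃ y₀ y₁ y₂ y₃ z₀ z₁ z₂ z₃ →
      x₀ :* (y₁ :+ z₁) :- x₁ :* (y₀ :+ z₀) :+ x₂ :* (y₃ :+ z₃) :- x₃ :* (y₂ :+ z₂) :=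
      (x₀ :* y₁ :- x₁ :* y₀ :+ x₂ :* y₃ :- x₃ :* y₂) :+ (x₀ :* z₁ :- x₁ :* z₀ :+ x₂ :* z₃ :- x₃ :* z₂)) refl
    (x 0F) (x 1F) (x 2F) (x 3F) (y 0F) (y 1F) (y 2F) (y 3F) (z 0F) (z 1F) (z 2F) (z 3F)

  β-*ʳ : ∀ k x y → β x (k *ₗ y) ≈ k * β x y
  β-*ʳ k x y = solve 9 (λ k x₀ x₁ x₂ x₃ y₀ y₁ y₂ y₃ →
      x₀ :* (k :* y₁) :- x₁ :* (k :* y₀) :+ x₂ :* (k :* y₃) :- x₃ :* (k :* y₂) :=
      k :* (x₀ :* y₁ :- x₁ :* y₀ :+ x₂ :* y₃ :- x₃ :* y₂)) refl
    k (x 0F) (x 1F) (x 2F) (x 3F) (y 0F) (y 1F) (y 2F) (y 3F)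

  β-antisym : ∀ x y → β y x ≈ - β x y
  β-antisym x y = solve 8 (λ x₀ x₁ x₂ x₃ y₀ y₁ y₂ y₃ →
      y₀ :* x₁ :- y₁ :* x₀ :+ y₂ :* x₃ :- y₃ :* x₂ :=
      :- (x₀ :* y₁ :- x₁ :* y₀ :+ x₂ :* y₃ :- x₃ :* y₂)) refl
    (x 0F) (x 1F) (x 2F) (x 3F) (y 0F) (y 1F) (y 2F) (y 3F)

  β-diagonal : ∀ x → β x x ≈ 0#
  β-diagonal x = solve 4 (λ x₀ x₁ x₂ x₃ →
      x₀ :* x₁ :- x₁ :* x₀ :+ x₂ :* x₃ :- x₃ :* x₂ := con (+ 0)) refl (x 0F) (x 1F) (x 2F) (x 3F)

  infix 4 _⊥_
  record _⊥_ (x y : Carrierᴹ) : Set where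
    constructor orthogonally
    field β≈0 : β x y ≈ 0#

  open _⊥_ public

  -0≈0 : - 0# ≈ 0#
  -0≈0 = solve 0 (:- con (+ 0) := con (+ 0)) refl

  ⊥-orthogonality : Orthogonality F F⁴
  ⊥-orthogonality = record
    { _⟂_       = _⊥_
    ; ⟂-resp    = λ {x} y≈z (orthogonally xy≈0) →
        orthogonally (trans (β-cong {x} (λ _ → refl) (λ i → sym (y≈z i))) xy≈0)
    ; ⟂-refl    = λ {x} → orthogonally (β-diagonal x)
    ; ⟂-sym     = λ {x} {y} (orthogonally xy≈0) →
        orthogonally (trans (β-antisym x y) (trans (-‿cong xy≈0) -0≈0))
    ; ⟂-+       = λ {x} {y} {z} (orthogonally xy≈0) (orthogonally xz≈0) → orthogonally
                    (trans (β-+ʳ x y z) (trans (+-cong xy≈0 xz≈0) (+-identityˡ 0#)))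
    ; ⟂-*       = λ k {x} {y} (orthogonally xy≈0) →
        orthogonally (trans (β-*ʳ k x y) (trans (*-congˡ xy≈0) (zeroʳ k)))
    ; ⟂-project = λ {x} {z} ¬x⊥z y →
        let xz≉0 = ¬x⊥z ∘ orthogonally
            l = β x z ⁻¹⟨ xz≉0 ⟩
            k = - (β x y * l)
        in k , orthogonally (begin
          β x (y +ᴹ k *ₗ z)             ≈⟨ β-+ʳ x y (k *ₗ z) ⟩
          β x y + β x (k *ₗ z)          ≈⟨ +-congˡ (β-*ʳ k x z) ⟩
          β x y + k * β x z             ≈⟨ solve 3 (λ a b l → a :+ :- (a :* l) :* b
              := a :- a :* (b :* l)) refl (β x y) (β x z) l ⟩
          β x y - β x y * (β x z * l)   ≈⟨ +-congˡ
              (-‿cong (trans (*-congˡ (inverseʳ⟨ xz≉0 ⟩)) (*-identityʳ _))) ⟩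
          β x y - β x y                 ≈⟨ -‿inverseʳ _ ⟩
          0#                            ∎)
    }
    where open ≈-Reasoning setoid

  open Orthogonality ⊥-orthogonality
    using () renaming (⟂-resp to ⊥-resp; ⟂-refl to ⊥-refl; ⟂-sym to ⊥-sym; ⟂-+ to ⊥-+; ⟂-* to ⊥-*) public
  open HyperbolicPairs F order 1<q F⁴ (pointwise-≟ order) ⊥-orthogonality
    using (orthogonal; ⟂-coefficient; ⟂-cancel; NonDegenerate; Frame; trivial-frame; extend-frame;
        new-pair; full-frame-spans; complement) public

  -- The test vectors form the dual basis with respect to β, that is, signed unit vectors in the
  -- order that reads off the coordinates of x.
  orthogonal-to-all : ∀ {x} → (∀ y → x ⊥ y) → x ≈ᴹ 0ᴹ
  orthogonal-to-all {x} x⊥ = λ where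
      0F → trans (solve 4 (λ a b c d → a := a :* con (+ 1) :- b :* con (+ 0) :+ c :* con (+ 0) :- d
          :* con (+ 0)) refl
             (x 0F) (x 1F) (x 2F) (x 3F)) (β≈0 (x⊥ (0# ∷ 1# ∷ 0# ∷ 0# ∷ [])))
      1F → trans (solve 4 (λ a b c d → b := a :* con (+ 0) :- b :* con -[1+ 0 ] :+ c :* con (+ 0) :- d
          :* con (+ 0)) refl
             (x 0F) (x 1F) (x 2F) (x 3F)) (β≈0 (x⊥ (- 1# ∷ 0# ∷ 0# ∷ 0# ∷ [])))
      2F → trans (solve 4 (λ a b c d → c := a :* con (+ 0) :- b :* con (+ 0) :+ c :* con (+ 1) :- d
          :* con (+ 0)) refl
             (x 0F) (x 1F) (x 2F) (x 3F)) (β≈0 (x⊥ (0# ∷ 0# ∷ 0# ∷ 1# ∷ [])))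
      3F → trans (solve 4 (λ a b c d → d := a :* con (+ 0) :- b :* con (+ 0) :+ c :* con (+ 0) :- d
          :* con -[1+ 0 ]) refl
             (x 0F) (x 1F) (x 2F) (x 3F)) (β≈0 (x⊥ (0# ∷ 0# ∷ - 1# ∷ 0# ∷ [])))

  F⁴-dimension : HasDimension F⁴ 4
  F⁴-dimension = standard-basis 4

  F⁴-whole : KSubspace F⁴ 4
  F⁴-whole = record { subspace = wholeSpace F⁴ ; basis = F⁴-dimension }

  four-span : ∀ {v : Vector Carrierᴹ 4} → Independent v → ∀ x → x ∈ span v
  four-span {v} v-ind x = independent-spans F⁴-whole {v = v} v-ind (λ _ → _) {x} _

  four-orthogonal : ∀ {x} {v : Vector Carrierᴹ 4} → Independent v → (∀ i → x ⊥ v i) → x ≈ᴹ 0ᴹ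
  four-orthogonal {x} {v} v-ind x⊥v = orthogonal-to-all λ y → span-least (orthogonal x) v x⊥v
      (four-span v-ind y)

  isotropic-span : ∀ {x y u v} → x ⊥ y → u ∈ span (x ∷ y ∷ []) → v ∈ span (x ∷ y ∷ []) → u ⊥ v
  isotropic-span {x} {y} {u} {v} x⊥y u∈ v∈ = ⊥-sym {v} {u} (span-least (orthogonal v) (x ∷ y ∷ [])
    (λ { 0F → ⊥-sym {x} {v} (span-least (orthogonal x) (x ∷ y ∷ [])
        (λ { 0F → ⊥-refl {x} ; 1F → x⊥y }) {v} v∈)
       ; 1F → ⊥-sym {y} {v} (span-least (orthogonal y) (x ∷ y ∷ [])
           (λ { 0F → ⊥-sym {x} {y} x⊥y ; 1F → ⊥-refl {y} }) {v} v∈) })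
    {u} u∈)

  nonorthogonal : ∀ {x} → ¬ (x ≈ᴹ 0ᴹ) → ∃[ y ] ¬ (x ⊥ y)
  nonorthogonal {x} x≉0 =
    let i , ¬x⊥ = Fin.¬∀⟶∃¬ 4 (λ i → x ⊥ unit i) (λ i → map′ orthogonally β≈0 (β x (unit i) ≟ 0#))
          (λ x⊥ → x≉0 (four-orthogonal {x} {unit} (independent (Basis.independent F⁴-dimension)) x⊥))
    in unit i , ¬x⊥

  -- Otherwise z, x, y and some w form a basis, and a combination of x and z is orthogonal to all of it.
  isotropic-maximal : ∀ {x y z} → Independent (x ∷ y ∷ []) → x ⊥ y → x ⊥ z → y ⊥ z → z ∈ span (x ∷ y ∷ [])
  isotropic-maximal {x} {y} {z} xy x⊥y x⊥z y⊥z = decidable-stable (z ∈span? (x ∷ y ∷ [])) λ z∉ →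
    let zxy = extend {v = z ∷ x ∷ y ∷ []} xy z∉
        i , w∉ = outside (ℕ.n<1+n 3) {v = unit} (independent (Basis.independent F⁴-dimension))
            (z ∷ x ∷ y ∷ [])
        w = unit i
        wzxy = extend {v = w ∷ z ∷ x ∷ y ∷ []} zxy w∉
        a = β x w
        b = β z w
        u = a *ₗ z +ᴹ (- b) *ₗ x
        u⊥w = orthogonally (trans (β-antisym w u) (trans (-‿cong (begin
          β w u                                  ≈⟨ trans (β-+ʳ w (a *ₗ z) ((- b) *ₗ x))
              (+-cong (β-*ʳ a w z) (β-*ʳ (- b) w x)) ⟩
          a * β w z + - b * β w x                ≈⟨ +-cong (*-congˡ (β-antisym z w))
              (*-congˡ (β-antisym x w)) ⟩
          a * - b + - b * - a                    ≈⟨ solve 2 (λ a b → a :* :- b :+ :- b :* :- a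
              := con (+ 0)) refl a b ⟩
          0#                                     ∎)) -0≈0))
        u⊥z = ⊥-sym (⊥-+ (⊥-* a ⊥-refl) (⊥-* (- b) (⊥-sym x⊥z)))
        u⊥x = ⊥-sym (⊥-+ (⊥-* a x⊥z) (⊥-* (- b) ⊥-refl))
        u⊥y = ⊥-sym (⊥-+ (⊥-* a y⊥z) (⊥-* (- b) (⊥-sym x⊥y)))
        u≈0 = four-orthogonal {u} {w ∷ z ∷ x ∷ y ∷ []} wzxy λ { 0F → u⊥w ; 1F → u⊥z ; 2F → u⊥x ; 3F → u⊥y }
        a≈0 = only-trivially zxy (a ∷ - b ∷ 0# ∷ []) (≈ᴹ-trans
          (linear (a ∷ - b ∷ []) (z ∷ x ∷ y ∷ []) (λ a b z x y →
            a ⊙ z ⊕ (b ⊙ x ⊕ (con (+ 0) ⊙ y ⊕ 𝟎)) ⊜ a ⊙ z ⊕ b ⊙ x) ≡.refl) u≈0) 0F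
        x≈0 = four-orthogonal {x} {w ∷ z ∷ x ∷ y ∷ []} wzxy λ { 0F → orthogonally a≈0 ; 1F → x⊥z ; 2F →
            ⊥-refl ; 3F → x⊥y }
    in independent-nonzero {v = x ∷ y ∷ []} xy 0F x≈0
    where
    open ≈-Reasoning setoid

  module _ (l : IncidenceStructure.Line symplecticQuadrangle) where

    private
      L = KSubspace.subspace (proj₁ l)

    m₀ m₁ : Carrierᴹ
    m₀ = vectors (proj₁ l) 0F
    m₁ = vectors (proj₁ l) 1F

    m₀∈ : m₀ ∈ L
    m₀∈ = vectors∈ (proj₁ l) 0F

    m₁∈ : m₁ ∈ L
    m₁∈ = vectors∈ (proj₁ l) 1F

    m-pair : Independent (m₀ ∷ m₁ ∷ [])
    m-pair = independent λ a eq →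
      only-trivially (independent {v = vectors (proj₁ l)}
          (Basis.independent (KSubspace.basis (proj₁ l)))) a eq

    m₀⊥m₁ : m₀ ⊥ m₁
    m₀⊥m₁ = orthogonally (proj₂ l m₀∈ m₁∈)

    line⊆ : L ≤ₛ span (m₀ ∷ m₁ ∷ [])
    line⊆ v∈ = independent-spans (proj₁ l) {v = m₀ ∷ m₁ ∷ []} m-pair (λ { 0F → m₀∈ ; 1F → m₁∈ }) v∈

    ⊆line : span (m₀ ∷ m₁ ∷ []) ≤ₛ L
    ⊆line {v} = span-least L (m₀ ∷ m₁ ∷ []) (λ { 0F → m₀∈ ; 1F → m₁∈ }) {v}

-- Recovering the symplectic form from a perpendicularity relation.

module SymplecticCoordinates {q : ℕ} (F : Field) (order : HasOrder F q) (1<q : 1 < q)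
  (M : Geometry.VectorSpace F) (_≟ᴹ_ : Decidable (LeftModule._≈ᴹ_ M))
  (orthogonality : Orthogonality F M) where

  open CommutativeRing (commutativeRingOf F) hiding (zero)
  open Geometry F
  open LeftModule M
  open FiniteField F order
  open LinearAlgebra F order 1<q M _≟ᴹ_
  open Orthogonality orthogonality
  open HyperbolicPairs F order 1<q M _≟ᴹ_ orthogonality
  open IntegerCoefficientSolver (commutativeRingOf F)
    using (_:*_; _:+_; con; :-_; _:-_; solve; _:=_)

  -- β = symplecticForm describes ⟂ on multiples of "good" vectors; if x and y are good
  -- and not perpendicular, x + y is good because both x + y ⟂ w and β(x + y, w) = 0
  -- express that the ⟨x,y⟩-component of w is a multiple of x + y.  Over the basis
  -- vectors and e₁ + e₂ (whose goodness fixes the scale of f₂) such sums reach every vector.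
  module StandardForm {e₁ f₁ e₂ f₂ : Carrierᴹ}
    (¬e₁⟂f₁ : ¬ (e₁ ⟂ f₁)) (¬e₂⟂f₂ : ¬ (e₂ ⟂ f₂))
    (e₁⟂e₂ : e₁ ⟂ e₂) (e₁⟂f₂ : e₁ ⟂ f₂) (f₁⟂e₂ : f₁ ⟂ e₂) (f₁⟂f₂ : f₁ ⟂ f₂)
    (e₁+e₂⟂f₁-f₂ : (e₁ +ᴹ e₂) ⟂ (f₁ +ᴹ -ᴹ f₂)) where

    basis : Vector Carrierᴹ 4
    basis = e₁ ∷ f₁ ∷ e₂ ∷ f₂ ∷ []

    κ : Vector Carrier 4 → Carrierᴹ
    κ c = lc c basis

    β : Vector Carrier 4 → Vector Carrier 4 → Carrier
    β = symplecticForm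

    record Good (c : Vector Carrier 4) : Set where
      field
        ⟂⇒β≈0 : ∀ w → κ c ⟂ κ w → β c w ≈ 0#
        β≈0⇒⟂ : ∀ w → β c w ≈ 0# → κ c ⟂ κ w

    open Good

    β-congˡ : ∀ {c c′} w → c ≋ c′ → β c w ≈ β c′ w
    β-congˡ {c} {c′} w c≋c′ = SymplecticSpace.β-cong F order 1<q {c} {w} {c′} {w} c≋c′ (λ _ → refl)

    Good-resp : ∀ {c c′} → c ≋ c′ → Good c → Good c′
    Good-resp c≋c′ g = record
      { ⟂⇒β≈0 = λ w κc′⟂ → trans (β-congˡ w (sym ∘ c≋c′))
          (⟂⇒β≈0 g w (⟂-respˡ (lc-congˡ {v = basis} (sym ∘ c≋c′)) κc′⟂))
      ; β≈0⇒⟂ = λ w β≈0 → ⟂-respˡ (lc-congˡ {v = basis} c≋c′) (β≈0⇒⟂ g w (trans (β-congˡ w c≋c′) β≈0))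
      }

    infixl 6 _⊞_
    _⊞_ : Vector Carrier 4 → Vector Carrier 4 → Vector Carrier 4
    (a ⊞ b) i = a i + b i

    infixr 7 _⊡_
    _⊡_ : Carrier → Vector Carrier 4 → Vector Carrier 4
    (k ⊡ a) i = k * a i

    β-⊞ˡ : ∀ a b w → β (a ⊞ b) w ≈ β a w + β b w
    β-⊞ˡ a b w = solve 12 (λ a₀ a₁ a₂ a₃ b₀ b₁ b₂ b₃ w₀ w₁ w₂ w₃ →
        (a₀ :+ b₀) :* w₁ :- (a₁ :+ b₁) :* w₀ :+ (a₂ :+ b₂) :* w₃ :- (a₃ :+ b₃) :* w₂ :=
        (a₀ :* w₁ :- a₁ :* w₀ :+ a₂ :* w₃ :- a₃ :* w₂) :+ (b₀ :* w₁ :- b₁ :* w₀ :+ b₂ :* w₃ :- b₃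
            :* w₂)) refl
      (a 0F) (a 1F) (a 2F) (a 3F) (b 0F) (b 1F) (b 2F) (b 3F) (w 0F) (w 1F) (w 2F) (w 3F)

    β-⊡ˡ : ∀ k a w → β (k ⊡ a) w ≈ k * β a w
    β-⊡ˡ k a w = solve 9 (λ k a₀ a₁ a₂ a₃ w₀ w₁ w₂ w₃ →
        (k :* a₀) :* w₁ :- (k :* a₁) :* w₀ :+ (k :* a₂) :* w₃ :- (k :* a₃) :* w₂ :=
        k :* (a₀ :* w₁ :- a₁ :* w₀ :+ a₂ :* w₃ :- a₃ :* w₂)) refl
      k (a 0F) (a 1F) (a 2F) (a 3F) (w 0F) (w 1F) (w 2F) (w 3F)

    Good-⊡ : ∀ k {c} → Good c → Good (k ⊡ c)
    Good-⊡ k {c} g = by-cases (k ≟ 0#)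
      where
      κ-⊡ : κ (k ⊡ c) ≈ᴹ k *ₗ κ c
      κ-⊡ = lc-* k c basis
      by-cases : Dec (k ≈ 0#) → Good (k ⊡ c)
      by-cases (yes k≈0) = record
        { ⟂⇒β≈0 = λ w _ → trans (β-⊡ˡ k c w) (trans (*-congʳ k≈0) (zeroˡ _))
        ; β≈0⇒⟂ = λ w _ → ⟂-respˡ (≈ᴹ-sym κ-⊡) (⟂-sym (⟂-zeroʳ k≈0))
        }
      by-cases (no k≉0) = record
        { ⟂⇒β≈0 = λ w κkc⟂ → trans (β-⊡ˡ k c w) (trans (*-congˡ (⟂⇒β≈0 g w
            (⟂-sym (unscale (orthogonal (κ w)) k≉0 (⟂-sym (⟂-respˡ κ-⊡ κkc⟂)))))) (zeroʳ k))
        ; β≈0⇒⟂ = λ w β≈0 → ⟂-respˡ (≈ᴹ-sym κ-⊡) (⟂-sym (⟂-* k (⟂-sym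
            (β≈0⇒⟂ g w (*-cancel k≉0 (trans (sym (β-⊡ˡ k c w)) β≈0))))))
        }

    -- Correct w by k₁ c′ and k₂ c to a vector w′ perpendicular to both summands. Then
    -- perpendicularity of c ⊞ c′ to w and vanishing of β (c ⊞ c′) w both amount to k₁ = k₂.
    Good-⊞ : ∀ {c c′} → Good c → Good c′ → ¬ (κ c ⟂ κ c′) → Good (c ⊞ c′)
    Good-⊞ {c} {c′} g g′ ¬c⟂c′ = record { ⟂⇒β≈0 = to ; β≈0⇒⟂ = from }
      where
      ¬c+c′⟂c : ¬ (κ (c ⊞ c′) ⟂ κ c)
      ¬c+c′⟂c p = ¬c⟂c′ (⟂-cancel (⟂-resp (lc-+ c c′ basis) (⟂-sym p)) ⟂-refl)
      module _ (w : Vector Carrier 4) where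
        k₁ k₂ : Carrier
        k₁ = proj₁ (⟂-project ¬c⟂c′ (κ w))
        k₂ = proj₁ (⟂-project (¬c⟂c′ ∘ ⟂-sym) (κ w))
        w′ : Vector Carrier 4
        w′ = w ⊞ k₁ ⊡ c′ ⊞ k₂ ⊡ c
        κw′≈ : κ w′ ≈ᴹ (κ w +ᴹ k₁ *ₗ κ c′) +ᴹ k₂ *ₗ κ c
        κw′≈ = ≈ᴹ-trans (lc-+ (w ⊞ k₁ ⊡ c′) (k₂ ⊡ c) basis) (+ᴹ-cong
          (≈ᴹ-trans (lc-+ w (k₁ ⊡ c′) basis) (+ᴹ-congˡ (lc-* k₁ c′ basis))) (lc-* k₂ c basis))
        c⟂w′ : κ c ⟂ κ w′
        c⟂w′ = ⟂-resp (≈ᴹ-sym κw′≈) (⟂-+ (proj₂ (⟂-project ¬c⟂c′ (κ w))) (⟂-* k₂ ⟂-refl))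
        c′⟂w′ : κ c′ ⟂ κ w′
        c′⟂w′ = ⟂-resp (≈ᴹ-trans
          (linear (k₁ ∷ k₂ ∷ []) (κ w ∷ κ c ∷ κ c′ ∷ []) (λ k₁ k₂ w c c′ →
            (w ⊕ k₂ ⊙ c) ⊕ k₁ ⊙ c′ ⊜ (w ⊕ k₁ ⊙ c′) ⊕ k₂ ⊙ c) ≡.refl) (≈ᴹ-sym κw′≈))
          (⟂-+ (proj₂ (⟂-project (¬c⟂c′ ∘ ⟂-sym) (κ w))) (⟂-* k₁ ⟂-refl))
        c+c′⟂w′ : κ (c ⊞ c′) ⟂ κ w′
        c+c′⟂w′ = ⟂-respˡ (≈ᴹ-sym (lc-+ c c′ basis)) (⟂-sym (⟂-+ (⟂-sym c⟂w′) (⟂-sym c′⟂w′)))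

        w≈ : κ w ≈ᴹ κ w′ +ᴹ ((- k₁) *ₗ κ (c ⊞ c′) +ᴹ (k₁ - k₂) *ₗ κ c)
        w≈ = ≈ᴹ-trans (linear (k₁ ∷ k₂ ∷ []) (κ w ∷ κ c ∷ κ c′ ∷ [])
          (λ k₁ k₂ w c c′ → w ⊜ ((w ⊕ k₁ ⊙ c′) ⊕ k₂ ⊙ c) ⊕ ((:- k₁) ⊙ (c ⊕ c′) ⊕ (k₁ :- k₂) ⊙ c)) ≡.refl)
          (+ᴹ-cong (≈ᴹ-sym κw′≈) (+ᴹ-congʳ (*ₗ-cong refl (≈ᴹ-sym (lc-+ c c′ basis)))))

        β≈ : β (c ⊞ c′) w ≈ (k₂ - k₁) * β c c′
        β≈ = begin
          β (c ⊞ c′) w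
            ≈⟨ β-⊞ˡ c c′ w ⟩
          β c w + β c′ w
            ≈⟨ solve 14 (λ k₁ k₂ a₀ a₁ a₂ a₃ b₀ b₁ b₂ b₃ w₀ w₁ w₂ w₃ →
                 (a₀ :* w₁ :- a₁ :* w₀ :+ a₂ :* w₃ :- a₃ :* w₂) :+ (b₀ :* w₁ :- b₁ :* w₀ :+ b₂ :* w₃ :- b₃
                     :* w₂) :=
                 (a₀ :* (w₁ :+ k₁ :* b₁ :+ k₂ :* a₁) :- a₁ :* (w₀ :+ k₁ :* b₀ :+ k₂ :* a₀)
                   :+ a₂ :* (w₃ :+ k₁ :* b₃ :+ k₂ :* a₃) :- a₃ :* (w₂ :+ k₁ :* b₂ :+ k₂ :* a₂)) :+
                 (b₀ :* (w₁ :+ k₁ :* b₁ :+ k₂ :* a₁) :- b₁ :* (w₀ :+ k₁ :* b₀ :+ k₂ :* a₀)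
                   :+ b₂ :* (w₃ :+ k₁ :* b₃ :+ k₂ :* a₃) :- b₃ :* (w₂ :+ k₁ :* b₂ :+ k₂ :* a₂)) :+
                 (k₂ :- k₁) :* (a₀ :* b₁ :- a₁ :* b₀ :+ a₂ :* b₃ :- a₃ :* b₂)) refl
               k₁ k₂ (c 0F) (c 1F) (c 2F) (c 3F) (c′ 0F) (c′ 1F) (c′ 2F) (c′ 3F) (w 0F) (w 1F) (w 2F)
                   (w 3F) ⟩
          β c w′ + β c′ w′ + (k₂ - k₁) * β c c′
            ≈⟨ +-congʳ (trans (+-cong (⟂⇒β≈0 g w′ c⟂w′) (⟂⇒β≈0 g′ w′ c′⟂w′)) (+-identityˡ 0#)) ⟩
          0# + (k₂ - k₁) * β c c′
            ≈⟨ +-identityˡ _ ⟩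
          (k₂ - k₁) * β c c′ ∎
          where open ≈-Reasoning setoid

        to : κ (c ⊞ c′) ⟂ κ w → β (c ⊞ c′) w ≈ 0#
        to p = trans β≈ (trans (*-congʳ k₂-k₁≈0) (zeroˡ _))
          where
          k₁-k₂≈0 : k₁ - k₂ ≈ 0#
          k₁-k₂≈0 = ⟂-coefficient ¬c+c′⟂c (⟂-cancel (⟂-cancel (⟂-resp w≈ p) c+c′⟂w′) (⟂-* (- k₁) ⟂-refl))
          k₂-k₁≈0 : k₂ - k₁ ≈ 0#
          k₂-k₁≈0 = trans (solve 2 (λ k₁ k₂ → k₂ :- k₁ := con -[1+ 0 ] :* (k₁ :- k₂)) refl k₁ k₂)
            (trans (*-congˡ k₁-k₂≈0) (zeroʳ _))

        from : β (c ⊞ c′) w ≈ 0# → κ (c ⊞ c′) ⟂ κ w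
        from β≈0 = ⟂-resp (≈ᴹ-sym w≈) (⟂-+ c+c′⟂w′ (⟂-+ (⟂-* (- k₁) ⟂-refl) (⟂-zeroʳ k₁-k₂≈0)))
          where
          k₁-k₂≈0 : k₁ - k₂ ≈ 0#
          k₁-k₂≈0 = trans (solve 2 (λ k₁ k₂ → k₁ :- k₂ := con -[1+ 0 ] :* (k₂ :- k₁)) refl k₁ k₂)
            (trans (*-congˡ (*-cancel (¬c⟂c′ ∘ β≈0⇒⟂ g c′) (trans (*-comm _ _) (trans (sym β≈) β≈0))))
                (zeroʳ _))

    Good-line : ∀ {c c′} a b → Good c → Good c′ → ¬ (κ c ⟂ κ c′) → Good (a ⊡ c ⊞ b ⊡ c′)
    Good-line {c} {c′} a b g g′ ¬c⟂c′ = by-cases (a ≟ 0#) (b ≟ 0#)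
      where
      by-cases : Dec (a ≈ 0#) → Dec (b ≈ 0#) → Good (a ⊡ c ⊞ b ⊡ c′)
      by-cases (yes a≈0) _ = Good-resp
        (λ i → sym (trans (+-congʳ (trans (*-congʳ a≈0) (zeroˡ _))) (+-identityˡ _))) (Good-⊡ b g′)
      by-cases _ (yes b≈0) = Good-resp
        (λ i → sym (trans (+-congˡ (trans (*-congʳ b≈0) (zeroˡ _))) (+-identityʳ _))) (Good-⊡ a g)
      by-cases (no a≉0) (no b≉0) = Good-⊞ (Good-⊡ a g) (Good-⊡ b g′) λ ac⟂bc′ →
        ¬c⟂c′ (⟂-sym (unscale (orthogonal (κ c′)) a≉0 (⟂-sym (unscale (orthogonal (a *ₗ κ c)) b≉0
          (⟂-respˡ (lc-* a c basis) (⟂-resp (lc-* b c′ basis) ac⟂bc′))))))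

    -- Here s plays the role of a vector dual to x: what remains of w after splitting off β c w
    -- times s is perpendicular to x, so β c w is the only obstruction.
    Good-by : ∀ {c x s} → κ c ≈ᴹ x → ¬ (x ⟂ s) →
              (∀ w → ∃[ r ] x ⟂ r × κ w ≈ᴹ r +ᴹ β c w *ₗ s) → Good c
    Good-by κc≈x ¬x⟂s split = record
      { ⟂⇒β≈0 = λ w p → let r , x⟂r , w≈ = split w in
          ⟂-coefficient ¬x⟂s (⟂-cancel (⟂-resp w≈ (⟂-respˡ κc≈x p)) x⟂r)
      ; β≈0⇒⟂ = λ w β≈0 → let r , x⟂r , w≈ = split w in
          ⟂-respˡ (≈ᴹ-sym κc≈x) (⟂-resp (≈ᴹ-sym w≈) (⟂-+ x⟂r (⟂-zeroʳ β≈0)))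
      }

    e₁-good : Good (1# ∷ 0# ∷ 0# ∷ 0# ∷ [])
    e₁-good = Good-by
      (linear [] (e₁ ∷ f₁ ∷ e₂ ∷ f₂ ∷ []) (λ e₁ f₁ e₂ f₂ →
        con (+ 1) ⊙ e₁ ⊕ (con (+ 0) ⊙ f₁ ⊕ (con (+ 0) ⊙ e₂ ⊕ (con (+ 0) ⊙ f₂ ⊕ 𝟎))) ⊜ e₁) ≡.refl)
      ¬e₁⟂f₁
      λ w → w 0F *ₗ e₁ +ᴹ (w 2F *ₗ e₂ +ᴹ w 3F *ₗ f₂) ,
        ⟂-+ (⟂-* (w 0F) ⟂-refl) (⟂-+ (⟂-* (w 2F) e₁⟂e₂) (⟂-* (w 3F) e₁⟂f₂)) ,
        linear (w 0F ∷ w 1F ∷ w 2F ∷ w 3F ∷ []) (e₁ ∷ f₁ ∷ e₂ ∷ f₂ ∷ []) (λ w₀ w₁ w₂ w₃ e₁ f₁ e₂ f₂ →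
          w₀ ⊙ e₁ ⊕ (w₁ ⊙ f₁ ⊕ (w₂ ⊙ e₂ ⊕ (w₃ ⊙ f₂ ⊕ 𝟎))) ⊜
          (w₀ ⊙ e₁ ⊕ (w₂ ⊙ e₂ ⊕ w₃ ⊙ f₂)) ⊕
          (con (+ 1) :* w₁ :- con (+ 0) :* w₀ :+ con (+ 0) :* w₃ :- con (+ 0) :* w₂) ⊙ f₁) ≡.refl

    f₁-good : Good (0# ∷ 1# ∷ 0# ∷ 0# ∷ [])
    f₁-good = Good-by
      (linear [] (e₁ ∷ f₁ ∷ e₂ ∷ f₂ ∷ []) (λ e₁ f₁ e₂ f₂ →
        con (+ 0) ⊙ e₁ ⊕ (con (+ 1) ⊙ f₁ ⊕ (con (+ 0) ⊙ e₂ ⊕ (con (+ 0) ⊙ f₂ ⊕ 𝟎))) ⊜ f₁) ≡.refl)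
      (λ f₁⟂-e₁ → ¬e₁⟂f₁ (⟂-sym (⟂-resp (linear [] (e₁ ∷ []) (λ e → ⊝ (⊝ e) ⊜ e) ≡.refl)
        (-‿closed (orthogonal f₁) f₁⟂-e₁))))
      λ w → w 1F *ₗ f₁ +ᴹ (w 2F *ₗ e₂ +ᴹ w 3F *ₗ f₂) ,
        ⟂-+ (⟂-* (w 1F) ⟂-refl) (⟂-+ (⟂-* (w 2F) f₁⟂e₂) (⟂-* (w 3F) f₁⟂f₂)) ,
        linear (w 0F ∷ w 1F ∷ w 2F ∷ w 3F ∷ []) (e₁ ∷ f₁ ∷ e₂ ∷ f₂ ∷ []) (λ w₀ w₁ w₂ w₃ e₁ f₁ e₂ f₂ →
          w₀ ⊙ e₁ ⊕ (w₁ ⊙ f₁ ⊕ (w₂ ⊙ e₂ ⊕ (w₃ ⊙ f₂ ⊕ 𝟎))) ⊜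
          (w₁ ⊙ f₁ ⊕ (w₂ ⊙ e₂ ⊕ w₃ ⊙ f₂)) ⊕
          (con (+ 0) :* w₁ :- con (+ 1) :* w₀ :+ con (+ 0) :* w₃ :- con (+ 0) :* w₂) ⊙ ⊝ e₁) ≡.refl

    e₂-good : Good (0# ∷ 0# ∷ 1# ∷ 0# ∷ [])
    e₂-good = Good-by
      (linear [] (e₁ ∷ f₁ ∷ e₂ ∷ f₂ ∷ []) (λ e₁ f₁ e₂ f₂ →
        con (+ 0) ⊙ e₁ ⊕ (con (+ 0) ⊙ f₁ ⊕ (con (+ 1) ⊙ e₂ ⊕ (con (+ 0) ⊙ f₂ ⊕ 𝟎))) ⊜ e₂) ≡.refl)
      ¬e₂⟂f₂
      λ w → w 0F *ₗ e₁ +ᴹ (w 1F *ₗ f₁ +ᴹ w 2F *ₗ e₂) ,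
        ⟂-+ (⟂-* (w 0F) (⟂-sym e₁⟂e₂)) (⟂-+ (⟂-* (w 1F) (⟂-sym f₁⟂e₂)) (⟂-* (w 2F) ⟂-refl)) ,
        linear (w 0F ∷ w 1F ∷ w 2F ∷ w 3F ∷ []) (e₁ ∷ f₁ ∷ e₂ ∷ f₂ ∷ []) (λ w₀ w₁ w₂ w₃ e₁ f₁ e₂ f₂ →
          w₀ ⊙ e₁ ⊕ (w₁ ⊙ f₁ ⊕ (w₂ ⊙ e₂ ⊕ (w₃ ⊙ f₂ ⊕ 𝟎))) ⊜
          (w₀ ⊙ e₁ ⊕ (w₁ ⊙ f₁ ⊕ w₂ ⊙ e₂)) ⊕
          (con (+ 0) :* w₁ :- con (+ 0) :* w₀ :+ con (+ 1) :* w₃ :- con (+ 0) :* w₂) ⊙ f₂) ≡.refl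

    f₂-good : Good (0# ∷ 0# ∷ 0# ∷ 1# ∷ [])
    f₂-good = Good-by
      (linear [] (e₁ ∷ f₁ ∷ e₂ ∷ f₂ ∷ []) (λ e₁ f₁ e₂ f₂ →
        con (+ 0) ⊙ e₁ ⊕ (con (+ 0) ⊙ f₁ ⊕ (con (+ 0) ⊙ e₂ ⊕ (con (+ 1) ⊙ f₂ ⊕ 𝟎))) ⊜ f₂) ≡.refl)
      (λ f₂⟂-e₂ → ¬e₂⟂f₂ (⟂-sym (⟂-resp (linear [] (e₂ ∷ []) (λ e → ⊝ (⊝ e) ⊜ e) ≡.refl)
        (-‿closed (orthogonal f₂) f₂⟂-e₂))))
      λ w → w 0F *ₗ e₁ +ᴹ (w 1F *ₗ f₁ +ᴹ w 3F *ₗ f₂) ,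
        ⟂-+ (⟂-* (w 0F) (⟂-sym e₁⟂f₂)) (⟂-+ (⟂-* (w 1F) (⟂-sym f₁⟂f₂)) (⟂-* (w 3F) ⟂-refl)) ,
        linear (w 0F ∷ w 1F ∷ w 2F ∷ w 3F ∷ []) (e₁ ∷ f₁ ∷ e₂ ∷ f₂ ∷ []) (λ w₀ w₁ w₂ w₃ e₁ f₁ e₂ f₂ →
          w₀ ⊙ e₁ ⊕ (w₁ ⊙ f₁ ⊕ (w₂ ⊙ e₂ ⊕ (w₃ ⊙ f₂ ⊕ 𝟎))) ⊜
          (w₀ ⊙ e₁ ⊕ (w₁ ⊙ f₁ ⊕ w₃ ⊙ f₂)) ⊕
          (con (+ 0) :* w₁ :- con (+ 0) :* w₀ :+ con (+ 0) :* w₃ :- con (+ 1) :* w₂) ⊙ ⊝ e₂) ≡.refl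

    -- Trading f₁ for f₁ - f₂ makes w₁ + w₃ the coefficient of f₂, which is the value of the form.
    -- This is where the normalisation `e₁+e₂⟂f₁-f₂` enters.
    e₁+e₂-good : Good (1# ∷ 0# ∷ 1# ∷ 0# ∷ [])
    e₁+e₂-good = Good-by
      (linear [] (e₁ ∷ f₁ ∷ e₂ ∷ f₂ ∷ []) (λ e₁ f₁ e₂ f₂ →
        con (+ 1) ⊙ e₁ ⊕ (con (+ 0) ⊙ f₁ ⊕ (con (+ 1) ⊙ e₂ ⊕ (con (+ 0) ⊙ f₂ ⊕ 𝟎))) ⊜ e₁ ⊕ e₂) ≡.refl)
      (λ e₁+e₂⟂f₂ → ¬e₂⟂f₂ (⟂-sym (⟂-cancel (⟂-sym e₁+e₂⟂f₂) (⟂-sym e₁⟂f₂))))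
      λ w → w 0F *ₗ e₁ +ᴹ (w 2F *ₗ e₂ +ᴹ w 1F *ₗ (f₁ +ᴹ -ᴹ f₂)) ,
        ⟂-+ (⟂-* (w 0F) (⟂-sym (⟂-+ ⟂-refl e₁⟂e₂)))
          (⟂-+ (⟂-* (w 2F) (⟂-sym (⟂-+ (⟂-sym e₁⟂e₂) ⟂-refl))) (⟂-* (w 1F) e₁+e₂⟂f₁-f₂)) ,
        linear (w 0F ∷ w 1F ∷ w 2F ∷ w 3F ∷ []) (e₁ ∷ f₁ ∷ e₂ ∷ f₂ ∷ []) (λ w₀ w₁ w₂ w₃ e₁ f₁ e₂ f₂ →
          w₀ ⊙ e₁ ⊕ (w₁ ⊙ f₁ ⊕ (w₂ ⊙ e₂ ⊕ (w₃ ⊙ f₂ ⊕ 𝟎))) ⊜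
          (w₀ ⊙ e₁ ⊕ (w₂ ⊙ e₂ ⊕ w₁ ⊙ (f₁ ⊕ ⊝ f₂))) ⊕
          (con (+ 1) :* w₁ :- con (+ 0) :* w₀ :+ con (+ 1) :* w₃ :- con (+ 0) :* w₂) ⊙ f₂) ≡.refl

    private
      1≉0# : ¬ (1# ≈ 0#)
      1≉0# = 1≉0 1<q

      ¬⟂-by-β : ∀ {c k} w → Good c → β c w ≈ k → ¬ (k ≈ 0#) → ¬ (κ c ⟂ κ w)
      ¬⟂-by-β w g β≈k k≉0 c⟂w = k≉0 (trans (sym β≈k) (⟂⇒β≈0 g w c⟂w))

    plane₁-good : ∀ a b → Good (a ∷ b ∷ 0# ∷ 0# ∷ [])
    plane₁-good a b = Good-resp
      (λ { 0F → solve 2 (λ a b → a :* con (+ 1) :+ b :* con (+ 0) := a) refl a b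
         ; 1F → solve 2 (λ a b → a :* con (+ 0) :+ b :* con (+ 1) := b) refl a b
         ; 2F → solve 2 (λ a b → a :* con (+ 0) :+ b :* con (+ 0) := con (+ 0)) refl a b
         ; 3F → solve 2 (λ a b → a :* con (+ 0) :+ b :* con (+ 0) := con (+ 0)) refl a b })
      (Good-line a b e₁-good f₁-good (¬⟂-by-β (0# ∷ 1# ∷ 0# ∷ 0# ∷ []) e₁-good (solve 0
        (con (+ 1) :* con (+ 1) :- con (+ 0) :* con (+ 0) :+ con (+ 0) :* con (+ 0) :- con (+ 0)
            :* con (+ 0) := con (+ 1)) refl) 1≉0#))

    plane₂-good : ∀ a b → Good (0# ∷ 0# ∷ a ∷ b ∷ [])
    plane₂-good a b = Good-resp
      (λ { 0F → solve 2 (λ a b → a :* con (+ 0) :+ b :* con (+ 0) := con (+ 0)) refl a b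
         ; 1F → solve 2 (λ a b → a :* con (+ 0) :+ b :* con (+ 0) := con (+ 0)) refl a b
         ; 2F → solve 2 (λ a b → a :* con (+ 1) :+ b :* con (+ 0) := a) refl a b
         ; 3F → solve 2 (λ a b → a :* con (+ 0) :+ b :* con (+ 1) := b) refl a b })
      (Good-line a b e₂-good f₂-good (¬⟂-by-β (0# ∷ 0# ∷ 0# ∷ 1# ∷ []) e₂-good (solve 0
        (con (+ 0) :* con (+ 0) :- con (+ 0) :* con (+ 0) :+ con (+ 1) :* con (+ 1) :- con (+ 0)
            :* con (+ 0) := con (+ 1)) refl) 1≉0#))

    1b10-good : ∀ b → Good (1# ∷ b ∷ 1# ∷ 0# ∷ [])
    1b10-good b = Good-resp
      (λ { 0F → solve 1 (λ b → con (+ 1) :* con (+ 1) :+ b :* con (+ 0) := con (+ 1)) refl b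
         ; 1F → solve 1 (λ b → con (+ 1) :* con (+ 0) :+ b :* con (+ 1) := b) refl b
         ; 2F → solve 1 (λ b → con (+ 1) :* con (+ 1) :+ b :* con (+ 0) := con (+ 1)) refl b
         ; 3F → solve 1 (λ b → con (+ 1) :* con (+ 0) :+ b :* con (+ 0) := con (+ 0)) refl b })
      (Good-line 1# b e₁+e₂-good f₁-good (¬⟂-by-β (0# ∷ 1# ∷ 0# ∷ 0# ∷ []) e₁+e₂-good (solve 0
        (con (+ 1) :* con (+ 1) :- con (+ 0) :* con (+ 0) :+ con (+ 1) :* con (+ 0) :- con (+ 0)
            :* con (+ 0) := con (+ 1)) refl) 1≉0#))

    1b1c-good : ∀ b c → Good (1# ∷ b ∷ 1# ∷ c ∷ [])
    1b1c-good b c = Good-resp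
      (λ { 0F → solve 2 (λ b c → con (+ 1) :* con (+ 1) :+ c :* con (+ 0) := con (+ 1)) refl b c
         ; 1F → solve 2 (λ b c → con (+ 1) :* b :+ c :* con (+ 0) := b) refl b c
         ; 2F → solve 2 (λ b c → con (+ 1) :* con (+ 1) :+ c :* con (+ 0) := con (+ 1)) refl b c
         ; 3F → solve 2 (λ b c → con (+ 1) :* con (+ 0) :+ c :* con (+ 1) := c) refl b c })
      (Good-line 1# c (1b10-good b) f₂-good (¬⟂-by-β (0# ∷ 0# ∷ 0# ∷ 1# ∷ []) (1b10-good b) (solve 1 (λ b →
        con (+ 1) :* con (+ 0) :- b :* con (+ 0) :+ con (+ 1) :* con (+ 1) :- con (+ 0) :* con (+ 0)
            := con (+ 1)) refl b) 1≉0#))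

    -- The parameter c is free: the summands (1,b,1,c) and (0,0,p-1,r-c) have β = r - c p, and
    -- `1bpr-good` makes this nonzero by c = 0 or c = 1 unless p = r = 0.
    1bpr-good-by : ∀ b p r c → ¬ (r - c * p ≈ 0#) → Good (1# ∷ b ∷ p ∷ r ∷ [])
    1bpr-good-by b p r c r≉cp = Good-resp
      (λ { 0F → +-identityʳ 1#
         ; 1F → +-identityʳ b
         ; 2F → solve 1 (λ p → con (+ 1) :+ (p :- con (+ 1)) := p) refl p
         ; 3F → solve 2 (λ r c → c :+ (r :- c) := r) refl r c })
      (Good-⊞ (1b1c-good b c) (plane₂-good (p - 1#) (r - c)) (¬⟂-by-β (0# ∷ 0# ∷ p - 1# ∷ r - c ∷ [])
          (1b1c-good b c) (solve 4 (λ b p r c →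
        con (+ 1) :* con (+ 0) :- b :* con (+ 0) :+ con (+ 1) :* (r :- c) :- c :* (p :- con (+ 1))
            := r :- c :* p) refl b p r c) r≉cp))

    1bpr-good : ∀ b p r → Good (1# ∷ b ∷ p ∷ r ∷ [])
    1bpr-good b p r = by-cases (r ≟ 0#) (p ≟ 0#)
      where
      by-cases : Dec (r ≈ 0#) → Dec (p ≈ 0#) → Good (1# ∷ b ∷ p ∷ r ∷ [])
      by-cases (no r≉0) _ = 1bpr-good-by b p r 0#
        (r≉0 ∘ trans (solve 2 (λ r p → r := r :- con (+ 0) :* p) refl r p))
      by-cases (yes r≈0) (no p≉0) = 1bpr-good-by b p r 1# λ r-p≈0 → p≉0 (begin
        p                  ≈⟨ solve 2 (λ p r → p := r :- (r :- con (+ 1) :* p)) refl p r ⟩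
        r - (r - 1# * p)   ≈⟨ +-cong r≈0 (-‿cong r-p≈0) ⟩
        0# - 0#            ≈⟨ -‿inverseʳ 0# ⟩
        0#                 ∎)
        where open ≈-Reasoning setoid
      by-cases (yes r≈0) (yes p≈0) = Good-resp
        (λ { 0F → refl ; 1F → refl ; 2F → sym p≈0 ; 3F → sym r≈0 }) (plane₁-good 1# b)

    all-good : ∀ c → Good c
    all-good c = by-cases (c 0F ≟ 0#) (c 1F ≟ 0#)
      where
      by-cases : Dec (c 0F ≈ 0#) → Dec (c 1F ≈ 0#) → Good c
      by-cases (no c₀≉0) _ = Good-resp
        (λ { 0F → *-identityʳ (c 0F)
           ; 1F → unscaled (c 1F)
           ; 2F → unscaled (c 2F)
           ; 3F → unscaled (c 3F) })
        (Good-⊡ (c 0F) (1bpr-good (c₀⁻¹ * c 1F) (c₀⁻¹ * c 2F) (c₀⁻¹ * c 3F)))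
        where
        c₀⁻¹ = c 0F ⁻¹⟨ c₀≉0 ⟩
        unscaled : ∀ x → c 0F * (c₀⁻¹ * x) ≈ x
        unscaled x = trans (sym (*-assoc _ _ _)) (trans (*-congʳ (inverseʳ⟨ c₀≉0 ⟩)) (*-identityˡ x))
      by-cases (yes c₀≈0) (yes c₁≈0) = Good-resp
        (λ { 0F → sym c₀≈0 ; 1F → sym c₁≈0 ; 2F → refl ; 3F → refl }) (plane₂-good (c 2F) (c 3F))
      -- Split as (1,0,c₂,c₃) + (-1,c₁,0,0); the summands have β = c₁.
      by-cases (yes c₀≈0) (no c₁≉0) = Good-resp
        (λ { 0F → trans (-‿inverseʳ 1#) (sym c₀≈0)
           ; 1F → +-identityˡ (c 1F)
           ; 2F → +-identityʳ (c 2F)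
           ; 3F → +-identityʳ (c 3F) })
        (Good-⊞ (1bpr-good 0# (c 2F) (c 3F)) (plane₁-good (- 1#) (c 1F))
          (¬⟂-by-β (- 1# ∷ c 1F ∷ 0# ∷ 0# ∷ []) (1bpr-good 0# (c 2F) (c 3F)) (solve 3 (λ b p r →
            con (+ 1) :* b :- con (+ 0) :* con -[1+ 0 ] :+ p :* con (+ 0) :- r :* con (+ 0) := b) refl
                (c 1F) (c 2F) (c 3F)) c₁≉0))

    ⟂⇒form≈0 : ∀ c w → κ c ⟂ κ w → symplecticForm c w ≈ 0#
    ⟂⇒form≈0 c = ⟂⇒β≈0 (all-good c)

    form≈0⇒⟂ : ∀ c w → symplecticForm c w ≈ 0# → κ c ⟂ κ w
    form≈0⇒⟂ c = β≈0⇒⟂ (all-good c)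

-- Totally isotropic planes and the spreads of W(q) they induce.

module TotallyIsotropicPlanes {q : ℕ} (F : Field) (order : HasOrder F q) (1<q : 1 < q)
  (M : Geometry.VectorSpace F) (dim : Geometry.HasDimension F M 6)
  (orthogonality : Orthogonality F M) where

  open CommutativeRing (commutativeRingOf F) hiding (zero)
  open Geometry F
  open LeftModule M
  open FiniteField F order
  open LinearAlgebra F order 1<q M (decidable-equality F order M dim)
  open HyperbolicPairs F order 1<q M (decidable-equality F order M dim) orthogonality
  open Orthogonality orthogonality
  open IntegerCoefficientSolver (commutativeRingOf F)
    using (_:*_; _:+_; con; :-_; _:-_; solve; _:=_)
  open KSubspace using (subspace)

  Pair : (x y : Carrierᴹ) → Set
  Pair x y = Independent (x ∷ y ∷ [])

  -- What survives of the blocks inside H once V and D are forgotten. In `unique` an inclusion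
  -- suffices because it can be invoked for either plane.
  record PlaneSystem : Set₁ where
    field
      plane  : ∀ {x y} → Pair x y → x ⟂ y → KSubspace M 3
      ∋ˡ     : ∀ {x y} (xy : Pair x y) (x⟂y : x ⟂ y) → x ∈ subspace (plane xy x⟂y)
      ∋ʳ     : ∀ {x y} (xy : Pair x y) (x⟂y : x ⟂ y) → y ∈ subspace (plane xy x⟂y)
      isotropic : ∀ {x y} (xy : Pair x y) (x⟂y : x ⟂ y) {u v} →
               u ∈ subspace (plane xy x⟂y) → v ∈ subspace (plane xy x⟂y) → u ⟂ v
      unique : ∀ {x y u v} (xy : Pair x y) (x⟂y : x ⟂ y) (uv : Pair u v) (u⟂v : u ⟂ v) →
               u ∈ subspace (plane xy x⟂y) → v ∈ subspace (plane xy x⟂y) → plane xy x⟂y ≤ plane uv u⟂v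

  record SymplecticBasis : Set where
    field
      {e f e₁ f₁ e₂ f₂} : Carrierᴹ
      ¬e⟂f : ¬ (e ⟂ f)
      ¬e₁⟂f₁ : ¬ (e₁ ⟂ f₁)
      ¬e₂⟂f₂ : ¬ (e₂ ⟂ f₂)
      e⟂ : ∀ i → e ⟂ (e₁ ∷ f₁ ∷ e₂ ∷ f₂ ∷ []) i
      f⟂ : ∀ i → f ⟂ (e₁ ∷ f₁ ∷ e₂ ∷ f₂ ∷ []) i
      e₁⟂e₂ : e₁ ⟂ e₂
      e₁⟂f₂ : e₁ ⟂ f₂
      f₁⟂e₂ : f₁ ⟂ e₂
      f₁⟂f₂ : f₁ ⟂ f₂
      e₁+e₂⟂f₁-f₂ : (e₁ +ᴹ e₂) ⟂ (f₁ +ᴹ -ᴹ f₂)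
      spanning : ∀ h → h ∈ span (e ∷ f ∷ e₁ ∷ f₁ ∷ e₂ ∷ f₂ ∷ [])

  symplectic-basis : NonDegenerate (wholeSpace M) → SymplecticBasis
  symplectic-basis nd =
    let frame₀ = trivial-frame nd
        e , f , e∈ , f∈ , ¬e⟂f = new-pair frame₀ dim z<s
        frame₁ = extend-frame frame₀ e∈ f∈ ¬e⟂f
        e₁ , f₁ , e₁∈ , f₁∈ , ¬e₁⟂f₁ = new-pair frame₁ dim (s<s (s<s z<s))
        frame₂ = extend-frame frame₁ e₁∈ f₁∈ ¬e₁⟂f₁
        e₂ , f₂ , e₂∈ , f₂∈ , ¬e₂⟂f₂ = new-pair frame₂ dim (s<s (s<s (s<s (s<s z<s))))
        frame₃ = extend-frame frame₂ e₂∈ f₂∈ ¬e₂⟂f₂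
    in rescaled e₁∈ f₁∈ ¬e⟂f ¬e₁⟂f₁ ¬e₂⟂f₂ e₂∈ f₂∈ (full-frame-spans frame₃ dim)
    where
    rescaled : ∀ {e f e₁ f₁ e₂ f₂} → let Z₁ = complement e f (wholeSpace M) ; Z₂ = complement e₁ f₁ Z₁ in
               e₁ ∈ Z₁ → f₁ ∈ Z₁ → ¬ (e ⟂ f) → ¬ (e₁ ⟂ f₁) → ¬ (e₂ ⟂ f₂) → e₂ ∈ Z₂ → f₂ ∈ Z₂ →
               (∀ h → h ∈ span (e₂ ∷ f₂ ∷ e₁ ∷ f₁ ∷ e ∷ f ∷ [])) → SymplecticBasis
    rescaled {e} {f} {e₁} {f₁} {e₂} {f₂} (_ , e⟂e₁ , f⟂e₁) (_ , e⟂f₁ , f⟂f₁) ¬e⟂f ¬e₁⟂f₁ ¬e₂⟂f₂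
             ((_ , e⟂e₂ , f⟂e₂) , e₁⟂e₂ , f₁⟂e₂) ((_ , e⟂f₂ , f⟂f₂) , e₁⟂f₂ , f₁⟂f₂) spans = record
      { e = e ; f = f ; e₁ = e₁ ; f₁ = f₁ ; e₂ = e₂ ; f₂ = f₂′
      ; ¬e⟂f   = ¬e⟂f
      ; ¬e₁⟂f₁ = ¬e₁⟂f₁
      ; ¬e₂⟂f₂ = ¬e₂⟂f₂ ∘ unscale (orthogonal e₂) -k≉0
      ; e⟂ = λ { 0F → e⟂e₁ ; 1F → e⟂f₁ ; 2F → e⟂e₂ ; 3F → ⟂-* (- k) e⟂f₂ }
      ; f⟂ = λ { 0F → f⟂e₁ ; 1F → f⟂f₁ ; 2F → f⟂e₂ ; 3F → ⟂-* (- k) f⟂f₂ }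
      ; e₁⟂e₂ = e₁⟂e₂
      ; e₁⟂f₂ = ⟂-* (- k) e₁⟂f₂
      ; f₁⟂e₂ = f₁⟂e₂
      ; f₁⟂f₂ = ⟂-* (- k) f₁⟂f₂
      ; e₁+e₂⟂f₁-f₂ = ⟂-resp (linear (k ∷ []) (f₁ ∷ f₂ ∷ []) (λ k f₁ f₂ →
          f₁ ⊕ k ⊙ f₂ ⊜ f₁ ⊕ ⊝ ((:- k) ⊙ f₂)) ≡.refl) (proj₂ projected)
      ; spanning = λ h → span-least (span basis) (e₂ ∷ f₂ ∷ e₁ ∷ f₁ ∷ e ∷ f ∷ []) (λ where
          0F → ∈span basis 4F
          1F → unscale (span basis) -k≉0 (∈span basis 5F)
          2F → ∈span basis 2F
          3F → ∈span basis 3F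
          4F → ∈span basis 0F
          5F → ∈span basis 1F) (spans h)
      }
      where
      ¬e₁+e₂⟂f₂ : ¬ ((e₁ +ᴹ e₂) ⟂ f₂)
      ¬e₁+e₂⟂f₂ p = ¬e₂⟂f₂ (⟂-sym (⟂-cancel (⟂-sym p) (⟂-sym e₁⟂f₂)))
      -- The relation determines f₂ only up to a scalar. Projecting f₁ along f₂ finds the scalar -k
      -- that makes f₁ - f₂′ perpendicular to e₁ + e₂; it is nonzero, since otherwise f₁ would be
      -- perpendicular to e₁ + e₂ and therefore to e₁.
      projected : ∃[ k ] (e₁ +ᴹ e₂) ⟂ (f₁ +ᴹ k *ₗ f₂)
      projected = ⟂-project ¬e₁+e₂⟂f₂ f₁
      k : Carrier
      k = proj₁ projected
      -k≉0 : ¬ (- k ≈ 0#)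
      -k≉0 -k≈0 = ¬e₁⟂f₁ (⟂-sym (⟂-cancel (⟂-resp (+ᴹ-comm e₁ e₂) (⟂-sym e₁+e₂⟂f₁)) f₁⟂e₂))
        where
        k≈0 : k ≈ 0#
        k≈0 = trans (solve 1 (λ k → k := :- (:- k)) refl k)
            (trans (-‿cong -k≈0) (solve 0 (:- con (+ 0) := con (+ 0)) refl))
        e₁+e₂⟂f₁ : (e₁ +ᴹ e₂) ⟂ f₁
        e₁+e₂⟂f₁ = ⟂-resp (drop-zeroʳ f₁ f₂ k≈0) (proj₂ projected)
      f₂′ : Carrierᴹ
      f₂′ = (- k) *ₗ f₂
      basis : Vector Carrierᴹ 6
      basis = e ∷ f ∷ e₁ ∷ f₁ ∷ e₂ ∷ f₂′ ∷ []

  module SpreadFamily (planes : PlaneSystem) (symplectic : SymplecticBasis) where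

    open PlaneSystem planes
    open SymplecticBasis symplectic
    open SymplecticCoordinates.StandardForm F order 1<q M (decidable-equality F order M dim) orthogonality
      ¬e₁⟂f₁ ¬e₂⟂f₂ e₁⟂e₂ e₁⟂f₂ f₁⟂e₂ f₁⟂f₂ e₁+e₂⟂f₁-f₂ using (κ; basis; ⟂⇒form≈0; form≈0⇒⟂)
    private
      module S = SymplecticSpace F order 1<q
      module A = LinearAlgebra F order 1<q (coordinateSpace 4) (CoordinateSpaces.pointwise-≟ F order)
      open S using (_⊥_; orthogonally; β≈0; m₀; m₁; m₀∈; m₁∈; m-pair; m₀⊥m₁; line⊆; ⊆line)
      open A using () renaming (_∈_ to infix 4 _∈⁴_)

      0⁴ : Vector Carrier 4
      0⁴ _ = 0#

    ⟂κ : ∀ {x} → (∀ i → x ⟂ basis i) → ∀ c → x ⟂ κ c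
    ⟂κ {x} x⟂ c = lc-closed (orthogonal x) basis x⟂ c

    κ⊥ : ∀ {c w} → κ c ⟂ κ w → c ⊥ w
    κ⊥ {c} {w} p = orthogonally (⟂⇒form≈0 c w p)

    κ⟂ : ∀ {c w} → c ⊥ w → κ c ⟂ κ w
    κ⟂ {c} {w} p = form≈0⇒⟂ c w (β≈0 p)

    -- A vector mapped to 0 is perpendicular to every κ w, hence β-orthogonal to all of F⁴.
    κ-injective : ∀ c → κ c ≈ᴹ 0ᴹ → c ≋ 0⁴
    κ-injective c κc≈0 = S.orthogonal-to-all λ w → κ⊥ {c} {w} (⟂-respˡ (≈ᴹ-sym κc≈0)
      (⟂-sym (Subspace.0-closed (orthogonal (κ w)))))

    κ-pair : ∀ {c w} → A.Independent (c ∷ w ∷ []) → Pair (κ c) (κ w)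
    κ-pair {c} {w} cw = independent λ a eq → A.only-trivially cw a (κ-injective (A.lc a (c ∷ w ∷ [])) (begin
      κ (A.lc a (c ∷ w ∷ []))                           ≈⟨ lc-+ (λ i → a 0F * c i)
          (λ i → a 1F * w i + 0#) basis ⟩
      κ (λ i → a 0F * c i) +ᴹ κ (λ i → a 1F * w i + 0#) ≈⟨ +ᴹ-cong (lc-* (a 0F) c basis)
          (lc-+ (λ i → a 1F * w i) 0⁴ basis) ⟩
      a 0F *ₗ κ c +ᴹ (κ (λ i → a 1F * w i) +ᴹ κ 0⁴)     ≈⟨ +ᴹ-congˡ (+ᴹ-cong (lc-* (a 1F) w basis)
          (lc-0 basis)) ⟩
      a 0F *ₗ κ c +ᴹ (a 1F *ₗ κ w +ᴹ 0ᴹ)                ≈⟨ eq ⟩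
      0ᴹ                                                ∎))
      where open ≈-Reasoning ≈ᴹ-setoid

    κ-isLinear : IsLinear F {coordinateSpace 4} {M} κ
    κ-isLinear = record
      { cong    = lc-congˡ {v = basis}
      ; linearity = λ a b c w → ≈ᴹ-trans (lc-+ (λ i → a * c i) (λ i → b * w i) basis)
                    (+ᴹ-cong (lc-* a c basis) (lc-* b w basis))
      }

    open IsLinear κ-isLinear using (preimage)

    -- The q + 1 points of the hyperbolic line ⟨e,f⟩, each with a vector not perpendicular to it.
    r r̄ : Fin (suc q) → Carrierᴹ
    r zero    = f
    r (suc i) = e +ᴹ element i *ₗ f
    r̄ zero    = e
    r̄ (suc i) = f

    r⟂κ : ∀ i c → r i ⟂ κ c
    r⟂κ zero    = ⟂κ f⟂
    r⟂κ (suc i) = ⟂κ λ j → ⟂-sym (⟂-+ (⟂-sym (e⟂ j)) (⟂-* (element i) (⟂-sym (f⟂ j))))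

    r̄⟂κ : ∀ i c → r̄ i ⟂ κ c
    r̄⟂κ zero    = ⟂κ e⟂
    r̄⟂κ (suc i) = ⟂κ f⟂

    ¬r̄⟂r : ∀ i → ¬ (r̄ i ⟂ r i)
    ¬r̄⟂r zero    = ¬e⟂f
    ¬r̄⟂r (suc i) f⟂r = ¬e⟂f (⟂-sym (⟂-cancel (⟂-resp (+ᴹ-comm e _) f⟂r) (⟂-* (element i) ⟂-refl)))

    r-injective : ∀ i j → r i ⟂ r j → i ≡ j
    r-injective zero    zero    _ = ≡.refl
    r-injective zero    (suc j) p = contradiction p (¬r̄⟂r (suc j))
    r-injective (suc i) zero    p = contradiction (⟂-sym p) (¬r̄⟂r (suc i))
    r-injective (suc i) (suc j) p = ≡.cong suc (Bijection.injective order (sym (a-b≈0⇒a≈b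
      (⟂-coefficient {k = element j + - 1# * element i} (¬r̄⟂r (suc i) ∘ ⟂-sym) (⟂-cancel (⟂-resp
        (linear (element i ∷ element j ∷ []) (e ∷ f ∷ []) (λ x y e f →
          e ⊕ y ⊙ f ⊜ (e ⊕ x ⊙ f) ⊕ (y :+ con -[1+ 0 ] :* x) ⊙ f) ≡.refl) p) ⟂-refl)))))

    rκ-pair : ∀ i {c} → ¬ (c ≋ 0⁴) → Pair (r i) (κ c)
    rκ-pair i {c} c≉0 = extend (nonzero-independent (λ κc≈0 → c≉0 (κ-injective c κc≈0)))
      λ (a , r≈) → ¬r̄⟂r i (⟂-resp (≈ᴹ-sym (≈ᴹ-trans r≈ (+ᴹ-identityʳ _))) (⟂-* (a 0F) (r̄⟂κ i c)))

    decomposition : ∀ h → ∃₂ λ a b → ∃[ c ] h ≈ᴹ (a *ₗ e +ᴹ b *ₗ f) +ᴹ κ c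
    decomposition h =
      let c , h≈ = spanning h in
      c 0F , c 1F , (λ i → c (suc (suc i))) , ≈ᴹ-trans h≈ (≈ᴹ-sym (+ᴹ-assoc _ _ _))

    -- Split the vector into a multiple of r i and one of the second vector r̄ i. The first is
    -- perpendicular to r i and the second is not, so its coefficient vanishes.
    on-hyperbolic-line : ∀ i a b → r i ⟂ (a *ₗ e +ᴹ b *ₗ f) → ∃[ k ] a *ₗ e +ᴹ b *ₗ f ≈ᴹ k *ₗ r i
    on-hyperbolic-line zero a b p = b , (begin
      a *ₗ e +ᴹ b *ₗ f    ≈⟨ drop-zeroˡ e (b *ₗ f) a≈0 ⟩
      b *ₗ f              ∎)
      where
      open ≈-Reasoning ≈ᴹ-setoid
      a≈0 : a ≈ 0#
      a≈0 = ⟂-coefficient (¬e⟂f ∘ ⟂-sym) (⟂-cancel (⟂-resp (+ᴹ-comm _ _) p) (⟂-* b ⟂-refl))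
    on-hyperbolic-line (suc i) a b p = a , (begin
      a *ₗ e +ᴹ b *ₗ f                          ≈⟨ split ⟩
      a *ₗ r (suc i) +ᴹ (b - a * element i) *ₗ f ≈⟨ drop-zeroʳ (a *ₗ r (suc i)) f k≈0 ⟩
      a *ₗ r (suc i)                            ∎)
      where
      open ≈-Reasoning ≈ᴹ-setoid
      split : a *ₗ e +ᴹ b *ₗ f ≈ᴹ a *ₗ r (suc i) +ᴹ (b - a * element i) *ₗ f
      split = linear (a ∷ b ∷ element i ∷ []) (e ∷ f ∷ []) (λ a b x e f →
        a ⊙ e ⊕ b ⊙ f ⊜ a ⊙ (e ⊕ x ⊙ f) ⊕ (b :- a :* x) ⊙ f) ≡.refl
      k≈0 : b - a * element i ≈ 0#
      k≈0 = ⟂-coefficient (¬r̄⟂r (suc i) ∘ ⟂-sym) (⟂-cancel (⟂-resp split p) (⟂-* a ⟂-refl))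

    find-r : ∀ (X : Subspace M) a b → a *ₗ e +ᴹ b *ₗ f ∈ X → ¬ (a *ₗ e +ᴹ b *ₗ f ≈ᴹ 0ᴹ) → ∃[ i ] r i ∈ X
    find-r X a b s∈X s≉0 = by-cases (a ≟ 0#)
      where
      open ≈-Reasoning ≈ᴹ-setoid
      by-cases : Dec (a ≈ 0#) → ∃[ i ] r i ∈ X
      by-cases (no a≉0) = suc (index (a⁻¹ * b)) , unscale X a≉0 (Subspace.respects X (begin
          a *ₗ e +ᴹ b *ₗ f                 ≈⟨ +ᴹ-congˡ
              (*ₗ-cong (trans (sym (*-identityˡ b)) (*-congʳ (sym (inverseʳ⟨ a≉0 ⟩)))) ≈ᴹ-refl) ⟩
          a *ₗ e +ᴹ (a * a⁻¹ * b) *ₗ f     ≈⟨ linear (a ∷ a⁻¹ ∷ b ∷ []) (e ∷ f ∷ []) (λ a l b e f →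
                                                a ⊙ e ⊕ (a :* l :* b) ⊙ f ⊜ a ⊙ (e ⊕ (l :* b) ⊙ f)) ≡.refl ⟩
          a *ₗ (e +ᴹ (a⁻¹ * b) *ₗ f)       ≈⟨ *ₗ-cong refl
              (+ᴹ-congˡ (*ₗ-cong (sym (element-index (a⁻¹ * b))) ≈ᴹ-refl)) ⟩
          a *ₗ r (suc (index (a⁻¹ * b)))   ∎) s∈X)
        where
        a⁻¹ = a ⁻¹⟨ a≉0 ⟩
      by-cases (yes a≈0) = zero , unscale X b≉0 (Subspace.respects X s≈bf s∈X)
        where
        s≈bf : a *ₗ e +ᴹ b *ₗ f ≈ᴹ b *ₗ f
        s≈bf = drop-zeroˡ e (b *ₗ f) a≈0
        b≉0 : ¬ (b ≈ 0#)
        b≉0 b≈0 = s≉0 (≈ᴹ-trans s≈bf (scale-zero f b≈0))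

    open IncidenceStructure symplecticQuadrangle

    private
      L : Line → ProjectiveLine (coordinateSpace 4)
      L = proj₁

    linePlane : Line → KSubspace M 3
    linePlane l = plane (κ-pair (m-pair l)) (κ⟂ (m₀⊥m₁ l))

    κ∈linePlane : ∀ l {c} → c ∈⁴ subspace (L l) → κ c ∈ subspace (linePlane l)
    κ∈linePlane l {c} c∈ = A.span-least (preimage (subspace (linePlane l))) (m₀ l ∷ m₁ l ∷ [])
      (λ { 0F → ∋ˡ (κ-pair (m-pair l)) (κ⟂ (m₀⊥m₁ l)) ; 1F → ∋ʳ (κ-pair (m-pair l)) (κ⟂ (m₀⊥m₁ l)) }) {c}
          (line⊆ l c∈)

    -- The plane is totally isotropic, so c is orthogonal to the line l, and l is maximal totally
    -- isotropic in F⁴.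
    linePlane∋κ : ∀ l {c} → κ c ∈ subspace (linePlane l) → c ∈⁴ subspace (L l)
    linePlane∋κ l {c} κc∈ = ⊆line l {c}
      (S.isotropic-maximal (m-pair l) (m₀⊥m₁ l)
        (κ⊥ {m₀ l} {c} (isotropic (κ-pair (m-pair l)) (κ⟂ (m₀⊥m₁ l))
            (∋ˡ (κ-pair (m-pair l)) (κ⟂ (m₀⊥m₁ l))) κc∈))
        (κ⊥ {m₁ l} {c} (isotropic (κ-pair (m-pair l)) (κ⟂ (m₀⊥m₁ l))
            (∋ʳ (κ-pair (m-pair l)) (κ⟂ (m₀⊥m₁ l))) κc∈)))

    S : Fin (suc q) → Pred Line 0ℓ
    S i l = r i ∈ subspace (linePlane l)

    linePlane-isotropic : ∀ l {u v} → u ∈ subspace (linePlane l) → v ∈ subspace (linePlane l) → u ⟂ v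
    linePlane-isotropic l = isotropic (κ-pair (m-pair l)) (κ⟂ (m₀⊥m₁ l))

    linePlane-≤ : ∀ l {x y} (xy : Pair x y) (x⟂y : x ⟂ y) →
                  x ∈ subspace (linePlane l) → y ∈ subspace (linePlane l) → linePlane l ≤ plane xy x⟂y
    linePlane-≤ l xy x⟂y = unique (κ-pair (m-pair l)) (κ⟂ (m₀⊥m₁ l)) xy x⟂y

    ≤-linePlane : ∀ l {x y} (xy : Pair x y) (x⟂y : x ⟂ y) →
                  (∀ {c} → c ∈⁴ subspace (L l) → κ c ∈ subspace (plane xy x⟂y)) → plane xy x⟂y ≤ linePlane l
    ≤-linePlane l xy x⟂y L⊆ = unique xy x⟂y (κ-pair (m-pair l)) (κ⟂ (m₀⊥m₁ l))
      (L⊆ (m₀∈ l)) (L⊆ (m₁∈ l))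

    S-respects : ∀ i → S i Respects _≈ₗ_
    S-respects i {l} {l′} (_ , L′⊆L) r∈ = ≤-linePlane l′ (κ-pair (m-pair l)) (κ⟂ (m₀⊥m₁ l))
      (λ {c} c∈ → κ∈linePlane l {c} (L′⊆L c∈)) r∈

    -- Take a third vector t of the plane. Its hyperbolic component s is perpendicular to the image
    -- of F⁴, so its other component c is orthogonal to l and lies in l by maximality. Subtracting κ
    -- c leaves s in the plane, nonzero because t is outside the image of l.
    S-exists : ∀ l → ∃[ i ] S i l
    S-exists l = from-third (member-outside (linePlane l) (ℕ.n<1+n 2) (κ (m₀ l) ∷ κ (m₁ l) ∷ []))
      where
      B = subspace (linePlane l)
      from-third : ∃[ t ] t ∈ B × t ∉ span (κ (m₀ l) ∷ κ (m₁ l) ∷ []) → ∃[ i ] S i l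
      from-third (t , t∈ , t∉) = from-decomposition (decomposition t)
        where
        from-decomposition : (∃₂ λ a b → ∃[ c ] t ≈ᴹ (a *ₗ e +ᴹ b *ₗ f) +ᴹ κ c) → ∃[ i ] S i l
        from-decomposition (a , b , c , t≈) = find-r B a b s∈B s≉0
          where
          s : Carrierᴹ
          s = a *ₗ e +ᴹ b *ₗ f
          κ⟂s : ∀ w → κ w ⟂ s
          κ⟂s w = ⟂-+ (⟂-* a (⟂-sym (⟂κ e⟂ w))) (⟂-* b (⟂-sym (⟂κ f⟂ w)))
          m⊥c : ∀ {w} → w ∈⁴ subspace (L l) → w ⊥ c
          m⊥c {w} w∈ = κ⊥ {w} {c} (⟂-cancel (⟂-resp t≈ (linePlane-isotropic l (κ∈linePlane l {w} w∈) t∈))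
              (κ⟂s w))
          c∈span : c ∈⁴ A.span (m₀ l ∷ m₁ l ∷ [])
          c∈span = S.isotropic-maximal (m-pair l) (m₀⊥m₁ l) (m⊥c (m₀∈ l)) (m⊥c (m₁∈ l))
          κc∈ : ∀ (X : Subspace M) → κ (m₀ l) ∈ X → κ (m₁ l) ∈ X → κ c ∈ X
          κc∈ X κm₀∈ κm₁∈ = A.span-least (preimage X) (m₀ l ∷ m₁ l ∷ []) (λ { 0F → κm₀∈ ; 1F → κm₁∈ })
              {c} c∈span
          s∈B : s ∈ B
          s∈B = Subspace.respects B
            (≈ᴹ-trans (+ᴹ-congʳ t≈) (linear [] (s ∷ κ c ∷ []) (λ s k → (s ⊕ k) ⊕ ⊝ k ⊜ s) ≡.refl))
            (Subspace.+-closed B t∈ (-‿closed B (κc∈ B (κ∈linePlane l {m₀ l} (m₀∈ l))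
                (κ∈linePlane l {m₁ l} (m₁∈ l)))))
          s≉0 : ¬ (s ≈ᴹ 0ᴹ)
          s≉0 s≈0 = t∉ (Subspace.respects X
              (≈ᴹ-sym (≈ᴹ-trans t≈ (≈ᴹ-trans (+ᴹ-congʳ s≈0) (+ᴹ-identityˡ _))))
            (κc∈ X (∈span (κ (m₀ l) ∷ κ (m₁ l) ∷ []) 0F) (∈span (κ (m₀ l) ∷ κ (m₁ l) ∷ []) 1F)))
            where X = span (κ (m₀ l) ∷ κ (m₁ l) ∷ [])

    -- Two points of ⟨e,f⟩ in one totally isotropic plane are perpendicular, which distinct points
    -- of a hyperbolic line never are.
    S-partition : ∀ l → ∃! _≡_ λ i → S i l
    S-partition l =
      let i , rᵢ∈ = S-exists l in
      i , rᵢ∈ , λ {j} rⱼ∈ → r-injective i j (linePlane-isotropic l rᵢ∈ rⱼ∈)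

    module _ (i : Fin (suc q)) where

      -- The planes of l and l′ share the two independent vectors r i and κ v, so they coincide;
      -- their traces on the image of F⁴ are l and l′.
      S-≤ : ∀ l l′ {v} → ¬ (v ≋ 0⁴) → S i l → S i l′ → v ∈⁴ subspace (L l) → v ∈⁴ subspace (L l′) →
          L l ≤ L l′
      S-≤ l l′ {v} v≉0 r∈l r∈l′ v∈l v∈l′ {x} x∈ = linePlane∋κ l′ {x}
        (≤-linePlane l′ (rκ-pair i {v} v≉0) (r⟂κ i v)
          (λ {c} c∈ → linePlane-≤ l′ (rκ-pair i {v} v≉0) (r⟂κ i v) r∈l′ (κ∈linePlane l′ {v} v∈l′)
              (κ∈linePlane l′ {c} c∈))
          (linePlane-≤ l (rκ-pair i {v} v≉0) (r⟂κ i v) r∈l (κ∈linePlane l {v} v∈l) (κ∈linePlane l {x} x∈)))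

      line-through : ∀ {v} → ¬ (v ≋ 0⁴) → Σ[ l ∈ Line ] S i l × v ∈⁴ subspace (L l)
      line-through {v} v≉0 = from-third (member-outside B (ℕ.n<1+n 2) (r i ∷ κ v ∷ []))
        where
        rv = rκ-pair i {v} v≉0
        B = plane rv (r⟂κ i v)
        from-third : ∃[ t ] t ∈ subspace B × t ∉ span (r i ∷ κ v ∷ []) → Σ[ l ∈ Line ] S i l × v ∈⁴
            subspace (L l)
        from-third (t , t∈ , t∉) = from-decomposition (decomposition t)
          where
          from-decomposition : (∃₂ λ a b → ∃[ c ] t ≈ᴹ (a *ₗ e +ᴹ b *ₗ f) +ᴹ κ c) →
              Σ[ l ∈ Line ] S i l × v ∈⁴ subspace (L l)
          -- As t and κ c are perpendicular to r i, so is the hyperbolic component of t, which is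
          -- therefore a multiple of r i. Removing it leaves κ c in the plane, and the line sought
          -- is ⟨v,c⟩.
          from-decomposition (a , b , c , t≈) = from-multiple (on-hyperbolic-line i a b
            (⟂-cancel (⟂-resp (≈ᴹ-trans t≈ (+ᴹ-comm _ _)) (isotropic rv (r⟂κ i v) (∋ˡ rv (r⟂κ i v)) t∈))
                (r⟂κ i c)))
            where
            from-multiple : ∃[ k ] a *ₗ e +ᴹ b *ₗ f ≈ᴹ k *ₗ r i → Σ[ l ∈ Line ] S i l × v ∈⁴ subspace (L l)
            from-multiple (k , s≈) = l , r∈ , A.∈span (v ∷ c ∷ []) 0F
              where
              t≈′ : t ≈ᴹ k *ₗ r i +ᴹ κ c
              t≈′ = ≈ᴹ-trans t≈ (+ᴹ-congʳ s≈)
              κc∈B : κ c ∈ subspace B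
              κc∈B = Subspace.respects (subspace B)
                (≈ᴹ-trans (+ᴹ-congʳ t≈′) (linear (k ∷ []) (r i ∷ κ c ∷ []) (λ k r c →
                    (k ⊙ r ⊕ c) ⊕ (:- k) ⊙ r ⊜ c) ≡.refl))
                (Subspace.+-closed (subspace B) t∈ (Subspace.*ₗ-closed (subspace B) (- k)
                    (∋ˡ rv (r⟂κ i v))))
              v⊥c : v ⊥ c
              v⊥c = κ⊥ {v} {c} (isotropic rv (r⟂κ i v) (∋ʳ rv (r⟂κ i v)) κc∈B)
              c∉ : ¬ (c ∈⁴ A.span (v ∷ []))
              c∉ c∈ = t∉ (Subspace.respects X (≈ᴹ-sym t≈′) (Subspace.+-closed X
                (Subspace.*ₗ-closed X k (∈span (r i ∷ κ v ∷ []) 0F))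
                (A.span-least (preimage X) (v ∷ []) (λ { 0F → ∈span (r i ∷ κ v ∷ []) 1F }) {c} c∈)))
                where X = span (r i ∷ κ v ∷ [])
              vc : A.Independent (v ∷ c ∷ [])
              vc = A.independent-swap {c} {v} (A.extend {v = c ∷ v ∷ []} (A.nonzero-independent {v} v≉0) c∉)
              isotropic-line : TotallyIsotropic (A.spanned (v ∷ c ∷ []) vc)
              isotropic-line {x} {y} x∈ y∈ = β≈0 (S.isotropic-span {v} {c} {x} {y} v⊥c x∈ y∈)
              l : Line
              l = A.spanned (v ∷ c ∷ []) vc , isotropic-line
              r∈ : S i l
              r∈ = unique rv (r⟂κ i v) (κ-pair (m-pair l)) (κ⟂ (m₀⊥m₁ l)) (∋ʳ rv (r⟂κ i v)) κc∈B
                  (∋ˡ rv (r⟂κ i v))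

      S-spread : IsSpread (S i)
      S-spread = (λ {l} {l′} → S-respects i {l} {l′}) , λ (P , _) →
        let v = A.vectors P 0F
            v≉0 = A.independent-nonzero {v = A.vectors P} (A.independent {v = A.vectors P}
                (Basis.independent (KSubspace.basis P))) 0F
            P≤ : ∀ l → v ∈⁴ subspace (L l) → P ≤ L l
            P≤ = λ l v∈ → A.≤-from-basis P (subspace (L l)) λ { 0F → v∈ }
            l , r∈ , v∈ = line-through {v} v≉0
        in l , (r∈ , P≤ l v∈) , λ {l′} (r∈′ , P≤l′) →
           let v∈′ = P≤l′ (A.vectors∈ P 0F) in
           S-≤ l l′ {v} v≉0 r∈ r∈′ v∈ v∈′ , S-≤ l′ l {v} v≉0 r∈′ r∈ v∈′ v∈

    lines-partitionable : LinesPartitionableIntoSpreads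
    lines-partitionable = suc q , S , S-spread , S-partition

-- Blocks and derived spreads.

module Blocks {q : ℕ} (F : Field) (order : HasOrder F q) (1<q : 1 < q)
  (V : Geometry.VectorSpace F) (dim : Geometry.HasDimension F V 7)
  {d : Level} (D : Pred (Geometry.KSubspace F V 3) d) (fano : Geometry.IsFanoAnalog F D) where

  open CommutativeRing (commutativeRingOf F) hiding (zero)
  open Geometry F
  open LeftModule V
  open FiniteField F order
  open LinearAlgebra F order 1<q V (decidable-equality F order V dim)
  open IntegerCoefficientSolver (commutativeRingOf F) using (_:+_; :-_)
  open KSubspace using (subspace)

  Pair : (x y : Carrierᴹ) → Set
  Pair x y = Independent (x ∷ y ∷ [])

  abstract

    block : ∀ {x y} → Pair x y → KSubspace V 3
    block xy = proj₁ (proj₂ fano (spanned _ xy))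

    block-D : ∀ {x y} (xy : Pair x y) → D (block xy)
    block-D xy = proj₁ (proj₁ (proj₂ (proj₂ fano (spanned _ xy))))

  infix 4 _∈ᴷ_
  _∈ᴷ_ : ∀ {k} → Carrierᴹ → KSubspace V k → Set
  x ∈ᴷ B = KSubspace.Member B x

  abstract

    block∋ˡ : ∀ {x y} (xy : Pair x y) → x ∈ᴷ block xy
    block∋ˡ {x} {y} xy = proj₂ (proj₁ (proj₂ (proj₂ fano (spanned _ xy)))) (∈span (x ∷ y ∷ []) 0F)

    block∋ʳ : ∀ {x y} (xy : Pair x y) → y ∈ᴷ block xy
    block∋ʳ {x} {y} xy = proj₂ (proj₁ (proj₂ (proj₂ fano (spanned _ xy)))) (∈span (x ∷ y ∷ []) 1F)

    block-unique : ∀ {x y} {B C : KSubspace V 3} → Pair x y → D B → D C →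
                   x ∈ᴷ B → y ∈ᴷ B → x ∈ᴷ C → y ∈ᴷ C → B ≤ C
    block-unique {x} {y} {B} {C} xy DB DC x∈B y∈B x∈C y∈C =
      proj₁ (unique {C} (DC , L⊆ C x∈C y∈C)) ∘ proj₂ (unique {B} (DB , L⊆ B x∈B y∈B))
      where
      unique : ∀ {B : KSubspace V 3} → D B × spanned _ xy ≤ B → block xy ≐ B
      unique = proj₂ (proj₂ (proj₂ fano (spanned _ xy)))
      L⊆ : ∀ (B : KSubspace V 3) → x ∈ᴷ B → y ∈ᴷ B → spanned _ xy ≤ B
      L⊆ B x∈B y∈B = span-least (subspace B) (x ∷ y ∷ []) λ { 0F → x∈B ; 1F → y∈B }

    third : ∀ {x y} (B : KSubspace V 3) → Pair x y → x ∈ᴷ B → y ∈ᴷ B →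
            ∃[ t ] t ∈ᴷ B × Independent (t ∷ x ∷ y ∷ []) × subspace B ≤ₛ span (t ∷ x ∷ y ∷ [])
    third {x} {y} B xy x∈B y∈B =
      let t , t∈B , t∉ = member-outside B (ℕ.n<1+n 2) (x ∷ y ∷ [])
          txy = extend xy t∉
      in t , t∈B , txy , independent-spans B txy λ { 0F → t∈B ; 1F → x∈B ; 2F → y∈B }

  -- The second vector only certifies x ≠ 0. The subspace is `span (x ∷ [])` whatever y is, so
  -- quotients formed from `xy` and `xz` agree definitionally.
  point : ∀ {x y} → Pair x y → ProjectivePoint V
  point {x} {y} xy = spanned (x ∷ []) (nonzero-independent (independent-nonzero xy 0F))

  module _ {x y} (xy : Pair x y) (B : KSubspace V 3) (x∈B : x ∈ᴷ B) (y∈B : y ∈ᴷ B) where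

    private
      P = subspace (point xy)
      P≤B = span-least (subspace B) (x ∷ []) λ { 0F → x∈B }

    quotientLine : ProjectiveLine (quotient P)
    quotientLine = record
      { subspace = quotientSubspace P (subspace B)
      ; basis    = record
        { vectors     = t ∷ y ∷ []
        ; members     = λ { 0F → t , t∈B , ~-refl t ; 1F → y , y∈B , ~-refl y }
        -- A relation modulo P says that a combination of t and y equals c x, which is a relation of
        -- t, x, y with - c at x.
        ; independent = λ a (c , eq) → λ where
            0F → only-trivially txy (a 0F ∷ - c 0F ∷ a 1F ∷ []) (combined a c eq) 0F
            1F → only-trivially txy (a 0F ∷ - c 0F ∷ a 1F ∷ []) (combined a c eq) 2F
        ; spanning    = λ {z} (b , b∈B , c , z-b≈) →
            let a , b≈ = B⊆ b∈B in
            (a 0F ∷ a 2F ∷ []) , (c 0F + a 1F ∷ []) , (begin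
              z +ᴹ -ᴹ (a 0F *ₗ t +ᴹ (a 2F *ₗ y +ᴹ 0ᴹ))
                ≈⟨ linear (a 0F ∷ a 2F ∷ []) (z ∷ b ∷ t ∷ y ∷ [])
                     (λ a₀ a₂ z b t y → z ⊕ ⊝ (a₀ ⊙ t ⊕ (a₂ ⊙ y ⊕ 𝟎))
                         ⊜ (z ⊕ ⊝ b) ⊕ (b ⊕ ⊝ (a₀ ⊙ t ⊕ (a₂ ⊙ y ⊕ 𝟎)))) ≡.refl ⟩
              (z +ᴹ -ᴹ b) +ᴹ (b +ᴹ -ᴹ (a 0F *ₗ t +ᴹ (a 2F *ₗ y +ᴹ 0ᴹ)))
                ≈⟨ +ᴹ-cong z-b≈ (+ᴹ-congʳ b≈) ⟩
              (c 0F *ₗ x +ᴹ 0ᴹ) +ᴹ ((a 0F *ₗ t +ᴹ (a 1F *ₗ x +ᴹ (a 2F *ₗ y +ᴹ 0ᴹ))) +ᴹ -ᴹ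
                  (a 0F *ₗ t +ᴹ (a 2F *ₗ y +ᴹ 0ᴹ)))
                ≈⟨ linear (a 0F ∷ a 1F ∷ a 2F ∷ c 0F ∷ []) (x ∷ t ∷ y ∷ [])
                     (λ a₀ a₁ a₂ c x t y →
                       (c ⊙ x ⊕ 𝟎) ⊕ ((a₀ ⊙ t ⊕ (a₁ ⊙ x ⊕ (a₂ ⊙ y ⊕ 𝟎))) ⊕ ⊝ (a₀ ⊙ t ⊕ (a₂ ⊙ y ⊕ 𝟎)))
                           ⊜ (c :+ a₁) ⊙ x ⊕ 𝟎) ≡.refl ⟩
              (c 0F + a 1F) *ₗ x +ᴹ 0ᴹ ∎)
        }
      }
      where
      open ≈-Reasoning ≈ᴹ-setoid
      3rd = third B xy x∈B y∈B
      t = proj₁ 3rd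
      t∈B = proj₁ (proj₂ 3rd)
      txy = proj₁ (proj₂ (proj₂ 3rd))
      B⊆ = proj₂ (proj₂ (proj₂ 3rd))
      ~-refl : ∀ z → congruentModulo P z z
      ~-refl z = LeftModule.≈ᴹ-refl (quotient P) {z}
      combined : ∀ (a : Vector Carrier 2) (c : Vector Carrier 1) →
                 (a 0F *ₗ t +ᴹ (a 1F *ₗ y +ᴹ 0ᴹ)) +ᴹ -ᴹ 0ᴹ ≈ᴹ c 0F *ₗ x +ᴹ 0ᴹ →
                 a 0F *ₗ t +ᴹ ((- c 0F) *ₗ x +ᴹ (a 1F *ₗ y +ᴹ 0ᴹ)) ≈ᴹ 0ᴹ
      combined a c eq = begin
        a 0F *ₗ t +ᴹ ((- c 0F) *ₗ x +ᴹ (a 1F *ₗ y +ᴹ 0ᴹ))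
          ≈⟨ linear (a 0F ∷ a 1F ∷ c 0F ∷ []) (x ∷ t ∷ y ∷ [])
               (λ a₀ a₁ c x t y → a₀ ⊙ t ⊕ ((:- c) ⊙ x ⊕ (a₁ ⊙ y ⊕ 𝟎)) ⊜ ((a₀ ⊙ t ⊕ (a₁ ⊙ y ⊕ 𝟎)) ⊕ ⊝ 𝟎)
                   ⊕ (:- c) ⊙ x) ≡.refl ⟩
        ((a 0F *ₗ t +ᴹ (a 1F *ₗ y +ᴹ 0ᴹ)) +ᴹ -ᴹ 0ᴹ) +ᴹ (- c 0F) *ₗ x
          ≈⟨ +ᴹ-congʳ eq ⟩
        (c 0F *ₗ x +ᴹ 0ᴹ) +ᴹ (- c 0F) *ₗ x
          ≈⟨ linear (c 0F ∷ []) (x ∷ []) (λ c x → (c ⊙ x ⊕ 𝟎) ⊕ (:- c) ⊙ x ⊜ 𝟎) ≡.refl ⟩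
        0ᴹ ∎

    quotientLine-derived : D B → derivedDesign D (point xy) quotientLine
    quotientLine-derived DB = B , DB , P≤B , id , id

    B∋⇒quotientLine∋ : ∀ {z} → z ∈ᴷ B → KSubspace.Member quotientLine z
    B∋⇒quotientLine∋ {z} z∈B = z , z∈B , LeftModule.≈ᴹ-refl (quotient P) {z}

    quotientLine∋⇒B∋ : ∀ {z} → KSubspace.Member quotientLine z → z ∈ᴷ B
    quotientLine∋⇒B∋ {z} (b , b∈B , z-b∈P) = Subspace.respects (subspace B)
      (linear [] (z ∷ b ∷ []) (λ z b → (z ⊕ ⊝ b) ⊕ b ⊜ z) ≡.refl)
      (Subspace.+-closed (subspace B) (P≤B z-b∈P) b∈B)

  -- The α-point condition lifted to V. The sum modulo x carries a spread, whose line through w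
  -- comes from a block through x and w, that is, from `block xw`. The condition speaks of distinct
  -- lines only, so coinciding blocks are treated separately.
  block-spread : ∀ {x y z w} (xy : Pair x y) (xz : Pair x z) (xw : Pair x w) →
                 IsαPoint D (point xy) → w ∈ subspace (block xy) +ₛ subspace (block xz) →
                 subspace (block xw) ≤ₛ subspace (block xy) +ₛ subspace (block xz)
  block-spread {x} {y} {z} {w} xy xz xw (_ , geometric) w∈@(b , c , b∈ , c∈ , w≈b+c)
    with block xy ∈? z
  ... | yes z∈Bxy = λ u∈ → _ , 0ᴹ , xw⊆xy u∈ , Subspace.0-closed (subspace (block xz)) ,
      ≈ᴹ-sym (+ᴹ-identityʳ _)
    where
    w∈xy : w ∈ᴷ block xy
    w∈xy = Subspace.respects (subspace (block xy)) (≈ᴹ-sym w≈b+c)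
      (Subspace.+-closed (subspace (block xy)) b∈
        (block-unique {B = block xz} {C = block xy} xz (block-D xz) (block-D xy)
          (block∋ˡ xz) (block∋ʳ xz) (block∋ˡ xy) z∈Bxy c∈))
    xw⊆xy : block xw ≤ block xy
    xw⊆xy = block-unique {B = block xw} {C = block xy} xw (block-D xw) (block-D xy)
      (block∋ˡ xw) (block∋ʳ xw) (block∋ˡ xy) w∈xy
  ... | no z∉Bxy = conclude (proj₂ (proj₂ spread) wP wP≤)
    where
    P = subspace (point xy)
    Ly = quotientLine xy (block xy) (block∋ˡ xy) (block∋ʳ xy)
    Lz = quotientLine xz (block xz) (block∋ˡ xz) (block∋ʳ xz)
    Ly≉Lz : ¬ (Ly ≐ Lz)
    Ly≉Lz (_ , Lz⊆Ly) = z∉Bxy (quotientLine∋⇒B∋ xy (block xy) (block∋ˡ xy) (block∋ʳ xy)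
      (Lz⊆Ly (B∋⇒quotientLine∋ xz (block xz) (block∋ˡ xz) (block∋ʳ xz) (block∋ʳ xz))))
    spread = geometric Ly Lz
      (quotientLine-derived xy (block xy) (block∋ˡ xy) (block∋ʳ xy) (block-D xy))
      (quotientLine-derived xz (block xz) (block∋ˡ xz) (block∋ʳ xz) (block-D xz)) Ly≉Lz
    wP : ProjectivePoint (quotient P)
    wP = Spans.spanned F (quotient P) (w ∷ []) (Spans.independent λ a (c , eq) → λ where
      0F → only-trivially xw (- c 0F ∷ a 0F ∷ []) (begin
        (- c 0F) *ₗ x +ᴹ (a 0F *ₗ w +ᴹ 0ᴹ)
          ≈⟨ linear (a 0F ∷ c 0F ∷ []) (x ∷ w ∷ []) (λ a c x w →
               (:- c) ⊙ x ⊕ (a ⊙ w ⊕ 𝟎) ⊜ ((a ⊙ w ⊕ 𝟎) ⊕ ⊝ 𝟎) ⊕ (:- c) ⊙ x) ≡.refl ⟩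
        ((a 0F *ₗ w +ᴹ 0ᴹ) +ᴹ -ᴹ 0ᴹ) +ᴹ (- c 0F) *ₗ x
          ≈⟨ +ᴹ-congʳ eq ⟩
        (c 0F *ₗ x +ᴹ 0ᴹ) +ᴹ (- c 0F) *ₗ x
          ≈⟨ linear (c 0F ∷ []) (x ∷ []) (λ c x → (c ⊙ x ⊕ 𝟎) ⊕ (:- c) ⊙ x ⊜ 𝟎) ≡.refl ⟩
        0ᴹ ∎) 1F)
      where open ≈-Reasoning ≈ᴹ-setoid
    wP≤ : subspace wP ≤ₛ subspace Ly +ₛ subspace Lz
    wP≤ = Spans.span-least F (quotient P) (subspace Ly +ₛ subspace Lz) (w ∷ []) λ where
      0F → b , c , B∋⇒quotientLine∋ xy (block xy) (block∋ˡ xy) (block∋ʳ xy) b∈ ,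
           B∋⇒quotientLine∋ xz (block xz) (block∋ˡ xz) (block∋ʳ xz) c∈ ,
           Subspace.respects P (≈ᴹ-sym (≈ᴹ-trans (+ᴹ-congʳ w≈b+c) (-ᴹ‿inverseʳ _))) (Subspace.0-closed P)
    w∈wP : KSubspace.Member wP w
    w∈wP = Spans.∈span F (quotient P) (w ∷ []) 0F
    conclude : ∃! _≐_ (λ L → (derivedDesign D (point xy) L × subspace L ≤ₛ subspace Ly +ₛ subspace Lz)
        × wP ≤ L) →
               ∀ {u} → u ∈ᴷ block xw → u ∈ subspace (block xy) +ₛ subspace (block xz)
    conclude (L , (((B , DB , P≤B , (L⊆B/P , B/P⊆L)) , L≤Ly+Lz) , wP≤L) , _) {u} u∈ =
      let b , b∈B , w-b∈P = L⊆B/P (wP≤L w∈wP)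
          w∈B = Subspace.respects (subspace B)
            (linear [] (w ∷ b ∷ []) (λ w b → (w ⊕ ⊝ b) ⊕ b ⊜ w) ≡.refl)
            (Subspace.+-closed (subspace B) (P≤B w-b∈P) b∈B)
          u∈B = block-unique {B = block xw} {C = B} xw (block-D xw) DB
            (block∋ˡ xw) (block∋ʳ xw) (P≤B (∈span (x ∷ []) 0F)) w∈B u∈
          p , r , p∈Ly , r∈Lz , u-[p+r]∈P = L≤Ly+Lz (B/P⊆L (u , u∈B , LeftModule.≈ᴹ-refl (quotient P) {u}))
          P≤Bxy = span-least (subspace (block xy)) (x ∷ []) λ { 0F → block∋ˡ xy }
      -- The sum p + r represents u only modulo P; the remainder in P is absorbed by the summand in
      -- `block xy`.
      in (u +ᴹ -ᴹ (p +ᴹ r)) +ᴹ p , r ,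
         Subspace.+-closed (subspace (block xy)) (P≤Bxy u-[p+r]∈P)
           (quotientLine∋⇒B∋ xy (block xy) (block∋ˡ xy) (block∋ʳ xy) p∈Ly) ,
         quotientLine∋⇒B∋ xz (block xz) (block∋ˡ xz) (block∋ʳ xz) r∈Lz ,
         linear [] (u ∷ p ∷ r ∷ []) (λ u p r → u ⊜ ((u ⊕ ⊝ (p ⊕ r)) ⊕ p) ⊕ r) ≡.refl

-- Perpendicularity of vectors in the hyperplane.

module Perpendicularity {q : ℕ} (F : Field) (order : HasOrder F q) (1<q : 1 < q)
  (V : Geometry.VectorSpace F) (dim : Geometry.HasDimension F V 7)
  {d : Level} (D : Pred (Geometry.KSubspace F V 3) d) (fano : Geometry.IsFanoAnalog F D)
  (H : Geometry.KSubspace F V 6)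
  (α : ∀ (P : Geometry.ProjectivePoint F V) → Geometry._≤_ F P H → Geometry.IsαPoint F D P) where

  open CommutativeRing (commutativeRingOf F) hiding (zero)
  open Geometry F
  open LeftModule V
  open FiniteField F order
  open LinearAlgebra F order 1<q V (decidable-equality F order V dim)
  open IntegerCoefficientSolver (commutativeRingOf F) using (con; :-_)
  open KSubspace using (subspace)
  open Blocks F order 1<q V dim D fano
  module H = KSubspace H

  infix 4 _⟂_
  -- Quantifying over the proof of independence makes dependent vectors perpendicular vacuously, as
  -- for an alternating form. The record keeps x and y inferable.
  record _⟂_ (x y : Carrierᴹ) : Set where
    constructor perpendicular
    field block⊆H : (xy : Pair x y) → block xy ≤ H

  open _⟂_ public

  _≤H? : ∀ (B : KSubspace V 3) → Dec (B ≤ H)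
  B ≤H? = map′ (λ b⊆H {x} → ≤-from-basis B H.subspace b⊆H {x}) (λ B≤H i → B≤H (vectors∈ B i))
    (Fin.all? (λ i → H ∈? vectors B i))

  ⟂-block : ∀ {x y} (B : KSubspace V 3) → D B → B ≤ H → x ∈ᴷ B → y ∈ᴷ B → x ⟂ y
  ⟂-block {x} {y} B DB B≤H x∈B y∈B = perpendicular λ xy u∈ → B≤H
    (block-unique {B = block xy} {C = B} xy (block-D xy) DB (block∋ˡ xy) (block∋ʳ xy) x∈B y∈B u∈)

  ⟂-own-block : ∀ {x y} (xy : Pair x y) → block xy ≤ H → x ⟂ y
  ⟂-own-block xy B≤H = ⟂-block (block xy) (block-D xy) B≤H (block∋ˡ xy) (block∋ʳ xy)

  _⟂?_ : ∀ x y → Dec (x ⟂ y)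
  x ⟂? y = by-cases (independent? (x ∷ y ∷ []))
    where
    by-cases : Dec (Pair x y) → Dec (x ⟂ y)
    by-cases (no ¬xy) = yes (perpendicular λ xy → contradiction xy ¬xy)
    by-cases (yes xy) = map′ (⟂-own-block xy) (λ x⟂y → block⊆H x⟂y xy) (block xy ≤H?)

  ¬⟂⇒pair : ∀ {x y} → ¬ (x ⟂ y) → Pair x y
  ¬⟂⇒pair {x} {y} ¬x⟂y = decidable-stable (independent? (x ∷ y ∷ [])) λ ¬xy →
    ¬x⟂y (perpendicular λ xy → contradiction xy ¬xy)

  ¬⟂⇒∉H : ∀ {x y} → ¬ (x ⟂ y) → (xy : Pair x y) → ∃[ t ] t ∈ᴷ block xy × ¬ (t ∈ᴷ H)
  ¬⟂⇒∉H {x} {y} ¬x⟂y xy =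
    let i , bᵢ∉H = Fin.¬∀⟶∃¬ 3 (λ i → vectors (block xy) i ∈ᴷ H) (λ i → H ∈? vectors (block xy) i) (λ b⊆H →
          ¬x⟂y (⟂-own-block xy (≤-from-basis (block xy) H.subspace b⊆H)))
    in vectors (block xy) i , vectors∈ (block xy) i , bᵢ∉H

  ⟂-refl : ∀ {x} → x ⟂ x
  ⟂-refl {x} = perpendicular λ xx → contradiction (∈span (x ∷ []) 0F) (head∉tail xx)

  ⟂-sym : ∀ {x y} → x ⟂ y → y ⟂ x
  ⟂-sym x⟂y = perpendicular λ yx → block⊆H (⟂-block _ (block-D (independent-swap yx))
    (block⊆H x⟂y (independent-swap yx)) (block∋ʳ _) (block∋ˡ _)) yx

  ⟂-span : ∀ {x y z} → x ⟂ y → z ∈ span (x ∷ y ∷ []) → x ⟂ z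
  ⟂-span {x} {y} {z} x⟂y z∈ = perpendicular λ xz →
    let xy = independent-by xz λ { 0F → ∈span (x ∷ y ∷ []) 0F ; 1F → z∈ }
        z∈B = span-least (subspace (block xy)) (x ∷ y ∷ []) (λ { 0F → block∋ˡ xy ; 1F → block∋ʳ xy }) z∈
    in block⊆H (⟂-block (block xy) (block-D xy) (block⊆H x⟂y xy) (block∋ˡ xy) z∈B) xz

  proportional : ∀ {x y} → ¬ (x ≈ᴹ 0ᴹ) → ¬ Pair x y → y ∈ span (x ∷ [])
  proportional {x} {y} x≉0 ¬xy = decidable-stable (y ∈span? (x ∷ [])) λ y∉ →
    ¬xy (independent-swap (extend (nonzero-independent x≉0) y∉))

  α-at : ∀ {x y} → x ∈ᴷ H → (xy : Pair x y) → IsαPoint D (point xy)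
  α-at {x} x∈H xy = α (point xy) (span-least H.subspace (x ∷ []) λ { 0F → x∈H })

  -- By `block-spread` the block through x and y + z lies in the sum of two blocks contained in H.
  -- If y or z is a multiple of x, then y + z lies in the span of x and the other one.
  ⟂-+ : ∀ {x y z} → x ∈ᴷ H → x ⟂ y → x ⟂ z → x ⟂ (y +ᴹ z)
  ⟂-+ {x} {y} {z} x∈H x⟂y x⟂z = perpendicular by-cases
    where
    by-cases : (xw : Pair x (y +ᴹ z)) → block xw ≤ H
    by-cases xw with independent? (x ∷ y ∷ []) | independent? (x ∷ z ∷ [])
    ... | no ¬xy | _ =
      let a , y≈ = proportional (independent-nonzero xw 0F) ¬xy in
      block⊆H (⟂-span x⟂z ((a 0F ∷ 1# ∷ []) , ≈ᴹ-trans (+ᴹ-congʳ y≈)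
        (linear (a 0F ∷ []) (x ∷ z ∷ []) (λ a x z →
            (a ⊙ x ⊕ 𝟎) ⊕ z ⊜ a ⊙ x ⊕ (con (+ 1) ⊙ z ⊕ 𝟎)) ≡.refl))) xw
    ... | yes _ | no ¬xz =
      let a , z≈ = proportional (independent-nonzero xw 0F) ¬xz in
      block⊆H (⟂-span x⟂y ((a 0F ∷ 1# ∷ []) , ≈ᴹ-trans (+ᴹ-congˡ z≈)
        (linear (a 0F ∷ []) (x ∷ y ∷ []) (λ a x y → y ⊕ (a ⊙ x ⊕ 𝟎)
            ⊜ a ⊙ x ⊕ (con (+ 1) ⊙ y ⊕ 𝟎)) ≡.refl))) xw
    ... | yes xy | yes xz = λ u∈ →
      let b , c , b∈ , c∈ , u≈b+c = block-spread xy xz xw (α-at x∈H xy)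
            (y , z , block∋ʳ xy , block∋ʳ xz , ≈ᴹ-refl) u∈
      in H.respects (≈ᴹ-sym u≈b+c) (H.+-closed (block⊆H x⟂y xy b∈) (block⊆H x⟂z xz c∈))

  -- For S containing x this says that the derived spread in x restricts to S/x.
  BlockClosed : Carrierᴹ → Subspace V → Set
  BlockClosed x S = ∀ {u} (xu : Pair x u) → u ∈ S → subspace (block xu) ≤ₛ S

  block-closed : ∀ {x y} (xy : Pair x y) → BlockClosed x (subspace (block xy))
  block-closed xy xu u∈ = block-unique {B = block xu} {C = block xy} xu (block-D xu) (block-D xy)
    (block∋ˡ xu) (block∋ʳ xu) (block∋ˡ xy) u∈

  -- If y lies outside a union S of blocks through x, the block through x and y meets S only in ⟨x⟩.
  grow : ∀ {n x y t} {v : Vector Carrierᴹ n} (S : Subspace V) → BlockClosed x S → x ∈ S →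
         Independent v → (∀ i → v i ∈ S) → y ∉ S →
         (xy : Pair x y) → t ∈ᴷ block xy → t ∉ span (x ∷ y ∷ []) → Independent (t ∷ y ∷ v)
  grow {x = x} {y} {t} {v} S S-closed x∈S v-ind v⊆S y∉S xy t∈ t∉ =
    extend (extend v-ind (y∉S ∘ span-least S v v⊆S)) λ (a , t≈) →
      let s   = lc (a ∘ suc) v
          s∈S = lc-closed S v v⊆S (a ∘ suc)
          s≈  = ≈ᴹ-trans
            (linear (a 0F ∷ []) (s ∷ y ∷ []) (λ a s y → s ⊜ (a ⊙ y ⊕ s) ⊕ (:- a) ⊙ y) ≡.refl)
            (+ᴹ-congʳ (≈ᴹ-sym t≈))
          s∈B = Subspace.respects (subspace (block xy)) (≈ᴹ-sym s≈)
              (Subspace.+-closed (subspace (block xy)) t∈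
                  (Subspace.*ₗ-closed (subspace (block xy)) (- a 0F) (block∋ʳ xy)))
          xs  = decidable-stable (independent? (x ∷ s ∷ [])) λ ¬xs →
                  let b , s≈bx = proportional (independent-nonzero xy 0F) ¬xs in
                  t∉ ((b 0F ∷ a 0F ∷ []) , ≈ᴹ-trans t≈ (≈ᴹ-trans (+ᴹ-congˡ s≈bx)
                    (linear (a 0F ∷ b 0F ∷ []) (x ∷ y ∷ []) (λ a b x y →
                      a ⊙ y ⊕ (b ⊙ x ⊕ 𝟎) ⊜ b ⊙ x ⊕ (a ⊙ y ⊕ 𝟎)) ≡.refl)))
      in y∉S (S-closed xs s∈S (block-unique {B = block xy} {C = block xs} xs (block-D xy) (block-D xs)
           (block∋ˡ xy) s∈B (block∋ˡ xs) (block∋ʳ xs) (block∋ʳ xy)))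

  -- Three independent blocks through x span V, so they cannot all lie in H.
  ⟂-nondegenerate : ∀ {x} → x ∈ᴷ H → ¬ (x ≈ᴹ 0ᴹ) → ∃[ y ] y ∈ᴷ H × ¬ (x ⟂ y)
  ⟂-nondegenerate {x} x∈H x≉0 = first (member-outside H (s<s z<s) (x ∷ []))
    where
    Goal : Set
    Goal = ∃[ y ] y ∈ᴷ H × ¬ (x ⟂ y)

    x∈B : ∀ {y} (xy : Pair x y) → x ∈ subspace (block xy)
    x∈B xy = block∋ˡ xy

    module _ {y₁} (y₁∈H : y₁ ∈ᴷ H) (xy₁ : Pair x y₁) (B₁≤H : block xy₁ ≤ H)
             {t₁} (t₁∈B₁ : t₁ ∈ᴷ block xy₁) (ind₁ : Independent (t₁ ∷ x ∷ y₁ ∷ []))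
             (B₁⊆ : subspace (block xy₁) ≤ₛ span (t₁ ∷ x ∷ y₁ ∷ [])) where

      B₁ = subspace (block xy₁)

      v₁⊆B₁ : ∀ i → (t₁ ∷ x ∷ y₁ ∷ []) i ∈ B₁
      v₁⊆B₁ = λ { 0F → t₁∈B₁ ; 1F → block∋ˡ xy₁ ; 2F → block∋ʳ xy₁ }

      module _ {y₂} (y₂∈H : y₂ ∈ᴷ H) (y₂∉B₁ : y₂ ∉ B₁) (xy₂ : Pair x y₂) (B₂≤H : block xy₂ ≤ H)
               {t₂} (t₂∈B₂ : t₂ ∈ᴷ block xy₂) (ind₂ : Independent (t₂ ∷ x ∷ y₂ ∷ []))
               (B₂⊆ : subspace (block xy₂) ≤ₛ span (t₂ ∷ x ∷ y₂ ∷ [])) where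

        B₂ = subspace (block xy₂)
        v₂ = t₂ ∷ y₂ ∷ t₁ ∷ x ∷ y₁ ∷ []

        v₂⊆B₁+B₂ : ∀ i → v₂ i ∈ B₁ +ₛ B₂
        v₂⊆B₁+B₂ = λ where
          0F → ∈-+ₛʳ B₁ B₂ t₂∈B₂
          1F → ∈-+ₛʳ B₁ B₂ (block∋ʳ xy₂)
          2F → ∈-+ₛˡ B₁ B₂ t₁∈B₁
          3F → ∈-+ₛˡ B₁ B₂ (block∋ˡ xy₁)
          4F → ∈-+ₛˡ B₁ B₂ (block∋ʳ xy₁)

        B₁+B₂⊆ : B₁ +ₛ B₂ ≤ₛ span v₂
        B₁+B₂⊆ (b , c , b∈ , c∈ , u≈) = Subspace.respects (span v₂) (≈ᴹ-sym u≈)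
          (Subspace.+-closed (span v₂)
            (span-least (span v₂) (t₁ ∷ x ∷ y₁ ∷ [])
              (λ { 0F → ∈span v₂ 2F ; 1F → ∈span v₂ 3F ; 2F → ∈span v₂ 4F }) (B₁⊆ b∈))
            (span-least (span v₂) (t₂ ∷ x ∷ y₂ ∷ [])
              (λ { 0F → ∈span v₂ 0F ; 1F → ∈span v₂ 3F ; 2F → ∈span v₂ 1F }) (B₂⊆ c∈)))

        v₂-ind : Independent v₂
        v₂-ind = grow B₁ (block-closed xy₁) (block∋ˡ xy₁) ind₁ v₁⊆B₁ y₂∉B₁ xy₂ t₂∈B₂ (head∉tail ind₂)

        sum-closed : BlockClosed x (B₁ +ₛ B₂)
        sum-closed xu u∈ = block-spread xy₁ xy₂ xu (α-at x∈H xy₁) u∈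

        third-block : ∃[ y ] y ∈ᴷ H × y ∉ span v₂ → Goal
        third-block (y₃ , y₃∈H , y₃∉) = decide (x ⟂? y₃)
          where
          y₃∉S : y₃ ∉ B₁ +ₛ B₂
          y₃∉S = y₃∉ ∘ B₁+B₂⊆
          xy₃ : Pair x y₃
          xy₃ = independent-swap (extend (nonzero-independent x≉0)
            (y₃∉ ∘ span-least (span v₂) (x ∷ []) λ { 0F → ∈span v₂ 3F }))
          contradictory : block xy₃ ≤ H → ∃[ t ] t ∈ᴷ block xy₃ × t ∉ span (x ∷ y₃ ∷ []) → Goal
          contradictory B₃≤H (t₃ , t₃∈B₃ , t₃∉) =
            contradiction
              (grow (B₁ +ₛ B₂) sum-closed (v₂⊆B₁+B₂ 3F) v₂-ind v₂⊆B₁+B₂ y₃∉S xy₃ t₃∈B₃ t₃∉)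
              (dimension-bound H (ℕ.n<1+n 6) λ where
                0F → B₃≤H t₃∈B₃
                1F → y₃∈H
                2F → B₂≤H t₂∈B₂
                3F → y₂∈H
                4F → B₁≤H t₁∈B₁
                5F → x∈H
                (suc (suc (suc (suc (suc (suc zero)))))) → y₁∈H)
          decide : Dec (x ⟂ y₃) → Goal
          decide (no ¬x⟂y₃) = y₃ , y₃∈H , ¬x⟂y₃
          decide (yes x⟂y₃) = contradictory (block⊆H x⟂y₃ xy₃)
            (member-outside (block xy₃) (ℕ.n<1+n 2) (x ∷ y₃ ∷ []))

      second : ∃[ y ] y ∈ᴷ H × y ∉ span (t₁ ∷ x ∷ y₁ ∷ []) → Goal
      second (y₂ , y₂∈H , y₂∉) = decide (x ⟂? y₂)
        where
        xy₂ : Pair x y₂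
        xy₂ = independent-swap (extend (nonzero-independent x≉0)
          (y₂∉ ∘ span-least (span (t₁ ∷ x ∷ y₁ ∷ [])) (x ∷ []) λ { 0F → ∈span (t₁ ∷ x ∷ y₁ ∷ []) 1F }))
        decide : Dec (x ⟂ y₂) → Goal
        decide (no ¬x⟂y₂) = y₂ , y₂∈H , ¬x⟂y₂
        decide (yes x⟂y₂) =
          let t₂ , t₂∈B₂ , ind₂ , B₂⊆ = third (block xy₂) xy₂ (block∋ˡ xy₂) (block∋ʳ xy₂) in
          third-block y₂∈H (y₂∉ ∘ B₁⊆) xy₂ (block⊆H x⟂y₂ xy₂) t₂∈B₂ ind₂ B₂⊆
            (member-outside H (ℕ.n<1+n 5) (t₂ ∷ y₂ ∷ t₁ ∷ x ∷ y₁ ∷ []))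

    first : ∃[ y ] y ∈ᴷ H × y ∉ span (x ∷ []) → Goal
    first (y₁ , y₁∈H , y₁∉) = decide (x ⟂? y₁)
      where
      xy₁ : Pair x y₁
      xy₁ = independent-swap (extend (nonzero-independent x≉0) y₁∉)
      decide : Dec (x ⟂ y₁) → Goal
      decide (no ¬x⟂y₁) = y₁ , y₁∈H , ¬x⟂y₁
      decide (yes x⟂y₁) =
        let t₁ , t₁∈B₁ , ind₁ , B₁⊆ = third (block xy₁) xy₁ (block∋ˡ xy₁) (block∋ʳ xy₁) in
        second y₁∈H xy₁ (block⊆H x⟂y₁ xy₁) t₁∈B₁ ind₁ B₁⊆ (member-outside H (s<s (s<s (s<s z<s)))
            (t₁ ∷ x ∷ y₁ ∷ []))

-- The perpendicular space of a vector has codimension at most one in H.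

module Projection {q : ℕ} (F : Field) (order : HasOrder F q) (1<q : 1 < q)
  (V : Geometry.VectorSpace F) (dim : Geometry.HasDimension F V 7)
  {d : Level} (D : Pred (Geometry.KSubspace F V 3) d) (fano : Geometry.IsFanoAnalog F D)
  (H : Geometry.KSubspace F V 6)
  (α : ∀ (P : Geometry.ProjectivePoint F V) → Geometry._≤_ F P H → Geometry.IsαPoint F D P) where

  open CommutativeRing (commutativeRingOf F) hiding (zero)
  open Geometry F
  open LeftModule V
  open FiniteField F order
  open LinearAlgebra F order 1<q V (decidable-equality F order V dim)
  open IntegerCoefficientSolver (commutativeRingOf F)
    using (_:*_; _:+_; con; :-_; _:-_)
  open KSubspace using (subspace)
  open Blocks F order 1<q V dim D fano
  open Perpendicularity F order 1<q V dim D fano H α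

  whole : KSubspace V 7
  whole = record { subspace = wholeSpace V ; basis = dim }

  ⟂-resp : ∀ {x y z} → y ≈ᴹ z → x ⟂ y → x ⟂ z
  ⟂-resp {x} {y} y≈z x⟂y = ⟂-span x⟂y ((0# ∷ 1# ∷ []) , ≈ᴹ-trans (≈ᴹ-sym y≈z)
    (linear [] (x ∷ y ∷ []) (λ x y → y ⊜ con (+ 0) ⊙ x ⊕ (con (+ 1) ⊙ y ⊕ 𝟎)) ≡.refl))

  ⟂-* : ∀ k {x y} → x ⟂ y → x ⟂ (k *ₗ y)
  ⟂-* k {x} {y} x⟂y = ⟂-span x⟂y ((0# ∷ k ∷ []) ,
    linear (k ∷ []) (x ∷ y ∷ []) (λ k x y → k ⊙ y ⊜ con (+ 0) ⊙ x ⊕ (k ⊙ y ⊕ 𝟎)) ≡.refl)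

  ⟂-unscale : ∀ {k x y} → ¬ (k ≈ 0#) → x ⟂ (k *ₗ y) → x ⟂ y
  ⟂-unscale {k} {x} {y} k≉0 x⟂ky = ⟂-span x⟂ky (unscale (span (x ∷ k *ₗ y ∷ [])) k≉0
      (∈span (x ∷ k *ₗ y ∷ []) 1F))

  -- V/H is one-dimensional, so any two vectors outside H agree modulo H up to a factor.
  rescale-modulo-H : ∀ {u v} → ¬ (u ∈ᴷ H) → ¬ (v ∈ᴷ H) →
                     ∃₂ λ m h → h ∈ᴷ H × m *ₗ v ≈ᴹ u +ᴹ h
  rescale-modulo-H {u} {v} u∉H v∉H =
    let h-ind = independent (Basis.independent H.basis)
        w = u ∷ vectors H
        w-ind = extend h-ind (u∉H ∘ span-least H.subspace (vectors H) (vectors∈ H))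
        c , v≈ = independent-spans whole {v = w} w-ind (λ _ → _) {v} _
        h = lc (c ∘ suc) (vectors H)
        h∈H = lc-closed H.subspace (vectors H) (vectors∈ H) (c ∘ suc)
        k≉0 = λ k≈0 → v∉H (H.respects (≈ᴹ-sym (≈ᴹ-trans v≈ (≈ᴹ-trans
                (+ᴹ-congʳ (scale-zero u k≈0)) (+ᴹ-identityˡ h)))) h∈H)
        m = c 0F ⁻¹⟨ k≉0 ⟩
    in m , m *ₗ h , H.*ₗ-closed m h∈H , (begin
      m *ₗ v                     ≈⟨ *ₗ-cong refl v≈ ⟩
      m *ₗ (c 0F *ₗ u +ᴹ h)      ≈⟨ linear (m ∷ c 0F ∷ []) (u ∷ h ∷ [])
          (λ m k u h → m ⊙ (k ⊙ u ⊕ h) ⊜ (k :* m) ⊙ u ⊕ m ⊙ h) ≡.refl ⟩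
      (c 0F * m) *ₗ u +ᴹ m *ₗ h  ≈⟨ +ᴹ-congʳ (scale-one u (inverseʳ⟨ k≉0 ⟩)) ⟩
      u +ᴹ m *ₗ h                ∎)
    where open ≈-Reasoning ≈ᴹ-setoid

  -- In V/x the blocks B(x,y) and B(x,z) are disjoint lines ⟨y,y′⟩ and ⟨z,y′+d⟩ meeting
  -- H/x in y and z.  Were no point e a = y + a₀z + a₁d perpendicular to x, the block
  -- through x and e a would contain exactly one T r = y′ + r₀z + r₁d, and a ↦ r would be
  -- an injection of F² into itself missing (0,1), because T (0,1) = y′ + d lies on B(x,z).
  module _ {x y z y′ d} (x∈H : x ∈ᴷ H) (y∈H : y ∈ᴷ H) (z∈H : z ∈ᴷ H) (d∈H : d ∈ᴷ H)
           (y′∉H : ¬ (y′ ∈ᴷ H)) (xy : Pair x y) (xz : Pair x z) (¬x⟂z : ¬ (x ⟂ z))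
           (ind : Independent (y′ ∷ d ∷ x ∷ y ∷ z ∷ []))
           (y′∈ : y′ ∈ᴷ block xy) (z′∈ : (y′ +ᴹ d) ∈ᴷ block xz)
           (⊆span : subspace (block xy) +ₛ subspace (block xz) ≤ₛ span (y′ ∷ d ∷ x ∷ y ∷ z ∷ [])) where

    private
      S = subspace (block xy) +ₛ subspace (block xz)
      module S = Subspace S
      basis = y′ ∷ d ∷ x ∷ y ∷ z ∷ []

    y∈S : y ∈ S
    y∈S = ∈-+ₛˡ (subspace (block xy)) (subspace (block xz)) (block∋ʳ xy)

    z∈S : z ∈ S
    z∈S = ∈-+ₛʳ (subspace (block xy)) (subspace (block xz)) (block∋ʳ xz)

    d∈S : d ∈ S
    d∈S = S.respects
      (linear [] (y′ ∷ d ∷ []) (λ y′ d → (y′ ⊕ d) ⊕ ⊝ y′ ⊜ d) ≡.refl)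
      (S.+-closed (∈-+ₛʳ (subspace (block xy)) (subspace (block xz)) z′∈)
        (-‿closed S (∈-+ₛˡ (subspace (block xy)) (subspace (block xz)) y′∈)))

    leading≈0 : ∀ c → lc c basis ∈ᴷ H → c 0F ≈ 0#
    leading≈0 c lc∈H = decidable-stable (c 0F ≟ 0#) λ c₀≉0 → y′∉H (unscale H.subspace c₀≉0 (H.respects
      (linear (c 0F ∷ []) (y′ ∷ lc (c ∘ suc) (basis ∘ suc) ∷ []) (λ c y′ r →
          (c ⊙ y′ ⊕ r) ⊕ ⊝ r ⊜ c ⊙ y′) ≡.refl)
      (H.+-closed lc∈H (-‿closed H.subspace
        (lc-closed H.subspace (d ∷ x ∷ y ∷ z ∷ []) (λ { 0F → d∈H ; 1F → x∈H ; 2F → y∈H ; 3F → z∈H })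
            (c ∘ suc))))))

    e T : Vector Carrier 2 → Carrierᴹ
    e a = y +ᴹ (a 0F *ₗ z +ᴹ a 1F *ₗ d)
    T r = y′ +ᴹ (r 0F *ₗ z +ᴹ r 1F *ₗ d)

    e∈H : ∀ a → e a ∈ᴷ H
    e∈H a = H.+-closed y∈H (H.+-closed (H.*ₗ-closed (a 0F) z∈H) (H.*ₗ-closed (a 1F) d∈H))

    e∈S : ∀ a → e a ∈ S
    e∈S a = S.+-closed y∈S (S.+-closed (S.*ₗ-closed (a 0F) z∈S) (S.*ₗ-closed (a 1F) d∈S))

    T∉H : ∀ r → ¬ (T r ∈ᴷ H)
    T∉H r T∈H = y′∉H (H.respects
      (linear [] (y′ ∷ r 0F *ₗ z +ᴹ r 1F *ₗ d ∷ []) (λ y′ h → (y′ ⊕ h) ⊕ ⊝ h ⊜ y′) ≡.refl)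
      (H.+-closed T∈H (-‿closed H.subspace (H.+-closed (H.*ₗ-closed (r 0F) z∈H) (H.*ₗ-closed (r 1F) d∈H)))))

    ∉H⇒pair : ∀ {u} → ¬ (u ∈ᴷ H) → Pair x u
    ∉H⇒pair u∉H = independent-swap (extend (nonzero-independent (independent-nonzero xy 0F))
      (u∉H ∘ span-least H.subspace (x ∷ []) λ { 0F → x∈H }))

    ∉H⇒extends : ∀ {u w} → ¬ (u ∈ᴷ H) → w ∈ᴷ H → Pair x w → Independent (u ∷ x ∷ w ∷ [])
    ∉H⇒extends {w = w} u∉H w∈H xw = extend xw
      (u∉H ∘ span-least H.subspace (x ∷ w ∷ []) λ { 0F → x∈H ; 1F → w∈H })

    xe : ∀ a → Pair x (e a)
    xe a = independent λ c eq →
      let c≈0 = only-trivially ind (0# ∷ c 1F * a 1F ∷ c 0F ∷ c 1F ∷ c 1F * a 0F ∷ []) (≈ᴹ-trans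
            (linear (c 0F ∷ c 1F ∷ a 0F ∷ a 1F ∷ []) (y′ ∷ d ∷ x ∷ y ∷ z ∷ []) (λ c₀ c₁ a₀ a₁ y′ d x y z →
              con (+ 0) ⊙ y′ ⊕ ((c₁ :* a₁) ⊙ d ⊕ (c₀ ⊙ x ⊕ (c₁ ⊙ y ⊕ ((c₁ :* a₀) ⊙ z ⊕ 𝟎)))) ⊜
              c₀ ⊙ x ⊕ (c₁ ⊙ (y ⊕ (a₀ ⊙ z ⊕ a₁ ⊙ d)) ⊕ 𝟎)) ≡.refl) eq)
      in λ { 0F → c≈0 2F ; 1F → c≈0 3F }

    block-xe⊆S : ∀ a → subspace (block (xe a)) ≤ₛ S
    block-xe⊆S a = block-spread xy xz (xe a) (α-at x∈H xy) (e∈S a)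

    transversal : ∀ a → ¬ (x ⟂ e a) → ∃[ r ] T r ∈ᴷ block (xe a)
    transversal a ¬x⟂e =
      let t , t∈B , t∉H = ¬⟂⇒∉H ¬x⟂e (xe a)
          m , h , h∈H , mt≈ = rescale-modulo-H y′∉H t∉H
          p∈B = B.*ₗ-closed m t∈B
          c , p≈ = ⊆span (block-xe⊆S a p∈B)
          h≈ : lc (c 0F - 1# ∷ c ∘ suc) basis ≈ᴹ h
          h≈ = begin
            (c 0F - 1#) *ₗ y′ +ᴹ rest c               ≈⟨ linear (c 0F ∷ []) (y′ ∷ rest c ∷ []) (λ c y′ r →
                (c :- con (+ 1)) ⊙ y′ ⊕ r ⊜ (c ⊙ y′ ⊕ r) ⊕ ⊝ y′) ≡.refl ⟩
            lc c basis +ᴹ -ᴹ y′                       ≈⟨ +ᴹ-congʳ (≈ᴹ-trans (≈ᴹ-sym p≈) mt≈) ⟩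
            (y′ +ᴹ h) +ᴹ -ᴹ y′                        ≈⟨ linear [] (y′ ∷ h ∷ []) (λ y′ h →
                (y′ ⊕ h) ⊕ ⊝ y′ ⊜ h) ≡.refl ⟩
            h                                         ∎
          c₀-1≈0 = leading≈0 (c 0F - 1# ∷ c ∘ suc) (H.respects (≈ᴹ-sym h≈) h∈H)
          -- Removing the x-coordinate and `c 3F` times `e a` clears x and y and shifts the z- and
          -- d-coordinates to these values.
          r = (c 4F - c 3F * a 0F) ∷ (c 1F - c 3F * a 1F) ∷ []
          T≈ : m *ₗ t +ᴹ ((- c 2F) *ₗ x +ᴹ (- c 3F) *ₗ e a) ≈ᴹ T r
          T≈ = begin
            m *ₗ t +ᴹ ((- c 2F) *ₗ x +ᴹ (- c 3F) *ₗ e a)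
              ≈⟨ +ᴹ-congʳ p≈ ⟩
            lc c basis +ᴹ ((- c 2F) *ₗ x +ᴹ (- c 3F) *ₗ e a)
              ≈⟨ linear (c 0F ∷ c 1F ∷ c 2F ∷ c 3F ∷ c 4F ∷ a 0F ∷ a 1F ∷ []) (y′ ∷ d ∷ x ∷ y ∷ z ∷ [])
                   (λ c₀ c₁ c₂ c₃ c₄ a₀ a₁ y′ d x y z →
                     (c₀ ⊙ y′ ⊕ (c₁ ⊙ d ⊕ (c₂ ⊙ x ⊕ (c₃ ⊙ y ⊕ (c₄ ⊙ z ⊕ 𝟎)))))
                       ⊕ ((:- c₂) ⊙ x ⊕ (:- c₃) ⊙ (y ⊕ (a₀ ⊙ z ⊕ a₁ ⊙ d))) ⊜
                     (c₀ :- con (+ 1)) ⊙ y′ ⊕ (y′ ⊕ ((c₄ :- c₃ :* a₀) ⊙ z ⊕ (c₁ :- c₃ :* a₁) ⊙ d))) ≡.refl ⟩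
            (c 0F - 1#) *ₗ y′ +ᴹ T r
              ≈⟨ drop-zeroˡ y′ (T r) c₀-1≈0 ⟩
            T r ∎
      in r , B.respects T≈ (B.+-closed p∈B (B.+-closed
           (B.*ₗ-closed (- c 2F) (block∋ˡ (xe a))) (B.*ₗ-closed (- c 3F) (block∋ʳ (xe a)))))
      where
      module B = KSubspace (block (xe a))
      rest : Vector Carrier 5 → Carrierᴹ
      rest c = lc (c ∘ suc) (basis ∘ suc)
      open ≈-Reasoning ≈ᴹ-setoid

    e-coordinates : Vector Carrier 2 → Vector Carrier 5
    e-coordinates a = 0# ∷ a 1F ∷ 0# ∷ 1# ∷ a 0F ∷ []

    e≈ : ∀ a → e a ≈ᴹ lc (e-coordinates a) basis
    e≈ a = linear (a 0F ∷ a 1F ∷ []) (y′ ∷ d ∷ x ∷ y ∷ z ∷ []) (λ a₀ a₁ y′ d x y z →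
      y ⊕ (a₀ ⊙ z ⊕ a₁ ⊙ d) ⊜
      con (+ 0) ⊙ y′ ⊕ (a₁ ⊙ d ⊕ (con (+ 0) ⊙ x ⊕ (con (+ 1) ⊙ y ⊕ (a₀ ⊙ z ⊕ 𝟎))))) ≡.refl

    -- Equal transversal points put both blocks through x and T r, so they coincide and e a′ is a
    -- combination of T r, x, e a. Comparing y′- and y-coordinates gives the coefficients 0 at T r
    -- and 1 at e a, and then a = a′.
    transversal-injective : ∀ {a a′ r r′} → T r ∈ᴷ block (xe a) → T r′ ∈ᴷ block (xe a′) →
                            r ≋ r′ → a ≋ a′
    transversal-injective {a} {a′} {r} {r′} T∈ T′∈ r≋r′ = λ where
        0F → sym (trans (eqs 4F) (trans (+-cong (trans (*-congʳ g₀≈0) (zeroˡ _))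
            (trans (*-congʳ g₂≈1) (*-identityˡ _))) (+-identityˡ _)))
        1F → sym (trans (eqs 1F) (trans (+-cong (trans (*-congʳ g₀≈0) (zeroˡ _))
            (trans (*-congʳ g₂≈1) (*-identityˡ _))) (+-identityˡ _)))
      where
      C = block (xe a)
      e′∈C : e a′ ∈ᴷ C
      e′∈C = block-unique {B = block (xe a′)} {C = C} (∉H⇒pair (T∉H r)) (block-D (xe a′)) (block-D (xe a))
        (block∋ˡ (xe a′))
        (KSubspace.respects (block (xe a′))
            (+ᴹ-congˡ (+ᴹ-cong (*ₗ-cong (sym (r≋r′ 0F)) ≈ᴹ-refl) (*ₗ-cong (sym (r≋r′ 1F)) ≈ᴹ-refl))) T′∈)
        (block∋ˡ (xe a)) T∈ (block∋ʳ (xe a′))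
      combination = independent-spans C (∉H⇒extends (T∉H r) (e∈H a) (xe a))
        (λ { 0F → T∈ ; 1F → block∋ˡ (xe a) ; 2F → block∋ʳ (xe a) }) e′∈C
      g = proj₁ combination
      eqs : ∀ i → e-coordinates a′ i ≈ (g 0F ∷ (g 0F * r 1F + g 2F * a 1F) ∷ g 1F ∷ g
          2F ∷ (g 0F * r 0F + g 2F * a 0F) ∷ []) i
      eqs = lc-injective ind (≈ᴹ-trans (≈ᴹ-sym (e≈ a′)) (≈ᴹ-trans (proj₂ combination)
        (linear (g 0F ∷ g 1F ∷ g 2F ∷ a 0F ∷ a 1F ∷ r 0F ∷ r 1F ∷ []) (y′ ∷ d ∷ x ∷ y ∷ z ∷ [])
          (λ g₀ g₁ g₂ a₀ a₁ r₀ r₁ y′ d x y z →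
            g₀ ⊙ (y′ ⊕ (r₀ ⊙ z ⊕ r₁ ⊙ d)) ⊕ (g₁ ⊙ x ⊕ (g₂ ⊙ (y ⊕ (a₀ ⊙ z ⊕ a₁ ⊙ d)) ⊕ 𝟎)) ⊜
            g₀ ⊙ y′ ⊕ ((g₀ :* r₁ :+ g₂ :* a₁) ⊙ d
                ⊕ (g₁ ⊙ x ⊕ (g₂ ⊙ y ⊕ ((g₀ :* r₀ :+ g₂ :* a₀) ⊙ z ⊕ 𝟎))))) ≡.refl)))
      g₀≈0 = sym (eqs 0F)
      g₂≈1 = sym (eqs 3F)

    -- Otherwise the block would be `block xz` = ⟨y′ + d, x, z⟩, whose vectors have y-coordinate 0,
    -- whereas e a has y-coordinate 1.
    transversal-misses : ∀ {a r} → T r ∈ᴷ block (xe a) → ¬ (r ≋ (0# ∷ 1# ∷ []))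
    transversal-misses {a} {r} T∈ r≋01 = 1≉0 1<q (eqs 3F)
      where
      C = block (xe a)
      T≈ : T r ≈ᴹ y′ +ᴹ d
      T≈ = ≈ᴹ-trans (+ᴹ-congˡ (+ᴹ-cong (*ₗ-cong (r≋01 0F) ≈ᴹ-refl) (*ₗ-cong (r≋01 1F) ≈ᴹ-refl)))
        (linear [] (y′ ∷ d ∷ z ∷ []) (λ y′ d z → y′ ⊕ (con (+ 0) ⊙ z ⊕ con (+ 1) ⊙ d) ⊜ y′ ⊕ d) ≡.refl)
      z′∉H : ¬ ((y′ +ᴹ d) ∈ᴷ H)
      z′∉H = T∉H r ∘ H.respects (≈ᴹ-sym T≈)
      e∈ : e a ∈ᴷ block xz
      e∈ = block-unique {B = C} {C = block xz} (∉H⇒pair (T∉H r)) (block-D (xe a)) (block-D xz)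
        (block∋ˡ (xe a)) T∈ (block∋ˡ xz) (KSubspace.respects (block xz) (≈ᴹ-sym T≈) z′∈) (block∋ʳ (xe a))
      combination = independent-spans (block xz) (∉H⇒extends z′∉H z∈H xz)
        (λ { 0F → z′∈ ; 1F → block∋ˡ xz ; 2F → block∋ʳ xz }) e∈
      g = proj₁ combination
      eqs : ∀ i → e-coordinates a i ≈ (g 0F ∷ g 0F ∷ g 1F ∷ 0# ∷ g 2F ∷ []) i
      eqs = lc-injective ind (≈ᴹ-trans (≈ᴹ-sym (e≈ a)) (≈ᴹ-trans (proj₂ combination)
        (linear (g 0F ∷ g 1F ∷ g 2F ∷ []) (y′ ∷ d ∷ x ∷ y ∷ z ∷ [])
          (λ g₀ g₁ g₂ y′ d x y z →
            g₀ ⊙ (y′ ⊕ d) ⊕ (g₁ ⊙ x ⊕ (g₂ ⊙ z ⊕ 𝟎)) ⊜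
            g₀ ⊙ y′ ⊕ (g₀ ⊙ d ⊕ (g₁ ⊙ x ⊕ (con (+ 0) ⊙ y ⊕ (g₂ ⊙ z ⊕ 𝟎))))) ≡.refl)))

    not-all-transversal : ¬ (∀ (k : Fin (q ^ 2)) → ∃[ r ] T r ∈ᴷ block (xe (tuple k)))
    not-all-transversal f =
      let k , fk≋01 = injective⇒surjective (λ k → proj₁ (f k))
            (λ {k} {l} fk≋fl → tuple-injective {2} {k} {l} (transversal-injective {tuple k} {tuple l}
                {proj₁ (f k)} {proj₁ (f l)} (proj₂ (f k)) (proj₂ (f l)) fk≋fl))
            (0# ∷ 1# ∷ [])
      in transversal-misses {tuple k} {proj₁ (f k)} (proj₂ (f k)) fk≋01

    e-cong : ∀ {a b} → a ≋ b → e a ≈ᴹ e b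
    e-cong a≋b = +ᴹ-congˡ (+ᴹ-cong (*ₗ-cong (a≋b 0F) ≈ᴹ-refl) (*ₗ-cong (a≋b 1F) ≈ᴹ-refl))

    some-e-perpendicular : ∃[ a ] x ⟂ e a
    some-e-perpendicular = decidable-stable
      (∃-tuple? (λ a≋b → ⟂-resp (e-cong a≋b)) (λ a → x ⟂? e a))
      λ none → not-all-transversal λ k → transversal (tuple k) λ x⟂e → none (tuple k , x⟂e)

    module _ (a : Vector Carrier 2) (x⟂e : x ⟂ e a) (a₁≉0 : ¬ (a 1F ≈ 0#))
             {t} (t∈C : t ∈ᴷ block (xe a)) (txe : Independent (t ∷ x ∷ e a ∷ []))
             (c : Vector Carrier 5) (t≈ : t ≈ᴹ lc c basis) where

      private
        C = block (xe a)
        module C = KSubspace C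

        C≤H : C ≤ H
        C≤H = block⊆H x⟂e (xe a)

        -- Modulo x, the block of e a is a line of the plane ⟨y,z,d⟩ and meets the line ⟨y,z⟩. The
        -- meeting point is g y + h z, obtained from t and e a by eliminating d.
        g h : Carrier
        g = a 1F * c 3F - c 1F
        h = a 1F * c 4F - c 1F * a 0F

        u w : Carrierᴹ
        u = a 1F *ₗ t +ᴹ ((- (a 1F * c 2F)) *ₗ x +ᴹ (- c 1F) *ₗ e a)
        w = g *ₗ y +ᴹ h *ₗ z

        c₀≈0 : c 0F ≈ 0#
        c₀≈0 = leading≈0 c (H.respects t≈ (C≤H t∈C))

        u≈w : u ≈ᴹ w
        u≈w = begin
          u
            ≈⟨ +ᴹ-congʳ (*ₗ-cong refl t≈) ⟩
          a 1F *ₗ lc c basis +ᴹ ((- (a 1F * c 2F)) *ₗ x +ᴹ (- c 1F) *ₗ e a)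
            ≈⟨ linear (c 0F ∷ c 1F ∷ c 2F ∷ c 3F ∷ c 4F ∷ a 0F ∷ a 1F ∷ []) (y′ ∷ d ∷ x ∷ y ∷ z ∷ [])
                 (λ c₀ c₁ c₂ c₃ c₄ a₀ a₁ y′ d x y z →
                   a₁ ⊙ (c₀ ⊙ y′ ⊕ (c₁ ⊙ d ⊕ (c₂ ⊙ x ⊕ (c₃ ⊙ y ⊕ (c₄ ⊙ z ⊕ 𝟎)))))
                     ⊕ ((:- (a₁ :* c₂)) ⊙ x ⊕ (:- c₁) ⊙ (y ⊕ (a₀ ⊙ z ⊕ a₁ ⊙ d))) ⊜
                   (a₁ :* c₀) ⊙ y′ ⊕ ((a₁ :* c₃ :- c₁) ⊙ y ⊕ (a₁ :* c₄ :- c₁ :* a₀) ⊙ z)) ≡.refl ⟩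
          (a 1F * c 0F) *ₗ y′ +ᴹ w
            ≈⟨ drop-zeroˡ y′ w (trans (*-congˡ c₀≈0) (zeroʳ _)) ⟩
          w ∎
          where open ≈-Reasoning ≈ᴹ-setoid

        x⟂w : x ⟂ w
        x⟂w = ⟂-resp u≈w (⟂-block C (block-D (xe a)) C≤H (block∋ˡ (xe a))
          (C.+-closed (C.*ₗ-closed (a 1F) t∈C) (C.+-closed
            (C.*ₗ-closed (- (a 1F * c 2F)) (block∋ˡ (xe a))) (C.*ₗ-closed (- c 1F) (block∋ʳ (xe a))))))

        u≉0 : ¬ (u ≈ᴹ 0ᴹ)
        u≉0 u≈0 = a₁≉0 (only-trivially txe (a 1F ∷ - (a 1F * c 2F) ∷ - c 1F ∷ [])
          (≈ᴹ-trans (+ᴹ-congˡ (+ᴹ-congˡ (+ᴹ-identityʳ _))) u≈0) 0F)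

        -- With g = 0 the nonzero vector u would be a multiple of z, contrary to x not being
        -- perpendicular to z.
        g≉0 : ¬ (g ≈ 0#)
        g≉0 g≈0 = u≉0 (≈ᴹ-trans u≈w (≈ᴹ-trans w≈hz
          (scale-zero z h≈0)))
          where
          w≈hz : w ≈ᴹ h *ₗ z
          w≈hz = drop-zeroˡ y (h *ₗ z) g≈0
          h≈0 : h ≈ 0#
          h≈0 = decidable-stable (h ≟ 0#) λ h≉0 → ¬x⟂z (⟂-unscale h≉0 (⟂-resp w≈hz x⟂w))

      eliminate-d : ∃[ k ] x ⟂ (y +ᴹ k *ₗ z)
      eliminate-d = g ⁻¹⟨ g≉0 ⟩ * h , ⟂-resp (≈ᴹ-trans
          (linear (g ∷ g ⁻¹⟨ g≉0 ⟩ ∷ h ∷ []) (y ∷ z ∷ []) (λ g l h y z →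
            l ⊙ (g ⊙ y ⊕ h ⊙ z) ⊜ (g :* l) ⊙ y ⊕ (l :* h) ⊙ z) ≡.refl)
          (+ᴹ-congʳ (scale-one y (inverseʳ⟨ g≉0 ⟩))))
        (⟂-* (g ⁻¹⟨ g≉0 ⟩) x⟂w)

    from-point : ∀ a → x ⟂ e a → Dec (a 1F ≈ 0#) → ∃[ k ] x ⟂ (y +ᴹ k *ₗ z)
    from-point a x⟂e (yes a₁≈0) = a 0F , ⟂-resp (+ᴹ-congˡ (≈ᴹ-trans
      (+ᴹ-congˡ (scale-zero d a₁≈0)) (+ᴹ-identityʳ _))) x⟂e
    from-point a x⟂e (no a₁≉0) =
      let t , t∈C , txe , _ = third (block (xe a)) (xe a) (block∋ˡ (xe a)) (block∋ʳ (xe a))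
          c , t≈ = ⊆span (block-xe⊆S a t∈C)
      in eliminate-d a x⟂e a₁≉0 t∈C txe c t≈

    disjoint-case : ∃[ k ] x ⟂ (y +ᴹ k *ₗ z)
    disjoint-case = let a , x⟂e = some-e-perpendicular in from-point a x⟂e (a 1F ≟ 0#)

  ⟂-projection : ∀ {x y z} → x ∈ᴷ H → y ∈ᴷ H → z ∈ᴷ H → ¬ (x ⟂ z) → ∃[ k ] x ⟂ (y +ᴹ k *ₗ z)
  ⟂-projection {x} {y} {z} x∈H y∈H z∈H ¬x⟂z = by-cases (x ⟂? y)
    where
    Goal : Set
    Goal = ∃[ k ] x ⟂ (y +ᴹ k *ₗ z)

    xz : Pair x z
    xz = ¬⟂⇒pair ¬x⟂z

    module _ {y′} (y′∉H : ¬ (y′ ∈ᴷ H)) (xy : Pair x y) (y′∈ : y′ ∈ᴷ block xy) where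

      private
        Bxy = subspace (block xy)
        Bxz = subspace (block xz)

      y′xy : Independent (y′ ∷ x ∷ y ∷ [])
      y′xy = extend xy (y′∉H ∘ span-least H.subspace (x ∷ y ∷ []) λ { 0F → x∈H ; 1F → y∈H })

      y′xy⊆B : ∀ i → (y′ ∷ x ∷ y ∷ []) i ∈ᴷ block xy
      y′xy⊆B = λ { 0F → y′∈ ; 1F → block∋ˡ xy ; 2F → block∋ʳ xy }

      -- The block meets H exactly in ⟨x,y⟩, so z = c₁ x + c₂ y with c₂ ≠ 0, and y - c₂⁻¹ z is a
      -- multiple of x.
      same-block : z ∈ span (y′ ∷ x ∷ y ∷ []) → Goal
      same-block (c , z≈) = - c₂⁻¹ , ⟂-resp (≈ᴹ-sym combination) (⟂-* (- c₂⁻¹ * c 1F) ⟂-refl)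
        where
        open ≈-Reasoning ≈ᴹ-setoid
        z-c₀y′ : z ≈ᴹ c 0F *ₗ y′ +ᴹ (c 1F *ₗ x +ᴹ c 2F *ₗ y)
        z-c₀y′ = ≈ᴹ-trans z≈ (+ᴹ-congˡ (+ᴹ-congˡ (+ᴹ-identityʳ _)))
        c₀≈0 : c 0F ≈ 0#
        c₀≈0 = decidable-stable (c 0F ≟ 0#) λ c₀≉0 → y′∉H (unscale H.subspace c₀≉0 (H.respects
          (≈ᴹ-trans (+ᴹ-congʳ z-c₀y′) (linear (c 0F ∷ []) (y′ ∷ c 1F *ₗ x +ᴹ c 2F *ₗ y ∷ [])
            (λ c y′ r → (c ⊙ y′ ⊕ r) ⊕ ⊝ r ⊜ c ⊙ y′) ≡.refl))
          (H.+-closed z∈H (-‿closed H.subspace (H.+-closed (H.*ₗ-closed (c 1F) x∈H)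
              (H.*ₗ-closed (c 2F) y∈H))))))
        z≈c₁x+c₂y : z ≈ᴹ c 1F *ₗ x +ᴹ c 2F *ₗ y
        z≈c₁x+c₂y = ≈ᴹ-trans z-c₀y′ (drop-zeroˡ y′ (c 1F *ₗ x +ᴹ c 2F *ₗ y) c₀≈0)
        c₂≉0 : ¬ (c 2F ≈ 0#)
        c₂≉0 c₂≈0 = head∉tail (independent-swap xz) ((c 1F ∷ []) ,
          ≈ᴹ-trans z≈c₁x+c₂y (+ᴹ-congˡ (scale-zero y c₂≈0)))
        c₂⁻¹ : Carrier
        c₂⁻¹ = c 2F ⁻¹⟨ c₂≉0 ⟩
        combination : y +ᴹ (- c₂⁻¹) *ₗ z ≈ᴹ (- c₂⁻¹ * c 1F) *ₗ x
        combination = begin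
          y +ᴹ (- c₂⁻¹) *ₗ z
            ≈⟨ +ᴹ-congˡ (*ₗ-cong refl z≈c₁x+c₂y) ⟩
          y +ᴹ (- c₂⁻¹) *ₗ (c 1F *ₗ x +ᴹ c 2F *ₗ y)
            ≈⟨ linear (c₂⁻¹ ∷ c 1F ∷ c 2F ∷ []) (x ∷ y ∷ []) (λ l c₁ c₂ x y →
                 y ⊕ (:- l) ⊙ (c₁ ⊙ x ⊕ c₂ ⊙ y) ⊜ (:- l :* c₁) ⊙ x ⊕ (con (+ 1) :- c₂ :* l) ⊙ y) ≡.refl ⟩
          (- c₂⁻¹ * c 1F) *ₗ x +ᴹ (1# - c 2F * c₂⁻¹) *ₗ y
            ≈⟨ +ᴹ-congˡ (≈ᴹ-trans (*ₗ-cong (trans (+-congˡ (-‿cong (inverseʳ⟨ c₂≉0 ⟩))) (-‿inverseʳ 1#))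
                ≈ᴹ-refl) (*ₗ-zeroˡ y)) ⟩
          (- c₂⁻¹ * c 1F) *ₗ x +ᴹ 0ᴹ
            ≈⟨ +ᴹ-identityʳ _ ⟩
          (- c₂⁻¹ * c 1F) *ₗ x ∎

      module _ (z∉ : z ∉ Bxy) {d} (d∈H : d ∈ᴷ H) (z′∈ : (y′ +ᴹ d) ∈ᴷ block xz) where

        private
          basis : Vector Carrierᴹ 5
          basis = y′ ∷ d ∷ x ∷ y ∷ z ∷ []

        z′∉H : ¬ ((y′ +ᴹ d) ∈ᴷ H)
        z′∉H z′∈H = y′∉H (H.respects (linear [] (y′ ∷ d ∷ []) (λ y′ d → (y′ ⊕ d) ⊕ ⊝ d ⊜ y′) ≡.refl)
          (H.+-closed z′∈H (-‿closed H.subspace d∈H)))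

        z′∉ : (y′ +ᴹ d) ∉ span (x ∷ z ∷ [])
        z′∉ = z′∉H ∘ span-least H.subspace (x ∷ z ∷ []) λ { 0F → x∈H ; 1F → z∈H }

        z′∈span : (y′ +ᴹ d) ∈ span basis
        z′∈span = Subspace.+-closed (span basis) (∈span basis 0F) (∈span basis 1F)

        -- `grow` gives independence with y′ + d in the role of d; the change to d is made by
        -- comparing spans.
        basis-independent : Independent basis
        basis-independent = independent-by
          (grow Bxy (block-closed xy) (block∋ˡ xy) y′xy y′xy⊆B z∉ xz z′∈ z′∉) λ where
            0F → z′∈span
            1F → ∈span basis 4F
            2F → ∈span basis 0F
            3F → ∈span basis 2F
            4F → ∈span basis 3F

        ⊆span : Bxy +ₛ Bxz ≤ₛ span basis
        ⊆span (b , c , b∈ , c∈ , u≈) = Subspace.respects (span basis) (≈ᴹ-sym u≈)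
          (Subspace.+-closed (span basis)
            (span-least (span basis) (y′ ∷ x ∷ y ∷ [])
              (λ { 0F → ∈span basis 0F ; 1F → ∈span basis 2F ; 2F → ∈span basis 3F })
              (independent-spans (block xy) y′xy y′xy⊆B b∈))
            (span-least (span basis) (y′ +ᴹ d ∷ x ∷ z ∷ [])
              (λ { 0F → z′∈span ; 1F → ∈span basis 2F ; 2F → ∈span basis 4F })
              (independent-spans (block xz) {v = y′ +ᴹ d ∷ x ∷ z ∷ []} (extend xz z′∉)
                (λ { 0F → z′∈ ; 1F → block∋ˡ xz ; 2F → block∋ʳ xz }) c∈)))

        distinct-blocks : Goal
        distinct-blocks = disjoint-case x∈H y∈H z∈H d∈H y′∉H xy xz ¬x⟂z basis-independent y′∈ z′∈ ⊆span

      by-blocks : Dec (z ∈ Bxy) → ∃[ z″ ] z″ ∈ Bxz × ¬ (z″ ∈ᴷ H) → Goal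
      by-blocks (yes z∈) _ = same-block (independent-spans (block xy) y′xy y′xy⊆B z∈)
      by-blocks (no z∉) (z″ , z″∈ , z″∉H) =
        -- Scaling z″ into the coset of y′ modulo H places the difference d of the two transversal
        -- vectors in H.
        let m , d , d∈H , mz″≈ = rescale-modulo-H y′∉H z″∉H
        in distinct-blocks z∉ d∈H (KSubspace.respects (block xz) mz″≈
            (KSubspace.*ₗ-closed (block xz) m z″∈))

    by-cases : Dec (x ⟂ y) → Goal
    by-cases (yes x⟂y) = 0# , ⟂-resp
      (linear [] (y ∷ z ∷ []) (λ y z → y ⊜ y ⊕ con (+ 0) ⊙ z) ≡.refl) x⟂y
    by-cases (no ¬x⟂y) =
      let xy = ¬⟂⇒pair ¬x⟂y
          y′ , y′∈ , y′∉H = ¬⟂⇒∉H ¬x⟂y xy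
      in by-blocks y′∉H xy y′∈ (_∈?_ (block xy) z) (¬⟂⇒∉H ¬x⟂z xz)

-- Transport from the hyperplane to F⁶.

module HyperplaneCoordinates {q : ℕ} (F : Field) (order : HasOrder F q) (1<q : 1 < q)
  (V : Geometry.VectorSpace F) (dim : Geometry.HasDimension F V 7)
  {d : Level} (D : Pred (Geometry.KSubspace F V 3) d) (fano : Geometry.IsFanoAnalog F D)
  (H : Geometry.KSubspace F V 6)
  (α : ∀ (P : Geometry.ProjectivePoint F V) → Geometry._≤_ F P H → Geometry.IsαPoint F D P) where

  open CommutativeRing (commutativeRingOf F) hiding (zero)
  open Geometry F
  open LeftModule V
  open FiniteField F order
  open CoordinateSpaces F
  open LinearAlgebra F order 1<q V (decidable-equality F order V dim)
  open KSubspace using (subspace)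
  open Blocks F order 1<q V dim D fano
  open Perpendicularity F order 1<q V dim D fano H α
  open Projection F order 1<q V dim D fano H α

  F⁶ : VectorSpace
  F⁶ = coordinateSpace 6

  private
    module C = LinearAlgebra F order 1<q F⁶ (decidable-equality F order F⁶ (standard-basis 6))
    open LeftModule F⁶ using () renaming (_≈ᴹ_ to _≈⁶_; _+ᴹ_ to _+⁶_; _*ₗ_ to _*⁶_; 0ᴹ to 0⁶)

    h : Vector Carrierᴹ 6
    h = vectors H

    h-ind : Independent h
    h-ind = independent (Basis.independent (KSubspace.basis H))

  -- Coordinates turn the subspace H into a vector space of its own, so that a perpendicularity
  -- valid only for vectors of H becomes total.
  ι : Vector Carrier 6 → Carrierᴹ
  ι a = lc a h

  ι∈H : ∀ a → ι a ∈ᴷ H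
  ι∈H = lc-closed H.subspace h (vectors∈ H)

  ι-cong : ∀ {a b} → a ≈⁶ b → ι a ≈ᴹ ι b
  ι-cong a≈b = lc-congˡ {v = h} a≈b

  ι-injective : ∀ {a b} → ι a ≈ᴹ ι b → a ≈⁶ b
  ι-injective = lc-injective h-ind

  ι-isLinear : IsLinear F {F⁶} {V} ι
  ι-isLinear = record
    { cong    = ι-cong
    ; linearity = λ a b x y → ≈ᴹ-trans (lc-+ (a *⁶ x) (b *⁶ y) h) (+ᴹ-cong (lc-* a x h) (lc-* b y h))
    }

  open IsLinear ι-isLinear using (preimage) renaming (additive to ι-+; homogeneous to ι-*)

  ι-lc : ∀ {n} a (w : Vector (Vector Carrier 6) n) → ι (C.lc a w) ≈ᴹ lc a (λ i → ι (w i))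
  ι-lc {zero}  a w = lc-0 h
  ι-lc {suc n} a w = ≈ᴹ-trans (ι-+ (a zero *⁶ w zero) (C.lc (tail a) (tail w)))
    (+ᴹ-cong (ι-* (a zero) (w zero)) (ι-lc (tail a) (tail w)))

  coordinates : ∀ {x} → x ∈ᴷ H → Vector Carrier 6
  coordinates x∈H = proj₁ (Basis.spanning (KSubspace.basis H) x∈H)

  ι-coordinates : ∀ {x} (x∈H : x ∈ᴷ H) → x ≈ᴹ ι (coordinates x∈H)
  ι-coordinates x∈H = proj₂ (Basis.spanning (KSubspace.basis H) x∈H)

  infix 4 _⟂ᴴ_
  record _⟂ᴴ_ (a b : Vector Carrier 6) : Set where
    constructor lift⟂
    field ι⟂ : ι a ⟂ ι b

  open _⟂ᴴ_

  orthogonality : Orthogonality F F⁶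
  orthogonality = record
    { _⟂_       = _⟂ᴴ_
    ; ⟂-resp    = λ y≈z (lift⟂ p) → lift⟂ (⟂-resp (ι-cong y≈z) p)
    ; ⟂-refl    = lift⟂ ⟂-refl
    ; ⟂-sym     = λ (lift⟂ p) → lift⟂ (⟂-sym p)
    ; ⟂-+       = λ {x} {y} {z} (lift⟂ p) (lift⟂ p′) → lift⟂ (⟂-resp (≈ᴹ-sym (ι-+ y z)) (⟂-+ (ι∈H x) p p′))
    ; ⟂-*       = λ k {x} {y} (lift⟂ p) → lift⟂ (⟂-resp (≈ᴹ-sym (ι-* k y)) (⟂-* k p))
    ; ⟂-project = λ {x} {z} ¬p y →
        let k , p = ⟂-projection (ι∈H x) (ι∈H y) (ι∈H z) (λ p → ¬p (lift⟂ p))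
        in k , lift⟂ (⟂-resp (≈ᴹ-sym (≈ᴹ-trans (ι-+ y (k *⁶ z)) (+ᴹ-congˡ (ι-* k z)))) p)
    }

  open TotallyIsotropicPlanes F order 1<q F⁶ (standard-basis 6) orthogonality
    using (PlaneSystem; symplectic-basis; module SpreadFamily) renaming (Pair to Pair⁶)
  open HyperbolicPairs F order 1<q F⁶ (decidable-equality F order F⁶ (standard-basis 6)) orthogonality
    using (NonDegenerate)

  ⟂ᴴ-nondegenerate : NonDegenerate (wholeSpace F⁶)
  ⟂ᴴ-nondegenerate {a} _ a≉0 =
    let y , y∈H , ¬p = ⟂-nondegenerate (ι∈H a)
            (λ ιa≈0 → a≉0 (ι-injective {a} {0⁶} (≈ᴹ-trans ιa≈0 (≈ᴹ-sym (lc-0 h)))))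
    in coordinates y∈H , _ , λ (lift⟂ p) → ¬p (⟂-resp (≈ᴹ-sym (ι-coordinates y∈H)) p)

  ι-pair : ∀ {a b} → Pair⁶ a b → Pair (ι a) (ι b)
  ι-pair {a} {b} ab = independent λ c eq → C.only-trivially ab c
    (ι-injective (≈ᴹ-trans (ι-lc c (a ∷ b ∷ [])) (≈ᴹ-trans eq (≈ᴹ-sym (lc-0 h)))))

  module _ {B : KSubspace V 3} (B≤H : B ≤ H) where

    private
      b : Vector (Vector Carrier 6) 3
      b i = coordinates (B≤H (vectors∈ B i))

      ιb≈ : ∀ i → ι (b i) ≈ᴹ vectors B i
      ιb≈ i = ≈ᴹ-sym (ι-coordinates (B≤H (vectors∈ B i)))

      ι-lc-b : ∀ a → ι (C.lc a b) ≈ᴹ lc a (vectors B)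
      ι-lc-b a = ≈ᴹ-trans (ι-lc a b) (lc-cong {a = a} {b = a} {u = λ i → ι (b i)} {v = vectors B}
          (λ _ → refl) ιb≈)

    pullback : KSubspace F⁶ 3
    pullback = record
      { subspace = preimage (subspace B)
      ; basis = record
        { vectors     = b
        ; members     = λ i → KSubspace.respects B (≈ᴹ-sym (ιb≈ i)) (vectors∈ B i)
        ; independent = λ a eq → Basis.independent (KSubspace.basis B) a
            (≈ᴹ-trans (≈ᴹ-sym (ι-lc-b a)) (≈ᴹ-trans (ι-cong {C.lc a b} {0⁶} eq) (lc-0 h)))
        ; spanning    = λ {x} x∈ → let a , x≈ = Basis.spanning (KSubspace.basis B) x∈ in
            a , ι-injective (≈ᴹ-trans x≈ (≈ᴹ-sym (ι-lc-b a)))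
        }
      }

  plane-system : PlaneSystem
  plane-system = record
    { plane     = λ {x} {y} xy p → pullback {block (ι-pair {x} {y} xy)} (block⊆H (ι⟂ p) (ι-pair {x} {y} xy))
    ; ∋ˡ        = λ {x} {y} xy _ → block∋ˡ (ι-pair {x} {y} xy)
    ; ∋ʳ        = λ {x} {y} xy _ → block∋ʳ (ι-pair {x} {y} xy)
    ; isotropic = λ {x} {y} xy p u∈ v∈ →
        lift⟂ (⟂-block (block (ι-pair {x} {y} xy)) (block-D (ι-pair {x} {y} xy))
                    (block⊆H (ι⟂ p) (ι-pair {x} {y} xy)) u∈ v∈)
    ; unique    = λ {x} {y} {u} {v} xy _ uv _ u∈ v∈ →
        block-unique {B = block (ι-pair {x} {y} xy)} {C = block (ι-pair {u} {v} uv)} (ι-pair {u} {v} uv)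
          (block-D (ι-pair {x} {y} xy)) (block-D (ι-pair {u} {v} uv)) u∈ v∈
          (block∋ˡ (ι-pair {u} {v} uv)) (block∋ʳ (ι-pair {u} {v} uv))
    }

  fano⇒lines-partitionable : IncidenceStructure.LinesPartitionableIntoSpreads symplecticQuadrangle
  fano⇒lines-partitionable = SpreadFamily.lines-partitionable
    plane-system (symplectic-basis λ {x} → ⟂ᴴ-nondegenerate {x})

-- Point-line duality and the algebra of the Klein correspondence.

module PointLineDuality (𝒲 𝒬 : IncidenceStructure) where

  private
    module W = IncidenceStructure 𝒲
    module Q = IncidenceStructure 𝒬
    module WL = Setoid W.lines
    module QP = Setoid Q.points

  -- Parts of a partition are carried along the bijection between lines of 𝒲 and points of 𝒬. The
  -- other kind of element is only tested for incidence, so each such element is given a counterpart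
  -- with the same incidences.
  record Duality : Set₁ where
    field
      line→point      : W.Line → Q.Point
      point→line      : Q.Point → W.Line
      line→point-cong : ∀ {l l′} → l W.≈ₗ l′ → line→point l Q.≈ₚ line→point l′
      point→line-cong : ∀ {x x′} → x Q.≈ₚ x′ → point→line x W.≈ₗ point→line x′
      line-point-line : ∀ l → point→line (line→point l) W.≈ₗ l
      point-line-point : ∀ x → line→point (point→line x) Q.≈ₚ x
      dual-line       : W.Point → Q.Line
      dual-line-I     : ∀ p l → (p W.I l → line→point l Q.I dual-line p) × (line→point l Q.I dual-line p →
          p W.I l)
      dual-point      : Q.Line → W.Point
      dual-point-I    : ∀ m l → (dual-point m W.I l → line→point l Q.I m) × (line→point l Q.I m →
          dual-point m W.I l)
      I-respˡ         : ∀ {x x′} m → x Q.≈ₚ x′ → x Q.I m → x′ Q.I m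

  spreads⇔ovoids : Duality → W.LinesPartitionableIntoSpreads ⇔ Q.PointsPartitionableIntoOvoids
  spreads⇔ovoids duality = mk⇔ to from
    where
    open Duality duality
    to : W.LinesPartitionableIntoSpreads → Q.PointsPartitionableIntoOvoids
    to (n , S , spread , partition) = n , (λ i x → S i (point→line x)) ,
      (λ i → (λ {x} {y} x≈y → proj₁ (spread i) {point→line x} {point→line y}
          (point→line-cong {x} {y} x≈y)) , λ m →
        let l , (Sl , p-I-l) , l-unique = proj₂ (spread i) (dual-point m) in
        line→point l ,
        (proj₁ (spread i) {l} {point→line (line→point l)} (WL.sym {point→line (line→point l)} {l}
            (line-point-line l)) Sl ,
         proj₁ (dual-point-I m l) p-I-l) ,
        λ {x} (Sx , x-I-m) →
          QP.trans {line→point l} {line→point (point→line x)} {x}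
            (line→point-cong {l} {point→line x}
                (l-unique {point→line x} (Sx , proj₂ (dual-point-I m (point→line x))
              (I-respˡ {x} {line→point (point→line x)} m
                (QP.sym {line→point (point→line x)} {x} (point-line-point x)) x-I-m))))
            (point-line-point x)) ,
      λ x → partition (point→line x)
    from : Q.PointsPartitionableIntoOvoids → W.LinesPartitionableIntoSpreads
    from (n , O , ovoid , partition) = n , (λ i l → O i (line→point l)) ,
      (λ i → (λ {l} {l′} l≈l′ → proj₁ (ovoid i) {line→point l} {line→point l′}
          (line→point-cong {l} {l′} l≈l′)) , λ p →
        let x , (Ox , x-I-m) , x-unique = proj₂ (ovoid i) (dual-line p)
            x≈ = QP.sym {line→point (point→line x)} {x} (point-line-point x) in
        point→line x ,
        (proj₁ (ovoid i) {x} {line→point (point→line x)} x≈ Ox ,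
         proj₂ (dual-line-I p (point→line x)) (I-respˡ {x} {line→point (point→line x)} (dual-line p) x≈
             x-I-m)) ,
        λ {l} (Ol , p-I-l) →
          WL.trans {point→line x} {point→line (line→point l)} {l}
            (point→line-cong {x} {line→point l}
                (x-unique {line→point l} (Ol , proj₁ (dual-line-I p l) p-I-l)))
            (line-point-line l)) ,
      λ l → partition (line→point l)

-- The Plücker coordinates of a line of W(q) satisfy p₁₂ + p₃₄ = 0; dropping p₃₄ turns the
-- Klein quadric into Q(4,q).  A point z of PG(4,q) acts on F⁴ by a matrix z ⌟_ with
-- z ⌟ (z ⌟ v) = Q(z) v, and on Q(4,q) its kernel is the line of W(q) represented by z.
module Klein {q : ℕ} (F : Field) (order : HasOrder F q) (1<q : 1 < q) where

  open CommutativeRing (commutativeRingOf F) hiding (zero)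
  open Geometry F
  open FiniteField F order
  open CoordinateSpaces F
  open SymplecticSpace F order 1<q
  open IntegerCoefficientSolver (commutativeRingOf F)
    using (Polynomial; var; components; variables; _:*_; _:+_; con; :-_; _:-_; solve; _:=_)

  F⁵ : VectorSpace
  F⁵ = coordinateSpace 5

  open LeftModule F⁴ renaming (Carrierᴹ to V⁴; _≈ᴹ_ to _≈⁴_; _+ᴹ_ to _+⁴_; _*ₗ_ to _*⁴_; 0ᴹ to 0⁴) using ()
  open LeftModule F⁵ renaming (Carrierᴹ to V⁵; _≈ᴹ_ to _≈⁵_; _+ᴹ_ to _+⁵_; _*ₗ_ to _*⁵_; 0ᴹ to 0⁵) using ()

  Q : V⁵ → Carrier
  Q = parabolicForm

  -- The coordinates are p₀₂, p₁₃, p₀₃, p₂₁, p₀₁. In this order and with these signs the Plücker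
  -- relation with p₂₃ = - p₀₁ becomes the form Q.
  plücker : V⁴ → V⁴ → V⁵
  plücker x y =
    x 0F * y 2F - x 2F * y 0F ∷ x 1F * y 3F - x 3F * y 1F ∷ x 0F * y 3F - x 3F * y 0F ∷
    x 2F * y 1F - x 1F * y 2F ∷ x 0F * y 1F - x 1F * y 0F ∷ []

  infixr 8 _⌟_
  -- The bilinear map that on z = `plücker x y` with x ⊥ y is v ↦ (β x v) y - (β y v) x, as
  -- `⌟-plücker` confirms.
  _⌟_ : V⁵ → V⁴ → V⁴
  z ⌟ v =
    z 4F * v 0F - z 0F * v 3F + z 2F * v 2F ∷ z 4F * v 1F + z 3F * v 3F + z 1F * v 2F ∷
    z 0F * v 1F + z 3F * v 0F - z 4F * v 2F ∷ z 2F * v 1F - z 1F * v 0F - z 4F * v 3F ∷ []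

  Q-cong : ∀ {z w} → z ≋ w → Q z ≈ Q w
  Q-cong z≋w = +-cong (+-cong (*-cong (z≋w 0F) (z≋w 1F)) (*-cong (z≋w 2F) (z≋w 3F)))
      (*-cong (z≋w 4F) (z≋w 4F))

  ⌟-congˡ : ∀ {z w} v → z ≋ w → (z ⌟ v) ≋ (w ⌟ v)
  ⌟-congˡ v z≋w = λ where
    0F → +-cong (+-cong (*-congʳ (z≋w 4F)) (-‿cong (*-congʳ (z≋w 0F)))) (*-congʳ (z≋w 2F))
    1F → +-cong (+-cong (*-congʳ (z≋w 4F)) (*-congʳ (z≋w 3F))) (*-congʳ (z≋w 1F))
    2F → +-cong (+-cong (*-congʳ (z≋w 0F)) (*-congʳ (z≋w 3F))) (-‿cong (*-congʳ (z≋w 4F)))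
    3F → +-cong (+-cong (*-congʳ (z≋w 2F)) (-‿cong (*-congʳ (z≋w 1F)))) (-‿cong (*-congʳ (z≋w 4F)))

  ⌟-congʳ : ∀ z {v w} → v ≋ w → (z ⌟ v) ≋ (z ⌟ w)
  ⌟-congʳ z v≋w = λ where
    0F → +-cong (+-cong (*-congˡ (v≋w 0F)) (-‿cong (*-congˡ (v≋w 3F)))) (*-congˡ (v≋w 2F))
    1F → +-cong (+-cong (*-congˡ (v≋w 1F)) (*-congˡ (v≋w 3F))) (*-congˡ (v≋w 2F))
    2F → +-cong (+-cong (*-congˡ (v≋w 1F)) (*-congˡ (v≋w 0F))) (-‿cong (*-congˡ (v≋w 2F)))
    3F → +-cong (+-cong (*-congˡ (v≋w 1F)) (-‿cong (*-congˡ (v≋w 0F)))) (-‿cong (*-congˡ (v≋w 3F)))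

  plücker-cong : ∀ {x y x′ y′} → x ≋ x′ → y ≋ y′ → plücker x y ≋ plücker x′ y′
  plücker-cong x≋ y≋ = λ where
      0F → minor 0F 2F
      1F → minor 1F 3F
      2F → minor 0F 3F
      3F → minor 2F 1F
      4F → minor 0F 1F
    where
    minor : ∀ i j → _
    minor i j = +-cong (*-cong (x≋ i) (y≋ j)) (-‿cong (*-cong (x≋ j) (y≋ i)))

  private
    Q′ : ∀ {n} → Vector (Polynomial n) 5 → Polynomial n
    Q′ z = z 0F :* z 1F :+ z 2F :* z 3F :+ z 4F :* z 4F

    β′ : ∀ {n} → Vector (Polynomial n) 4 → Vector (Polynomial n) 4 → Polynomial n
    β′ x y = x 0F :* y 1F :- x 1F :* y 0F :+ x 2F :* y 3F :- x 3F :* y 2F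

    plücker′ : ∀ {n} → Vector (Polynomial n) 4 → Vector (Polynomial n) 4 → Vector (Polynomial n) 5
    plücker′ x y =
      x 0F :* y 2F :- x 2F :* y 0F ∷ x 1F :* y 3F :- x 3F :* y 1F ∷ x 0F :* y 3F :- x 3F :* y 0F ∷
      x 2F :* y 1F :- x 1F :* y 2F ∷ x 0F :* y 1F :- x 1F :* y 0F ∷ []

    infixr 8 _⌟′_
    _⌟′_ : ∀ {n} → Vector (Polynomial n) 5 → Vector (Polynomial n) 4 → Vector (Polynomial n) 4
    z ⌟′ v =
      z 4F :* v 0F :- z 0F :* v 3F :+ z 2F :* v 2F ∷ z 4F :* v 1F :+ z 3F :* v 3F :+ z 1F :* v 2F ∷
      z 0F :* v 1F :+ z 3F :* v 0F :- z 4F :* v 2F ∷ z 2F :* v 1F :- z 1F :* v 0F :- z 4F :* v 3F ∷ []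

  -- The Plücker relation reads p₀₂ p₁₃ + p₀₃ p₂₁ = p₀₁ p₂₃, and p₀₁ + p₂₃ is β x y.
  Q-plücker : ∀ x y → Q (plücker x y) ≈ plücker x y 4F * β x y
  Q-plücker x y = solve 8 (λ x₀ x₁ x₂ x₃ y₀ y₁ y₂ y₃ →
      let x = x₀ ∷ x₁ ∷ x₂ ∷ x₃ ∷ [] ; y = y₀ ∷ y₁ ∷ y₂ ∷ y₃ ∷ [] in
      Q′ (plücker′ x y) := plücker′ x y 4F :* β′ x y) refl
    (x 0F) (x 1F) (x 2F) (x 3F) (y 0F) (y 1F) (y 2F) (y 3F)

  Q-* : ∀ k z → Q (k *⁵ z) ≈ k * k * Q z
  Q-* k z = solve 6 (λ k a b c d e →
      Q′ (k :* a ∷ k :* b ∷ k :* c ∷ k :* d ∷ k :* e ∷ []) := k :* k :* Q′ (a ∷ b ∷ c ∷ d ∷ e ∷ [])) refl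
    k (z 0F) (z 1F) (z 2F) (z 3F) (z 4F)

  ⌟-⌟ : ∀ z v → (z ⌟ z ⌟ v) ≋ (Q z *⁴ v)
  ⌟-⌟ z v = λ { 0F → h 0F ; 1F → h 1F ; 2F → h 2F ; 3F → h 3F }
    where
    h = components (Vec.tabulate z Vec.++ Vec.tabulate v)
      (let z = variables 0 5 4 ; v = variables 5 4 0 in λ i →
        (z ⌟′ z ⌟′ v) i := Q′ z :* v i) ≡.refl

  -- The Clifford relation, the polarisation of `⌟-⌟`: matrices of two points on a totally singular
  -- line anticommute.
  ⌟-polar : ∀ z w v → ((z ⌟ w ⌟ v) +⁴ (w ⌟ z ⌟ v)) ≋ ((Q (z +⁵ w) - Q z - Q w) *⁴ v)
  ⌟-polar z w v = λ { 0F → h 0F ; 1F → h 1F ; 2F → h 2F ; 3F → h 3F }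
    where
    h = components (Vec.tabulate z Vec.++ Vec.tabulate w Vec.++ Vec.tabulate v)
      (let z = variables 0 5 9 ; w = variables 5 5 4 ; v = variables 10 4 0 in λ i →
        (z ⌟′ w ⌟′ v) i :+ (w ⌟′ z ⌟′ v) i := (Q′ (λ i → z i :+ w i) :- Q′ z :- Q′ w) :* v i) ≡.refl

  ⌟-linearˡ : ∀ a b z w v → ((a *⁵ z +⁵ b *⁵ w) ⌟ v) ≋ (a *⁴ (z ⌟ v) +⁴ b *⁴ (w ⌟ v))
  ⌟-linearˡ a b z w v = λ { 0F → h 0F ; 1F → h 1F ; 2F → h 2F ; 3F → h 3F }
    where
    h = components (a Vec.∷ b Vec.∷ (Vec.tabulate z Vec.++ Vec.tabulate w Vec.++ Vec.tabulate v))
      (let a = var 0F ; b = var 1F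
           z = variables 2 5 9 ; w = variables 7 5 4 ; v = variables 12 4 0 in λ i →
        ((λ i → a :* z i :+ b :* w i) ⌟′ v) i := a :* (z ⌟′ v) i :+ b :* (w ⌟′ v) i) ≡.refl

  ⌟-linearʳ : ∀ a b z v w → (z ⌟ (a *⁴ v +⁴ b *⁴ w)) ≋ (a *⁴ (z ⌟ v) +⁴ b *⁴ (z ⌟ w))
  ⌟-linearʳ a b z v w = λ { 0F → h 0F ; 1F → h 1F ; 2F → h 2F ; 3F → h 3F }
    where
    h = components (a Vec.∷ b Vec.∷ (Vec.tabulate z Vec.++ Vec.tabulate v Vec.++ Vec.tabulate w))
      (let a = var 0F ; b = var 1F
           z = variables 2 5 8 ; v = variables 7 4 4 ; w = variables 11 4 0 in λ i →
        (z ⌟′ (λ i → a :* v i :+ b :* w i)) i := a :* (z ⌟′ v) i :+ b :* (z ⌟′ w) i) ≡.refl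

  -- With the antisymmetry of β this says that `z ⌟_` is self-adjoint.
  β-⌟ : ∀ z v w → β (z ⌟ v) w ≈ - β (z ⌟ w) v
  β-⌟ z v w = solve 13 (λ z₀ z₁ z₂ z₃ z₄ v₀ v₁ v₂ v₃ w₀ w₁ w₂ w₃ →
      let z = z₀ ∷ z₁ ∷ z₂ ∷ z₃ ∷ z₄ ∷ [] ; v = v₀ ∷ v₁ ∷ v₂ ∷ v₃ ∷ [] ; w = w₀ ∷ w₁ ∷ w₂ ∷ w₃ ∷ [] in
      β′ (z ⌟′ v) w := :- β′ (z ⌟′ w) v) refl
    (z 0F) (z 1F) (z 2F) (z 3F) (z 4F) (v 0F) (v 1F) (v 2F) (v 3F) (w 0F) (w 1F) (w 2F) (w 3F)

  plücker-linear : ∀ a b v x y → plücker v (a *⁴ x +⁴ b *⁴ y) ≋ (a *⁵ plücker v x +⁵ b *⁵ plücker v y)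
  plücker-linear a b v x y = λ { 0F → h 0F ; 1F → h 1F ; 2F → h 2F ; 3F → h 3F ; 4F → h 4F }
    where
    h = components (a Vec.∷ b Vec.∷ (Vec.tabulate v Vec.++ Vec.tabulate x Vec.++ Vec.tabulate y))
      (let a = var 0F ; b = var 1F
           v = variables 2 4 8 ; x = variables 6 4 4 ; y = variables 10 4 0 in λ i →
        plücker′ v (λ i → a :* x i :+ b :* y i) i := a :* plücker′ v x i :+ b :* plücker′ v y i) ≡.refl

  plücker-determinant : ∀ a b c d x y →
                        plücker (a *⁴ x +⁴ b *⁴ y) (c *⁴ x +⁴ d *⁴ y) ≋ ((a * d - b * c) *⁵ plücker x y)
  plücker-determinant a b c d x y = λ { 0F → h 0F ; 1F → h 1F ; 2F → h 2F ; 3F → h 3F ; 4F → h 4F }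
    where
    h = components (a Vec.∷ b Vec.∷ c Vec.∷ d Vec.∷ (Vec.tabulate x Vec.++ Vec.tabulate y))
      (let a = var 0F ; b = var 1F ; c = var 2F ; d = var 3F
           x = variables 4 4 4 ; y = variables 8 4 0 in λ i →
        plücker′ (λ i → a :* x i :+ b :* y i) (λ i → c :* x i :+ d :* y i) i := (a :* d :- b :* c)
            :* plücker′ x y i) ≡.refl

  private
    -‿*0 : ∀ {a b c} → b ≈ 0# → a - b * c ≈ a
    -‿*0 {a} {b} {c} b≈0 = trans (+-congˡ (-‿cong (trans (*-congʳ b≈0) (zeroˡ c))))
      (solve 1 (λ a → a :- con (+ 0) := a) refl a)

  -- For singular z the matrix squares to zero and its image is the line represented by z, so two
  -- vectors of the image have Plücker coordinates proportional to z.
  plücker-⌟ : ∀ {z} v w → Q z ≈ 0# → plücker (z ⌟ v) (z ⌟ w) ≋ (β (z ⌟ v) w *⁵ z)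
  plücker-⌟ {z} v w Qz≈0 i = trans (identity i) (-‿*0 Qz≈0)
    where
    -- As a polynomial identity the claim holds only up to a multiple of Q z; this is the cofactor.
    remainder : V⁵
    remainder = plücker v w 0F ∷ plücker v w 1F ∷ plücker v w 2F ∷ plücker v w 3F ∷ plücker v w 4F - β
        v w ∷ []
    h = components (Vec.tabulate z Vec.++ Vec.tabulate v Vec.++ Vec.tabulate w)
      (let z = variables 0 5 8 ; v = variables 5 4 4 ; w = variables 9 4 0 in λ i →
        plücker′ (z ⌟′ v) (z ⌟′ w) i := β′ (z ⌟′ v) w :* z i :- Q′ z :* (
          plücker′ v w 0F ∷ plücker′ v w 1F ∷ plücker′ v w 2F ∷ plücker′ v w 3F ∷ plücker′ v w 4F :- β′ v
              w ∷ []) i) ≡.refl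
    identity : ∀ i → plücker (z ⌟ v) (z ⌟ w) i ≈ β (z ⌟ v) w * z i - Q z * remainder i
    identity = λ { 0F → h 0F ; 1F → h 1F ; 2F → h 2F ; 3F → h 3F ; 4F → h 4F }

  ⌟-plücker : ∀ {x y} v → x ⊥ y → (plücker x y ⌟ v) ≋ (β x v *⁴ y +⁴ (- β y v) *⁴ x)
  ⌟-plücker {x} {y} v x⊥y i = trans (identity i) (-‿*0 (β≈0 x⊥y))
    where
    -- The cofactor of β x y, a term that disappears by x ⊥ y.
    remainder : V⁴
    remainder = 0# ∷ 0# ∷ v 2F ∷ v 3F ∷ []
    h = components (Vec.tabulate x Vec.++ Vec.tabulate y Vec.++ Vec.tabulate v)
      (let x = variables 0 4 8 ; y = variables 4 4 4 ; v = variables 8 4 0 in λ i →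
        (plücker′ x y ⌟′ v) i := (β′ x v :* y i :+ :- β′ y v :* x i) :- β′ x y
            :* (con (+ 0) ∷ con (+ 0) ∷ v 2F ∷ v 3F ∷ [])
            i) ≡.refl
    identity : ∀ i → (plücker x y ⌟ v) i ≈ (β x v * y i + - β y v * x i) - β x y * remainder i
    identity = λ { 0F → h 0F ; 1F → h 1F ; 2F → h 2F ; 3F → h 3F }

-- The duality between W(q) and Q(4,q).

module KleinDuality {q : ℕ} (F : Field) (order : HasOrder F q) (1<q : 1 < q) where

  open CommutativeRing (commutativeRingOf F) hiding (zero)
  open Geometry F
  open FiniteField F order
  open CoordinateSpaces F
  open SymplecticSpace F order 1<q
  open Klein F order 1<q
  open IntegerCoefficientSolver (commutativeRingOf F)
    using (_:*_; _:+_; con; :-_; _:-_; solve; _:=_)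
  open KSubspace using (subspace)

  private
    module A = LinearAlgebra F order 1<q F⁴ (pointwise-≟ order)
    module B = LinearAlgebra F order 1<q F⁵ (pointwise-≟ order)
    module W = IncidenceStructure symplecticQuadrangle
    module 𝒬 = IncidenceStructure parabolicQuadric

  open A using () renaming (_∈_ to infix 4 _∈⁴_)
  open B using () renaming (_∈_ to infix 4 _∈⁵_)
  open LeftModule F⁴ renaming (Carrierᴹ to V⁴; _≈ᴹ_ to _≈⁴_; _+ᴹ_ to _+⁴_; _*ₗ_ to _*⁴_; 0ᴹ to 0⁴) using ()
  open LeftModule F⁵ renaming (Carrierᴹ to V⁵; _≈ᴹ_ to _≈⁵_; _+ᴹ_ to _+⁵_; _*ₗ_ to _*⁵_; 0ᴹ to 0⁵) using ()

  ⌟-isLinearʳ : ∀ z → IsLinear F {F⁴} {F⁴} (z ⌟_)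
  ⌟-isLinearʳ z = record { cong = ⌟-congʳ z ; linearity = λ a b v w → ⌟-linearʳ a b z v w }

  ⌟-isLinearˡ : ∀ v → IsLinear F {F⁵} {F⁴} (_⌟ v)
  ⌟-isLinearˡ v = record { cong = ⌟-congˡ v ; linearity = λ a b z w → ⌟-linearˡ a b z w v }

  plücker-isLinear : ∀ v → IsLinear F {F⁴} {F⁵} (plücker v)
  plücker-isLinear v = record
    { cong    = λ {x} {y} x≋y → plücker-cong {v} {x} {v} {y} (λ _ → refl) x≋y
    ; linearity = λ a b x y → plücker-linear a b v x y
    }

  kernel : V⁵ → Subspace F⁴
  kernel z = IsLinear.preimage (⌟-isLinearʳ z) A.zeroSubspace

  annihilator : V⁴ → Subspace F⁵
  annihilator v = IsLinear.preimage (⌟-isLinearˡ v) A.zeroSubspace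

  partners : V⁴ → Subspace F⁵ → Subspace F⁴
  partners v X = IsLinear.preimage (plücker-isLinear v) X

  plücker-diagonal : ∀ v → plücker v v ≋ 0⁵
  plücker-diagonal v = λ { 0F → minor 0F 2F ; 1F → minor 1F 3F ; 2F → minor 0F 3F ; 3F → minor 2F 1F ; 4F →
      minor 0F 1F }
    where
    minor : ∀ i j → v i * v j - v j * v i ≈ 0#
    minor i j = solve 2 (λ a b → a :* b :- b :* a := con (+ 0)) refl (v i) (v j)

  Pair : V⁴ → V⁴ → Set
  Pair x y = A.Independent (x ∷ y ∷ [])

  plücker∋ˡ : ∀ {x y} → x ⊥ y → x ∈⁴ kernel (plücker x y)
  plücker∋ˡ {x} {y} x⊥y i = trans (⌟-plücker {x} {y} x x⊥y i)
    (trans (+-cong (trans (*-congʳ (β-diagonal x)) (zeroˡ _))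
        (trans (*-congʳ (trans (-‿cong (β≈0 (⊥-sym {x} {y} x⊥y))) -0≈0)) (zeroˡ _))) (+-identityˡ 0#))

  plücker∋ʳ : ∀ {x y} → x ⊥ y → y ∈⁴ kernel (plücker x y)
  plücker∋ʳ {x} {y} x⊥y i = trans (⌟-plücker {x} {y} y x⊥y i)
    (trans (+-cong (trans (*-congʳ (β≈0 x⊥y)) (zeroˡ _))
        (trans (*-congʳ (trans (-‿cong (β-diagonal y)) -0≈0)) (zeroˡ _))) (+-identityˡ 0#))

  span⊆kernel : ∀ {x y} → x ⊥ y → A.span (x ∷ y ∷ []) ≤ₛ kernel (plücker x y)
  span⊆kernel {x} {y} x⊥y = A.span-least (kernel (plücker x y)) (x ∷ y ∷ [])
    λ { 0F → plücker∋ˡ {x} {y} x⊥y ; 1F → plücker∋ʳ {x} {y} x⊥y }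

  -- By `⌟-plücker` a kernel vector v satisfies (β x v) y = (β y v) x, so it is orthogonal to x and
  -- y, and ⟨x,y⟩ is maximal totally isotropic.
  kernel⊆span : ∀ {x y} → Pair x y → x ⊥ y → kernel (plücker x y) ≤ₛ A.span (x ∷ y ∷ [])
  kernel⊆span {x} {y} xy x⊥y {v} v∈ = isotropic-maximal xy x⊥y
      (orthogonally (coefficients 1F)) (orthogonally (trans (solve 1 (λ a → a := :- (:- a)) refl (β y v))
          (trans (-‿cong (coefficients 0F)) -0≈0)))
    where
    coefficients : ∀ i → (- β y v ∷ β x v ∷ []) i ≈ 0#
    coefficients = A.only-trivially xy (- β y v ∷ β x v ∷ []) λ i → trans
      (solve 2 (λ a b → b :+ (a :+ con (+ 0)) := a :+ b) refl (β x v * y i) (- β y v * x i))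
      (trans (sym (⌟-plücker {x} {y} v x⊥y i)) (v∈ i))

  -- If the coordinates vanished, the kernel would be all of F⁴, inside the span of two vectors.
  plücker-nonzero : ∀ {x y} → Pair x y → x ⊥ y → ¬ (plücker x y ≋ 0⁵)
  plücker-nonzero {x} {y} xy x⊥y pl≋0 = A.steinitz (s<s (s<s z<s)) unit (x ∷ y ∷ [])
    (λ i → kernel⊆span xy x⊥y (Subspace.respects (annihilator (unit i)) {0⁵} (λ j → sym (pl≋0 j))
        (Subspace.0-closed (annihilator (unit i)))))
    (A.independent {v = unit} (Basis.independent F⁴-dimension))

  plücker-proportional : ∀ {x y u w} → u ∈⁴ A.span (x ∷ y ∷ []) → w ∈⁴ A.span (x ∷ y ∷ []) →
                         ∃[ d ] plücker u w ≋ (d *⁵ plücker x y)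
  plücker-proportional {x} {y} {u} {w} (a , u≋) (b , w≋) = _ , λ i → trans
    (plücker-cong {u} {w} {a 0F *⁴ x +⁴ a 1F *⁴ y} {b 0F *⁴ x +⁴ b 1F *⁴ y}
        (λ j → trans (u≋ j) (+-congˡ (+-identityʳ _))) (λ j → trans (w≋ j) (+-congˡ (+-identityʳ _))) i)
    (plücker-determinant (a 0F) (a 1F) (b 0F) (b 1F) x y i)

  -- A basis of the kernel of z. Its Plücker coordinates recover z only up to a factor, hence
  -- `scale`.
  record LineOf (z : V⁵) : Set where
    field
      {x y}  : V⁴
      pair   : Pair x y
      x⊥y    : x ⊥ y
      scale  : Carrier
      scale≉0 : ¬ (scale ≈ 0#)
      plücker≋ : plücker x y ≋ (scale *⁵ z)

    span⊆ : A.span (x ∷ y ∷ []) ≤ₛ kernel z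
    span⊆ {v} v∈ = B.unscale (annihilator v) {scale} {z} scale≉0
      (Subspace.respects (annihilator v) {plücker x y} plücker≋ (span⊆kernel {x} {y} x⊥y {v} v∈))

    ⊆span : kernel z ≤ₛ A.span (x ∷ y ∷ [])
    ⊆span {v} v∈ = kernel⊆span pair x⊥y {v} (Subspace.respects (annihilator v) {scale *⁵ z} {plücker x y}
      (λ i → sym (plücker≋ i)) (Subspace.*ₗ-closed (annihilator v) scale {z} v∈))

  ⌟-faithful : ∀ {z} → (∀ j → (z ⌟ unit j) ≋ 0⁴) → z ≋ 0⁵
  ⌟-faithful {z} z⌟≋0 = λ where
    0F → trans (solve 5 (λ a b c d e → a := a :* con (+ 1) :+ d :* con (+ 0) :- e :* con (+ 0)) refl (z 0F)
        (z 1F) (z 2F) (z 3F) (z 4F)) (z⌟≋0 1F 2F)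
    1F → trans (solve 5 (λ a b c d e → b := :- (c :* con (+ 0) :- b :* con (+ 1) :- e :* con (+ 0))) refl
        (z 0F) (z 1F) (z 2F) (z 3F) (z 4F)) (trans (-‿cong (z⌟≋0 0F 3F)) -0≈0)
    2F → trans (solve 5 (λ a b c d e → c := c :* con (+ 1) :- b :* con (+ 0) :- e :* con (+ 0)) refl (z 0F)
        (z 1F) (z 2F) (z 3F) (z 4F)) (z⌟≋0 1F 3F)
    3F → trans (solve 5 (λ a b c d e → d := a :* con (+ 0) :+ d :* con (+ 1) :- e :* con (+ 0)) refl (z 0F)
        (z 1F) (z 2F) (z 3F) (z 4F)) (z⌟≋0 0F 2F)
    4F → trans (solve 5 (λ a b c d e → e := e :* con (+ 1) :- a :* con (+ 0) :+ c :* con (+ 0)) refl (z 0F)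
        (z 1F) (z 2F) (z 3F) (z 4F)) (z⌟≋0 0F 0F)

  -- A separate identity, because in characteristic 2 it does not follow from the antisymmetry in
  -- `β-⌟`.
  β-⌟-diagonal : ∀ z v → v ⊥ (z ⌟ v)
  β-⌟-diagonal z v = orthogonally (solve 9 (λ a b c d e v₀ v₁ v₂ v₃ →
    v₀ :* (e :* v₁ :+ d :* v₃ :+ b :* v₂) :- v₁ :* (e :* v₀ :- a :* v₃ :+ c :* v₂)
      :+ v₂ :* (c :* v₁ :- b :* v₀ :- e :* v₃) :- v₃ :* (a :* v₁ :+ d :* v₀ :- e :* v₂) := con (+ 0)) refl
    (z 0F) (z 1F) (z 2F) (z 3F) (z 4F) (v 0F) (v 1F) (v 2F) (v 3F))

  ⌟-squared-zero : ∀ {z} v → Q z ≈ 0# → (z ⌟ z ⌟ v) ≋ 0⁴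
  ⌟-squared-zero {z} v Qz≈0 i = trans (⌟-⌟ z v i) (trans (*-congʳ Qz≈0) (zeroˡ _))

  -- The line is the image of `z ⌟_`. Choose v with u = z ⌟ v nonzero and w not orthogonal to u.
  -- Then v ⊥ u, whereas self-adjointness shows that v is not orthogonal to z ⌟ w, so u and z ⌟ w
  -- are independent; they are orthogonal because the matrix squares to zero.
  line-of : ∀ {z} → ¬ (z ≋ 0⁵) → Q z ≈ 0# → LineOf z
  line-of {z} z≉0 Qz≈0 = from-column (Fin.¬∀⟶∃¬ 4 (λ j → (z ⌟ unit j) ≋ 0⁴)
      (λ j → pointwise-≟ order (z ⌟ unit j) 0⁴) (z≉0 ∘ ⌟-faithful {z}))
    where
    from-column : ∃[ j ] ¬ ((z ⌟ unit j) ≋ 0⁴) → LineOf z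
    from-column (j , u≉0) = from-partner (nonorthogonal {u} u≉0)
      where
      v u : V⁴
      v = unit j
      u = z ⌟ v
      from-partner : ∃[ w ] ¬ (u ⊥ w) → LineOf z
      from-partner (w , ¬u⊥w) = record
        { x = u ; y = z ⌟ w
        ; pair     = A.independent λ a eq →
            let b≈0 = ⟂-coefficient {v} {z ⌟ w} {a 1F} ¬v⊥zw (⟂-cancel {v} {a 0F *⁴ u} {a 1F *⁴ (z ⌟ w)}
                        (⊥-resp {v} {0⁴} {a 0F *⁴ u +⁴ a 1F *⁴ (z ⌟ w)}
                            (λ i → sym (trans (+-congˡ (sym (+-identityʳ _))) (eq i)))
                            (Subspace.0-closed (orthogonal v)))
                        (⊥-* (a 0F) {v} {u} (β-⌟-diagonal z v)))
                a≈0 = decidable-stable (a 0F ≟ 0#) λ a≉0 → u≉0 λ i →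
                    *-cancel a≉0 (trans (sym (+-identityʳ _))
                        (trans (+-congˡ (sym (trans (+-congʳ (trans (*-congʳ b≈0) (zeroˡ _)))
                            (+-identityˡ 0#)))) (eq i)))
            in λ { 0F → a≈0 ; 1F → b≈0 }
        ; x⊥y      = orthogonally
            (trans (β-⌟ z v (z ⌟ w)) (trans
            (-‿cong (trans (β-cong {z ⌟ z ⌟ w} {v} {0⁴} {v} (⌟-squared-zero {z} w Qz≈0) (λ _ → refl))
                       (β≈0 (⊥-sym {v} {0⁴} (Subspace.0-closed (orthogonal v)))))) -0≈0))
        ; scale    = β u w
        ; scale≉0  = ¬u⊥w ∘ orthogonally
        ; plücker≋ = plücker-⌟ {z} v w Qz≈0
        }
        where
        ¬v⊥zw : ¬ (v ⊥ (z ⌟ w))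
        ¬v⊥zw p = ¬u⊥w (orthogonally (trans (β-⌟ z v w) (trans (-‿cong (β≈0 (⊥-sym {v} {z ⌟ w} p))) -0≈0)))

  plückerOf : W.Line → V⁵
  plückerOf l = plücker (m₀ l) (m₁ l)

  line≐kernel : ∀ l → LineOf (plückerOf l)
  line≐kernel l = record
    { pair = m-pair l ; x⊥y = m₀⊥m₁ l ; scale = 1# ; scale≉0 = 1≉0 1<q ; plücker≋ = λ i →
        sym (*-identityˡ _) }

  singular : ∀ {P : ProjectivePoint F⁵} {z} → subspace P ≤ₛ B.span (z ∷ []) → Q z ≈ 0# → Singular P
  singular {z = z} P⊆ Qz≈0 x∈P = let k , x≋ = P⊆ x∈P in
    trans (Q-cong (λ i → trans (x≋ i) (+-identityʳ _)))
      (trans (Q-* (k 0F) z) (trans (*-congˡ Qz≈0) (zeroʳ _)))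

  Q-plücker≈0 : ∀ {x y} → x ⊥ y → Q (plücker x y) ≈ 0#
  Q-plücker≈0 {x} {y} x⊥y = trans (Q-plücker x y) (trans (*-congˡ (β≈0 x⊥y)) (zeroʳ _))

  line→point : W.Line → 𝒬.Point
  line→point l = P , singular {P} {plückerOf l} (λ x∈ → x∈) (Q-plücker≈0 {m₀ l} {m₁ l} (m₀⊥m₁ l))
    where
    P : ProjectivePoint F⁵
    P = B.spanned (plückerOf l ∷ []) (B.nonzero-independent (plücker-nonzero (m-pair l) (m₀⊥m₁ l)))

  generator : 𝒬.Point → V⁵
  generator (P , _) = B.vectors P 0F

  generator≉0 : ∀ x → ¬ (generator x ≋ 0⁵)
  generator≉0 (P , _) = B.independent-nonzero {v = B.vectors P}
    (B.independent {v = B.vectors P} (Basis.independent (KSubspace.basis P))) 0F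

  Q-generator : ∀ x → Q (generator x) ≈ 0#
  Q-generator (P , P-singular) = P-singular (B.vectors∈ P 0F)

  point⊆ : ∀ x {z} → z ∈⁵ subspace (proj₁ x) → ∃[ k ] z ≋ (k *⁵ generator x)
  point⊆ (P , _) z∈ = let k , z≋ = Basis.spanning (KSubspace.basis P) z∈ in k 0F , λ i →
      trans (z≋ i) (+-identityʳ _)

  generator-line : ∀ x → LineOf (generator x)
  generator-line x = line-of {generator x} (generator≉0 x) (Q-generator x)

  point→line : 𝒬.Point → W.Line
  point→line x = A.spanned _ L.pair , λ {u} {v} u∈ v∈ → β≈0 (isotropic-span {L.x} {L.y} {u} {v} L.x⊥y u∈ v∈)
    where module L = LineOf (generator-line x)

  line→point-≤ : ∀ l l′ → proj₁ l′ ≤ proj₁ l → proj₁ (line→point l′) ≤ proj₁ (line→point l)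
  line→point-≤ l l′ l′≤l = B.span-least (subspace (proj₁ (line→point l))) (plückerOf l′ ∷ []) λ where
    0F → let d , eq = plücker-proportional {m₀ l} {m₁ l} {m₀ l′} {m₁ l′}
               (line⊆ l (l′≤l (m₀∈ l′))) (line⊆ l (l′≤l (m₁∈ l′)))
         in (d ∷ []) , λ i → trans (eq i) (sym (+-identityʳ _))

  point→line-≤ : ∀ x x′ → proj₁ x′ ≤ proj₁ x → proj₁ (point→line x) ≤ proj₁ (point→line x′)
  point→line-≤ x x′ x′≤x {v} v∈ =
    let k , z′≋kz = point⊆ x (x′≤x (B.vectors∈ (proj₁ x′) 0F)) in
    LineOf.⊆span (generator-line x′) {v} (Subspace.respects (annihilator v) {k *⁵ generator x}
        (λ i → sym (z′≋kz i))
      (Subspace.*ₗ-closed (annihilator v) k {generator x} (LineOf.span⊆ (generator-line x) {v} v∈)))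

  line-point-line : ∀ l → point→line (line→point l) W.≈ₗ l
  line-point-line l =
    (λ {v} v∈ → ⊆line l {v} (LineOf.⊆span (line≐kernel l) {v} (LineOf.span⊆ (generator-line (line→point l))
        {v} v∈))) ,
    (λ {v} v∈ → LineOf.⊆span (generator-line (line→point l)) {v} (LineOf.span⊆ (line≐kernel l) {v}
        (line⊆ l {v} v∈)))

  point-line-point : ∀ x → line→point (point→line x) 𝒬.≈ₚ x
  point-line-point x =
    B.span-least (subspace (proj₁ x)) (plücker L.x L.y ∷ [])
      (λ { 0F → Subspace.respects (subspace (proj₁ x)) (λ i → sym (L.plücker≋ i))
                  (Subspace.*ₗ-closed (subspace (proj₁ x)) L.scale (B.vectors∈ (proj₁ x) 0F)) }) ,
    λ z∈ → let k , z≋ = point⊆ x z∈ in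
      Subspace.respects X (λ i → sym (z≋ i))
          (Subspace.*ₗ-closed X k (B.unscale X {L.scale} {generator x} L.scale≉0
        (Subspace.respects X {plücker L.x L.y} L.plücker≋ (B.∈span (plücker L.x L.y ∷ []) 0F))))
    where
    module L = LineOf (generator-line x)
    X = B.span (plücker L.x L.y ∷ [])

  module Pencil {v u u′ : V⁴} (vuu′ : A.Independent (v ∷ u ∷ u′ ∷ [])) (v⊥u : v ⊥ u) (v⊥u′ : v ⊥ u′) where

    -- Otherwise v would be orthogonal to the four vectors of a basis and vanish.
    polar⊆ : ∀ {w} → v ⊥ w → w ∈⁴ A.span (v ∷ u ∷ u′ ∷ [])
    polar⊆ {w} v⊥w = decidable-stable (A._∈span?_ w (v ∷ u ∷ u′ ∷ [])) λ w∉ →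
      A.independent-nonzero {v = v ∷ u ∷ u′ ∷ []} vuu′ 0F
        (four-orthogonal {v} {w ∷ v ∷ u ∷ u′ ∷ []} (A.extend {v = w ∷ v ∷ u ∷ u′ ∷ []} vuu′ w∉)
          λ { 0F → v⊥w ; 1F → ⊥-refl {v} ; 2F → v⊥u ; 3F → v⊥u′ })

    -- The lines of W(q) through ⟨v⟩ are the lines through it in the polar plane ⟨v,u,u′⟩. Plücker
    -- coordinates are linear in the second vector, so these lines become the points of one line of
    -- PG(4,q).
    pencil : Vector V⁵ 2
    pencil = plücker v u ∷ plücker v u′ ∷ []

    pencil⊆annihilator : B.span pencil ≤ₛ annihilator v
    pencil⊆annihilator = B.span-least (annihilator v) pencil λ { 0F → plücker∋ˡ {v} {u} v⊥u ; 1F →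
        plücker∋ˡ {v} {u′} v⊥u′ }

    combination≋ : ∀ a b → plücker v (a *⁴ u +⁴ b *⁴ u′) ≋ (a *⁵ plücker v u +⁵ b *⁵ plücker v u′)
    combination≋ a b = plücker-linear a b v u u′

    v⊥combination : ∀ a b → v ⊥ (a *⁴ u +⁴ b *⁴ u′)
    v⊥combination a b = ⊥-+ {v} {a *⁴ u} {b *⁴ u′} (⊥-* a {v} {u} v⊥u) (⊥-* b {v} {u′} v⊥u′)

    Q-pencil : ∀ {z} → z ∈⁵ B.span pencil → Q z ≈ 0#
    Q-pencil {z} (c , z≋) = trans
      (Q-cong {z} {plücker v (c 0F *⁴ u +⁴ c 1F *⁴ u′)}
          (λ i → trans (z≋ i) (trans (+-congˡ (+-identityʳ _)) (sym (combination≋ (c 0F) (c 1F) i)))))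
      (Q-plücker≈0 {v} {c 0F *⁴ u +⁴ c 1F *⁴ u′} (v⊥combination (c 0F) (c 1F)))

    -- A vanishing combination is `plücker v w` with w = c₀ u + c₁ u′. Applied to some f not
    -- orthogonal to v it gives (β v f) w = (β w f) v, which the independence of v, u, u′ allows
    -- only for c = 0.
    pencil-independent : B.Independent pencil
    pencil-independent = B.independent λ c eq →
      let w = c 0F *⁴ u +⁴ c 1F *⁴ u′
          f , ¬v⊥f = nonorthogonal {v} (A.independent-nonzero {v = v ∷ u ∷ u′ ∷ []} vuu′ 0F)
          k = β v f
          k≉0 = ¬v⊥f ∘ orthogonally
          w⌟f≋0 = Subspace.respects (annihilator f) {0⁵} {plücker v w}
                    (λ i → sym (trans (combination≋ (c 0F) (c 1F) i) (trans (+-congˡ (sym (+-identityʳ _)))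
                        (eq i))))
                    (Subspace.0-closed (annihilator f))
          zero-combination = λ i → trans
            (solve 7 (λ b x k a₀ u a₁ u′ → b :* x :+ ((k :* a₀) :* u :+ ((k :* a₁) :* u′ :+ con (+ 0)))
                := k :* (a₀ :* u :+ a₁ :* u′) :+ b :* x) refl
              (- β w f) (v i) k (c 0F) (u i) (c 1F) (u′ i))
            (trans (sym (⌟-plücker {v} {w} f (v⊥combination (c 0F) (c 1F)) i)) (w⌟f≋0 i))
          coefficients = A.only-trivially vuu′ (- β w f ∷ k * c 0F ∷ k * c 1F ∷ []) zero-combination
      in λ { 0F → *-cancel k≉0 (coefficients 1F) ; 1F → *-cancel k≉0 (coefficients 2F) }

    -- P and m are specified up to mutual inclusion, to serve both directions: m is the pencil
    -- itself for `dual-line`, and a given line that turns out to be the pencil for the dual point.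
    module _ (P : ProjectivePoint F⁴) (P≐v : ∀ X → (subspace P ≤ₛ X → v ∈⁴ X) × (v ∈⁴ X → subspace P ≤ₛ X))
             (m : ProjectiveLine F⁵) (m⊆ : subspace m ≤ₛ B.span pencil)
                 (⊆m : B.span pencil ≤ₛ subspace m) where

      I⇒ : ∀ l → P ≤ proj₁ l → proj₁ (line→point l) ≤ m
      I⇒ l P≤l = from-second (A.member-outside (proj₁ l) (ℕ.n<1+n 1) (v ∷ []))
        where
        v∈l : v ∈⁴ subspace (proj₁ l)
        v∈l = proj₁ (P≐v (subspace (proj₁ l))) P≤l
        from-second : ∃[ w ] w ∈⁴ subspace (proj₁ l) × ¬ (w ∈⁴ A.span (v ∷ [])) → proj₁ (line→point l) ≤ m
        from-second (w , w∈l , w∉) = B.span-least (subspace m) (plückerOf l ∷ []) λ where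
            -- The factor d passes from the chosen basis of l to w, v, and d′ accounts for
            -- exchanging w and v.
            0F → let d , eq = plücker-proportional {w} {v} {m₀ l} {m₁ l} (l⊆ (m₀∈ l)) (l⊆ (m₁∈ l))
                     d′ , eq′ = plücker-proportional {v} {w} {w} {v} (A.∈span (v ∷ w ∷ []) 1F)
                         (A.∈span (v ∷ w ∷ []) 0F)
                 in Subspace.respects (subspace m) {d *⁵ (d′ *⁵ plücker v w)}
                      (λ i → sym (trans (eq i) (*-congˡ (eq′ i))))
                      (Subspace.*ₗ-closed (subspace m) d (Subspace.*ₗ-closed (subspace m) d′ plücker-vw∈m))
          where
          wv : Pair w v
          wv = A.extend {v = w ∷ v ∷ []}
              (A.nonzero-independent {v} (A.independent-nonzero {v = v ∷ u ∷ u′ ∷ []} vuu′ 0F)) w∉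
          l⊆ : ∀ {x} → x ∈⁴ subspace (proj₁ l) → x ∈⁴ A.span (w ∷ v ∷ [])
          l⊆ {x} = A.independent-spans (proj₁ l) {v = w ∷ v ∷ []} wv (λ { 0F → w∈l ; 1F → v∈l }) {x}
          plücker-vw∈m : plücker v w ∈⁵ subspace m
          plücker-vw∈m = A.span-least (partners v (subspace m)) (v ∷ u ∷ u′ ∷ [])
            (λ { 0F → Subspace.respects (subspace m) (λ i → sym (plücker-diagonal v i))
                (Subspace.0-closed (subspace m))
               ; 1F → ⊆m (B.∈span pencil 0F) ; 2F → ⊆m (B.∈span pencil 1F) })
            {w} (polar⊆ {w} (orthogonally (proj₂ l v∈l w∈l)))

      ⇒I : ∀ l → proj₁ (line→point l) ≤ m → P ≤ proj₁ l
      ⇒I l fl≤m = proj₂ (P≐v (subspace (proj₁ l))) (⊆line l {v} (LineOf.⊆span (line≐kernel l) {v}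
        (pencil⊆annihilator {plückerOf l} (m⊆ (fl≤m (B.∈span (plückerOf l ∷ []) 0F))))))

  first : ProjectivePoint F⁴ → V⁴
  first P = A.vectors P 0F

  first≉0 : ∀ P → ¬ (first P ≋ 0⁴)
  first≉0 P = A.independent-nonzero {v = A.vectors P}
    (A.independent {v = A.vectors P} (Basis.independent (KSubspace.basis P))) 0F

  ≤⇔first∈ : ∀ P (X : Subspace F⁴) → (subspace P ≤ₛ X → first P ∈⁴ X) × (first P ∈⁴ X → subspace P ≤ₛ X)
  ≤⇔first∈ P X = (λ P≤X → P≤X (A.vectors∈ P 0F)) , λ v∈X {x} → A.≤-from-basis P X (λ { 0F → v∈X }) {x}

  record PencilBasis (v : V⁴) : Set where
    field
      {u u′} : V⁴
      independent : A.Independent (v ∷ u ∷ u′ ∷ [])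
      v⊥u         : v ⊥ u
      v⊥u′        : v ⊥ u′

    open Pencil independent v⊥u v⊥u′ public

  -- Complete v to a hyperbolic pair v, f. A further hyperbolic pair in its complement spans the
  -- polar plane of v together with v.
  pencil-basis : ∀ {v} → ¬ (v ≋ 0⁴) → PencilBasis v
  pencil-basis {v} v≉0 = from-partner (nonorthogonal {v} v≉0)
    where
    nd : NonDegenerate (wholeSpace F⁴)
    nd {x} _ x≉0 = let y , ¬x⊥y = nonorthogonal {x} x≉0 in y , _ , ¬x⊥y
    from-partner : ∃[ f ] ¬ (v ⊥ f) → PencilBasis v
    from-partner (f , ¬v⊥f) = from-pair (new-pair frame F⁴-dimension (s<s (s<s z<s)))
      where
      frame : Frame (v ∷ f ∷ []) (complement v f (wholeSpace F⁴))
      frame = extend-frame {u = []} {Z = wholeSpace F⁴} {e = v} {f = f} (trivial-frame (λ {x} → nd {x}))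
          _ _ ¬v⊥f
      from-pair : (∃₂ λ e₁ f₁ → e₁ ∈⁴ complement v f (wholeSpace F⁴) × f₁ ∈⁴ complement v f (wholeSpace F⁴)
          × ¬ (e₁ ⊥ f₁)) → PencilBasis v
      from-pair (e₁ , f₁ , e₁∈ , f₁∈ , ¬e₁⊥f₁) = record
        { independent = A.independent λ c eq →
            let coefficients = A.only-trivially efvf (c 1F ∷ c 2F ∷ c 0F ∷ 0# ∷ []) λ i → trans
                  (solve 7 (λ a b c v e f g →
                      b :* e :+ (c :* f :+ (a :* v :+ (con (+ 0) :* g :+ con (+ 0))))
                          := a :* v :+ (b :* e :+ (c :* f :+ con (+ 0)))) refl
                    (c 0F) (c 1F) (c 2F) (v i) (e₁ i) (f₁ i) (f i)) (eq i)
            in λ { 0F → coefficients 2F ; 1F → coefficients 0F ; 2F → coefficients 1F }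
        ; v⊥u  = proj₁ (proj₂ e₁∈)
        ; v⊥u′ = proj₁ (proj₂ f₁∈)
        }
        where
        efvf : A.Independent (e₁ ∷ f₁ ∷ v ∷ f ∷ [])
        efvf = Frame.frame-independent (extend-frame {u = v ∷ f ∷ []} {Z = complement v f (wholeSpace F⁴)}
            {e = e₁} {f = f₁} frame e₁∈ f₁∈ ¬e₁⊥f₁)

  dual-line : W.Point → 𝒬.Line
  dual-line (P , _) = B.spanned pencil pencil-independent , λ R R≤m {z} z∈R → Q-pencil {z} (R≤m z∈R)
    where open PencilBasis (pencil-basis {first P} (first≉0 P))

  dual-line-I : ∀ p l → (p W.I l → line→point l 𝒬.I dual-line p) × (line→point l 𝒬.I dual-line p → p W.I l)
  dual-line-I p@(P , _) l = (λ P≤l {x} → I⇒ P (≤⇔first∈ P) (proj₁ (dual-line p)) (λ z∈ → z∈) (λ z∈ → z∈) l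
      P≤l {x}) ,
                            (λ fl≤m {x} → ⇒I P (≤⇔first∈ P) (proj₁ (dual-line p)) (λ z∈ → z∈) (λ z∈ → z∈) l
                                fl≤m {x})
    where open PencilBasis (pencil-basis {first P} (first≉0 P))

  -- Any second vector u of the kernel line yields a basis v, u, and the Plücker coordinates of two
  -- bases of one line differ by a factor, nonzero by `plücker-nonzero`.
  second-point : ∀ {z v} → LineOf z → ¬ (v ≋ 0⁴) → (z ⌟ v) ≋ 0⁴ →
                 ∃₂ λ u k → v ⊥ u × ¬ (k ≈ 0#) × plücker v u ≋ (k *⁵ z)
  second-point {z} {v} L v≉0 zv≋0 = from-member (A.member-outside ℓ (ℕ.n<1+n 1) (v ∷ []))
    where
    module L = LineOf L
    ℓ = A.spanned (L.x ∷ L.y ∷ []) L.pair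
    from-member : ∃[ u ] u ∈⁴ subspace ℓ × ¬ (u ∈⁴ A.span (v ∷ [])) →
                  ∃₂ λ u k → v ⊥ u × ¬ (k ≈ 0#) × plücker v u ≋ (k *⁵ z)
    from-member (u , u∈ , u∉) =
      let v∈ = L.⊆span {v} zv≋0
          v⊥u = isotropic-span {L.x} {L.y} {v} {u} L.x⊥y v∈ u∈
          vu = A.independent-swap {u} {v} (A.extend {v = u ∷ v ∷ []} (A.nonzero-independent {v} v≉0) u∉)
          d , eq = plücker-proportional {L.x} {L.y} {v} {u} v∈ u∈
          eq′ : plücker v u ≋ ((d * L.scale) *⁵ z)
          eq′ i = trans (eq i) (trans (*-congˡ (L.plücker≋ i)) (sym (*-assoc _ _ _)))
      in u , d * L.scale , v⊥u ,
         (λ k≈0 → plücker-nonzero vu v⊥u (λ i → trans (eq′ i) (trans (*-congʳ k≈0) (zeroˡ _)))) , eq′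

  module _ (m : 𝒬.Line) where

    private
      X Y : V⁵
      X = B.vectors (proj₁ m) 0F
      Y = B.vectors (proj₁ m) 1F

      XY : B.Independent (X ∷ Y ∷ [])
      XY = B.independent λ a eq → B.only-trivially (B.independent {v = B.vectors (proj₁ m)}
          (Basis.independent (KSubspace.basis (proj₁ m)))) a eq

      X≉0 : ¬ (X ≋ 0⁵)
      X≉0 = B.independent-nonzero {v = X ∷ Y ∷ []} XY 0F

      Y≉0 : ¬ (Y ≋ 0⁵)
      Y≉0 = B.independent-nonzero {v = X ∷ Y ∷ []} XY 1F

      Q-line : ∀ {z} → ¬ (z ≋ 0⁵) → z ∈⁵ subspace (proj₁ m) → Q z ≈ 0#
      Q-line {z} z≉0 z∈ = proj₂ m (B.spanned (z ∷ []) (B.nonzero-independent z≉0))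
        (B.span-least (subspace (proj₁ m)) (z ∷ []) λ { 0F → z∈ }) (B.∈span (z ∷ []) 0F)

      QX≈0 : Q X ≈ 0#
      QX≈0 = Q-line X≉0 (B.vectors∈ (proj₁ m) 0F)

      QY≈0 : Q Y ≈ 0#
      QY≈0 = Q-line Y≉0 (B.vectors∈ (proj₁ m) 1F)

      QX+Y≈0 : Q (X +⁵ Y) ≈ 0#
      QX+Y≈0 = Q-line
        (λ X+Y≋0 → 1≉0 1<q (B.only-trivially XY (1# ∷ 1# ∷ []) (λ i → trans
          (solve 2 (λ x y → con (+ 1) :* x :+ (con (+ 1) :* y :+ con (+ 0)) := x :+ y) refl (X i) (Y i))
              (X+Y≋0 i)) 0F))
        (Subspace.+-closed (subspace (proj₁ m)) (B.vectors∈ (proj₁ m) 0F) (B.vectors∈ (proj₁ m) 1F))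

      ⌟-anticommute : ∀ v → (Y ⌟ v) ≋ 0⁴ → (Y ⌟ X ⌟ v) ≋ 0⁴
      ⌟-anticommute v Yv≋0 i = begin
        (Y ⌟ X ⌟ v) i                          ≈⟨ +-identityˡ _ ⟨
        0# + (Y ⌟ X ⌟ v) i                     ≈⟨ +-congʳ
            (trans (⌟-congʳ X Yv≋0 i) (Subspace.0-closed (kernel X) i)) ⟨
        (X ⌟ Y ⌟ v) i + (Y ⌟ X ⌟ v) i          ≈⟨ ⌟-polar X Y v i ⟩
        (Q (X +⁵ Y) - Q X - Q Y) * v i         ≈⟨ *-congʳ (+-cong (+-cong QX+Y≈0 (-‿cong QX≈0))
            (-‿cong QY≈0)) ⟩
        (0# - 0# - 0#) * v i                   ≈⟨ solve 1 (λ v → (con (+ 0) :- con (+ 0) :- con (+ 0)) :* v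
            := con (+ 0)) refl (v i) ⟩
        0#                                     ∎
        where open ≈-Reasoning setoid

      module LX = LineOf (line-of {X} X≉0 QX≈0)
      module LY = LineOf (line-of {Y} Y≉0 QY≈0)

      -- Otherwise the line of Y would lie in the line of X, and proportional Plücker coordinates
      -- would make X and Y dependent.
      not-both-in-kernel : ¬ (((X ⌟ LY.x) ≋ 0⁴) × ((X ⌟ LY.y) ≋ 0⁴))
      not-both-in-kernel (Xx≋0 , Xy≋0) =
        let d , eq = plücker-proportional {LX.x} {LX.y} {LY.x} {LY.y} (LX.⊆span {LY.x} Xx≋0)
                (LX.⊆span {LY.y} Xy≋0) in
        LY.scale≉0 (trans (solve 1 (λ a → a := :- (:- a)) refl LY.scale) (trans (-‿cong
          (B.only-trivially XY (d * LX.scale ∷ - LY.scale ∷ []) (λ i → begin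
            (d * LX.scale) * X i + (- LY.scale * Y i + 0#)
              ≈⟨ solve 5 (λ d s x t y → (d :* s) :* x :+ (:- t :* y :+ con (+ 0)) := d :* (s :* x) :- t
                  :* y) refl d LX.scale (X i) LY.scale (Y i) ⟩
            d * (LX.scale * X i) - LY.scale * Y i
              ≈⟨ +-cong (trans (*-congˡ (sym (LX.plücker≋ i))) (sym (eq i)))
                  (-‿cong (sym (LY.plücker≋ i))) ⟩
            plücker LY.x LY.y i - plücker LY.x LY.y i
              ≈⟨ -‿inverseʳ _ ⟩
            0# ∎) 1F)) -0≈0))
        where open ≈-Reasoning setoid

    record Meet : Set where
      field
        {v}  : V⁴
        v≉0  : ¬ (v ≋ 0⁴)
        Xv≋0 : (X ⌟ v) ≋ 0⁴
        Yv≋0 : (Y ⌟ v) ≋ 0⁴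

    -- The common point of the two lines is the image X ⌟ v: X kills it because its matrix squares
    -- to zero, and Y kills it because the matrices anticommute and Y kills v.
    meet-at : ∀ v → v ∈⁴ kernel Y → ¬ ((X ⌟ v) ≋ 0⁴) → Meet
    meet-at v Yv≋0 Xv≉0 = record { v≉0 = Xv≉0 ; Xv≋0 = ⌟-squared-zero {X} v QX≈0 ; Yv≋0 =
        ⌟-anticommute v Yv≋0 }

    meet : Meet
    meet = by-cases (pointwise-≟ order (X ⌟ LY.x) 0⁴) (pointwise-≟ order (X ⌟ LY.y) 0⁴)
      where
      by-cases : Dec ((X ⌟ LY.x) ≋ 0⁴) → Dec ((X ⌟ LY.y) ≋ 0⁴) → Meet
      by-cases (no Xx≉0) _ = meet-at LY.x (LY.span⊆ {LY.x} (A.∈span (LY.x ∷ LY.y ∷ []) 0F)) Xx≉0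
      by-cases (yes _) (no Xy≉0) = meet-at LY.y (LY.span⊆ {LY.y} (A.∈span (LY.x ∷ LY.y ∷ []) 1F)) Xy≉0
      by-cases (yes Xx≋0) (yes Xy≋0) = contradiction (Xx≋0 , Xy≋0) not-both-in-kernel

    DualPoint : Set₁
    DualPoint = Σ[ p ∈ W.Point ] (∀ l → (p W.I l → line→point l 𝒬.I m) × (line→point l 𝒬.I m → p W.I l))

    dual-point-at : Meet → DualPoint
    dual-point-at meeting = from-second-points
        (second-point {X} {v} (line-of {X} X≉0 QX≈0) v≉0 Xv≋0) (second-point {Y} {v} (line-of {Y} Y≉0 QY≈0)
            v≉0 Yv≋0)
      where
      open Meet meeting
      from-second-points : (∃₂ λ u k → v ⊥ u × ¬ (k ≈ 0#) × plücker v u ≋ (k *⁵ X)) →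
                           (∃₂ λ u k → v ⊥ u × ¬ (k ≈ 0#) × plücker v u ≋ (k *⁵ Y)) → DualPoint
      from-second-points (u , k , v⊥u , k≉0 , X≋) (u′ , k′ , v⊥u′ , k′≉0 , Y≋) = (P , _) , λ l →
          (λ P≤l {x} → I⇒ P P≐v (proj₁ m) m⊆ ⊆m l (λ {y} → P≤l {y}) {x}) ,
          (λ fl≤m {x} → ⇒I P P≐v (proj₁ m) m⊆ ⊆m l (λ {y} → fl≤m {y}) {x})
        where
        open ≈-Reasoning setoid
        independent : A.Independent (v ∷ u ∷ u′ ∷ [])
        -- Applying `plücker v` to a relation c₀ v + c₁ u + c₂ u′ = 0 kills v and leaves c₁ k X + c₂
        -- k′ Y = 0. Hence c₁ = c₂ = 0, and then c₀ = 0 because v ≠ 0.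
        independent = A.independent λ c eq →
          let coefficients : ∀ i → (c 1F * k ∷ c 2F * k′ ∷ []) i ≈ 0#
              coefficients = B.only-trivially XY (c 1F * k ∷ c 2F * k′ ∷ []) λ i → begin
                (c 1F * k) * X i + ((c 2F * k′) * Y i + 0#)
                  ≈⟨ +-cong (trans (*-assoc _ _ _) (*-congˡ (sym (X≋ i))))
                      (trans (+-identityʳ _) (trans (*-assoc _ _ _) (*-congˡ (sym (Y≋ i))))) ⟩
                c 1F * plücker v u i + c 2F * plücker v u′ i
                  ≈⟨ plücker-linear (c 1F) (c 2F) v u u′ i ⟨
                plücker v (c 1F *⁴ u +⁴ c 2F *⁴ u′) i
                  ≈⟨ IsLinear.cong (plücker-isLinear v) {c 1F *⁴ u +⁴ c 2F *⁴ u′} {(- c 0F) *⁴ v}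
                      (λ j → trans
                       (solve 6 (λ a b c v u w →
                          b :* u :+ c :* w := (a :* v :+ (b :* u :+ (c :* w :+ con (+ 0)))) :+ (:- a)
                              :* v) refl
                         (c 0F) (c 1F) (c 2F) (v j) (u j) (u′ j))
                       (trans (+-congʳ (eq j)) (+-identityˡ _))) i ⟩
                plücker v ((- c 0F) *⁴ v) i
                  ≈⟨ IsLinear.homogeneous (plücker-isLinear v) (- c 0F) v i ⟩
                - c 0F * plücker v v i
                  ≈⟨ trans (*-congˡ (plücker-diagonal v i)) (zeroʳ _) ⟩
                0# ∎
              c₁≈0 = *-cancel k≉0 (trans (*-comm _ _) (coefficients 0F))
              c₂≈0 = *-cancel k′≉0 (trans (*-comm _ _) (coefficients 1F))
              c₀≈0 = decidable-stable (c 0F ≟ 0#) λ c₀≉0 → v≉0 λ i → *-cancel c₀≉0 (begin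
                c 0F * v i
                  ≈⟨ solve 3 (λ a u w → a := a :+ (con (+ 0) :* u :+ (con (+ 0) :* w :+ con (+ 0)))) refl
                      (c 0F * v i) (u i) (u′ i) ⟩
                c 0F * v i + (0# * u i + (0# * u′ i + 0#))
                  ≈⟨ +-congˡ (+-cong (*-congʳ (sym c₁≈0)) (+-congʳ (*-congʳ (sym c₂≈0)))) ⟩
                c 0F * v i + (c 1F * u i + (c 2F * u′ i + 0#))
                  ≈⟨ eq i ⟩
                0# ∎)
          in λ { 0F → c₀≈0 ; 1F → c₁≈0 ; 2F → c₂≈0 }
        open Pencil {v} {u} {u′} independent v⊥u v⊥u′
        P : ProjectivePoint F⁴
        P = A.spanned (v ∷ []) (A.nonzero-independent {v} v≉0)
        P≐v : ∀ Z → (subspace P ≤ₛ Z → v ∈⁴ Z) × (v ∈⁴ Z → subspace P ≤ₛ Z)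
        P≐v = ≤⇔first∈ P
        ⊆m : B.span pencil ≤ₛ subspace (proj₁ m)
        ⊆m = B.span-least (subspace (proj₁ m)) pencil λ where
          0F → Subspace.respects (subspace (proj₁ m)) (λ i → sym (X≋ i))
              (Subspace.*ₗ-closed (subspace (proj₁ m)) k (B.vectors∈ (proj₁ m) 0F))
          1F → Subspace.respects (subspace (proj₁ m)) (λ i → sym (Y≋ i))
              (Subspace.*ₗ-closed (subspace (proj₁ m)) k′ (B.vectors∈ (proj₁ m) 1F))
        m⊆ : subspace (proj₁ m) ≤ₛ B.span pencil
        m⊆ = B.≤-from-basis (proj₁ m) (B.span pencil) λ where
          0F → B.unscale (B.span pencil) {k} {X} k≉0 (Subspace.respects (B.span pencil) {plücker v u} X≋
              (B.∈span pencil 0F))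
          1F → B.unscale (B.span pencil) {k′} {Y} k′≉0 (Subspace.respects (B.span pencil) {plücker v u′} Y≋
              (B.∈span pencil 1F))

    dual-point-with-I : DualPoint
    dual-point-with-I = dual-point-at meet

  klein-duality : PointLineDuality.Duality symplecticQuadrangle parabolicQuadric
  klein-duality = record
    { line→point       = line→point
    ; point→line       = point→line
    ; line→point-cong  = λ {l} {l′} (l≤l′ , l′≤l) →
        (λ {x} → line→point-≤ l′ l (λ {y} → l≤l′ {y}) {x}) ,
            (λ {x} → line→point-≤ l l′ (λ {y} → l′≤l {y}) {x})
    ; point→line-cong  = λ {x} {x′} (x≤x′ , x′≤x) →
        (λ {v} → point→line-≤ x x′ (λ {y} → x′≤x {y}) {v}) ,
            (λ {v} → point→line-≤ x′ x (λ {y} → x≤x′ {y}) {v})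
    ; line-point-line  = line-point-line
    ; point-line-point = point-line-point
    ; dual-line        = dual-line
    ; dual-line-I      = dual-line-I
    ; dual-point       = λ m → proj₁ (dual-point-with-I m)
    ; dual-point-I     = λ m → proj₂ (dual-point-with-I m)
    ; I-respˡ          = λ m (_ , x′≤x) x≤m z∈ → x≤m (x′≤x z∈)
    }

  spreads⇔ovoids : IncidenceStructure.LinesPartitionableIntoSpreads symplecticQuadrangle ⇔
                   IncidenceStructure.PointsPartitionableIntoOvoids parabolicQuadric
  spreads⇔ovoids = PointLineDuality.spreads⇔ovoids symplecticQuadrangle parabolicQuadric klein-duality

theorem1 : ∀ {d : Level} (q : ℕ) → 1 < q → IsPrimePower q → (F : Field) → HasOrder F q →
    let open Geometry F
        a = IncidenceStructure.LinesPartitionableIntoSpreads symplecticQuadrangle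
        b = IncidenceStructure.PointsPartitionableIntoOvoids parabolicQuadric
    in (a ⇔ b) ×
       ((V : VectorSpace) → HasDimension V 7 →
        (D : Pred (KSubspace V 3) d) → IsFanoAnalog D →
        (Σ[ H ∈ KSubspace V 6 ] (∀ (P : ProjectivePoint V) → P ≤ H → IsαPoint D P)) →
        a × b)
theorem1 q 1<q _ F order = a⇔b , λ V dim D fano (H , α) →
    let a = HyperplaneCoordinates.fano⇒lines-partitionable F order 1<q V dim D fano H α
    in a , Equivalence.to a⇔b a
  where
  a⇔b = KleinDuality.spreads⇔ovoids F order 1<q
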